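{- Let $m,\alpha,\beta\ge 1$ be integers with $2\nmid\alpha$, let $c(n)$ be defined by $$\sum_{n=0}^{\infty}c(n)q^n:=f_1^3f_2^6,$$ and let $p\ge 3$ be a prime. Define $$\kappa(p):=c\left(\frac{5(p^2-1)}{8}\right)+p^3\left(\frac{ -\frac54(p^2-1)}{p}\right)_L,$$ and $$\nu(p):=\begin{cases}4,&\text{if }\kappa(p)\equiv 0\pmod 2,\\ 6,&\text{if }\kappa(p)\equiv 1\pmod 2.\end{cases}$$ (1) For all integers $n,k\ge 0$ with $p\nmid n$, $$\bar a_{2^m\alpha}\left(8p^{\nu(p)(k+1)-1}n+5p^{\nu(p)(k+1)}\right)\equiv 0\pmod{2^{m+3}},$$ $$\bar a_{2\beta+1}\left(8p^{\nu(p)(k+1)-1}n+5p^{\nu(p)(k+1)}\right)\equiv 0\pmod{16}.$$ (2) If $\kappa(p)\equiv 1\pmod 2$, then for all integers $n,k\ge 0$ with $p\nmid(8n+5)$, $$\bar a_{2^m\alpha}\left(8p^{6k+2}n+5p^{6k+2}\right)\equiv 0\pmod{2^{m+3}},$$ $$\bar a_{2\beta+1}\left(8p^{6k+2}n+5p^{6k+2}\right)\equiv 0\pmod{16}.$$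
   Context: For integers $\ell\ge1$ write $f_\ell=\prod_{j\ge 1}(1-q^{\ell j})$. For a positive integer $s$, $\bar a_s(n)$ denotes the number of partitions of $n$ in which each odd part occurs in one of $s$ colors and the first occurrence of each part (parts of the same size but different colors being distinct) may be overlined. Equivalently, $$\sum_{n\ge0}\bar a_s(n)q^n=\frac{f_2^{3s-2}}{f_1^{2s}f_4^{s-1}}.$$ $\left(\frac{\cdot}{p}\right)_L$ is the Legendre symbol modulo the odd prime $p$ (equal to $0$ on multiples of $p$). -}

module Defs where

open import Data.Bool.Base using (Bool; true; false; if_then_else_)
import Data.Bool.Properties as Bool
open import Data.Fin.Base using (Fin; toℕ)
open import Data.Fin.Properties using (any?)
open import Data.Integer.Base as ℤ using (ℤ; +_; 0ℤ; 1ℤ; -1ℤ; _%ℕ_)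
import Data.Integer.Divisibility.Signed as ℤ∣
open import Data.Integer.Properties using (+-*-semiring)
open import Algebra.Properties.Semiring.Sum +-*-semiring using (sum-syntax; sum⁺-syntax)
open import Data.List.Base
  using (List; []; _∷_; allFin; cartesianProductWith; concatMap; filter; length; map; upTo)
open import Data.List.Relation.Unary.Linked using (Linked; linked?)
open import Data.Nat.Base
open import Data.Nat.ListAction using (sum)
open import Data.Nat.Properties using (_≟_; _<?_)
open import Data.Product.Base using (_×_)
open import Data.Sum.Base using (_⊎_)
open import Relation.Binary.Definitions using (Decidable)
open import Relation.Binary.PropositionalEquality using (_≡_)
import Relation.Unary as U
open import Relation.Nullary.Decidable using (does; _×-dec_; _⊎-dec_)

------------------------------------------------------------------------
-- Overpartitions in which each odd part comes in s colours

colours : ℕ → ℕ → ℕ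
colours s k = if k % 2 ≡ᵇ 1 then s else 1

record Part (s : ℕ) : Set where
  constructor part
  field
    size      : ℕ
    colour    : Fin (colours s size)
    overlined : Bool

open Part public

-- p ⊒ q : the part q may immediately follow p.  The kinds (size, colour) are
-- listed in weakly decreasing lexicographic order, so that each multiset of
-- kinds has exactly one listing; a repeated kind is not a first occurrence
-- and hence may not be overlined.
_⊒_ : ∀ {s} → Part s → Part s → Set
p ⊒ q = size q < size p
      ⊎ (size q ≡ size p × toℕ (colour q) < toℕ (colour p))
      ⊎ (size q ≡ size p × toℕ (colour q) ≡ toℕ (colour p) × overlined q ≡ false)

_⊒?_ : ∀ {s} → Decidable (_⊒_ {s})
p ⊒? q = (size q <? size p)
   ⊎-dec ((size q ≟ size p) ×-dec (toℕ (colour q) <? toℕ (colour p)))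
   ⊎-dec ((size q ≟ size p) ×-dec (toℕ (colour q) ≟ toℕ (colour p))
                            ×-dec (overlined q Bool.≟ false))

-- Positivity of the sizes is not included here: it is built into `parts`.
IsOverpartition : ∀ {s} → ℕ → List (Part s) → Set
IsOverpartition n ps = Linked _⊒_ ps × sum (map size ps) ≡ n

isOverpartition? : ∀ {s} n → U.Decidable (IsOverpartition {s} n)
isOverpartition? n ps = linked? _⊒?_ ps ×-dec (sum (map size ps) ≟ n)

-- All parts of size 1, …, n.
parts : ∀ s → ℕ → List (Part s)
parts s n = concatMap
  (λ i → cartesianProductWith (part (suc i)) (allFin (colours s (suc i))) (false ∷ true ∷ []))
  (upTo n)

-- All lists of length k with entries from xs.
words : ∀ {A : Set} → List A → ℕ → List (List A)
words xs zero    = [] ∷ []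
words xs (suc k) = cartesianProductWith _∷_ xs (words xs k)

-- A partition of n has at most n parts, each of size at most n, so the
-- candidates below contain every overpartition of n, exactly once.
overpartitions : ∀ s → ℕ → List (List (Part s))
overpartitions s n =
  filter (isOverpartition? n) (concatMap (words (parts s n)) (upTo (suc n)))

ā : ℕ → ℕ → ℕ
ā s n = length (overpartitions s n)

------------------------------------------------------------------------
-- Formal power series over ℤ, as coefficient sequences

Series : Set
Series = ℕ → ℤ

q^_ : ℕ → Series
(q^ m) n = if n ≡ᵇ m then 1ℤ else 0ℤ

_⊖_ : Series → Series → Series
(a ⊖ b) n = a n ℤ.- b n

_⊛_ : Series → Series → Series
(a ⊛ b) n = ∑[ i ≤ n ] (a (toℕ i) ℤ.* b (n ∸ toℕ i))

pow : Series → ℕ → Series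
pow a zero    = q^ 0
pow a (suc k) = a ⊛ pow a k

-- ∏_{j=1}^{N} (1 - q^{ℓj})
partialProduct : ℕ → ℕ → Series
partialProduct ℓ zero    = q^ 0
partialProduct ℓ (suc N) = partialProduct ℓ N ⊛ ((q^ 0) ⊖ (q^ (ℓ * suc N)))

-- For ℓ ≥ 1, the factors with j > n do not affect the coefficient of q^n in
-- the infinite product ∏_{j≥1} (1 - q^{ℓj}).
f : ℕ → Series
f ℓ n = partialProduct ℓ n n

c : ℕ → ℤ
c = pow (f 1) 3 ⊛ pow (f 2) 6

------------------------------------------------------------------------
-- The quantities κ(p) and ν(p)

legendre : ℤ → ℕ → ℤ
legendre a p =
  if does (+ p ℤ∣.∣? a) then 0ℤ
  else if does (any? {p} λ x → + p ℤ∣.∣? (+ (toℕ x * toℕ x) ℤ.- a)) then 1ℤ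
  else -1ℤ

-- Both divisions are exact for odd p, since then 8 divides p² - 1.
κ : ℕ → ℤ
κ p = c (5 * (p ^ 2 ∸ 1) / 8)
      ℤ.+ + (p ^ 3) ℤ.* legendre (ℤ.- + (5 * (p ^ 2 ∸ 1) / 4)) p

ν : ℕ → ℕ
ν p = if κ p %ℕ 2 ≡ᵇ 0 then 4 else 6

{-# OPTIONS --safe #-}
module Submission where

-- Let φ = φ(-q) = 1 + 2x and φ₂ = φ(-q²) = 1 + 2y with x = Σ (-1)ⁿ q^{n²} and
-- y = Σ (-1)ⁿ q^{2n²} (n ≥ 1).  By Gauss, the generating function of ā_s is
-- G = φ₂^{s-1}/φˢ.  Modulo 2^{m+3} the power φ^{8s} is 1, so G = φ^{7s} φ₂^{s-1}, a
-- polynomial in x and y of which, at exponents N ≡ 5 (mod 8), only terms controlled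
-- by the parity of R(N) = #{(a, b) : a² + 4b² = N} survive: since no a² + 2b² is
-- 5 modulo 8, both congruences hold at N as soon as R(N) is even.  Zagier's
-- involution gives R(N) ≡ d(N)/2 (mod 2), and d(N) is divisible by 4 when p
-- divides N exactly to a power ≡ 3 (mod 4).  Finally f₁³ ≡ Σ q^{n(n+1)/2} (mod 2)
-- gives c(n) ≡ R(8n + 5) (mod 2); evaluated at 8n + 5 = 5p² this shows that κ(p) is
-- always even.  So ν(p) = 4, and the second part is vacuous.

open import Algebra.Bundles using (CommutativeRing; RawRing)

-- All series are compared in `truncated k L`, with coefficients modulo `k` and q^L = 0. There q is
-- nilpotent, the factors 1 ± qʲ are units, and Gauss's identities are needed only in finite form:
-- Shanks' sums, evaluated where the next power of q vanishes.
--
-- Where R(N) comes from: φ² = 1 + 4X with X = x + x², and the coefficient of X at N has to vanish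
-- modulo 4, not just modulo 2. Split x by the parity of the exponents. Only the cross term 2 · odds
-- · evens of x² reaches an odd exponent, and an odd square plus an even square is a² + 4b². One
-- factor 2 is therefore free, and an even R(N) supplies the other. For odd s the product x · y²
-- enters as well; modulo 2 it is again the series of a² + 4b². The remaining terms have only even
-- exponents or exponents of the form a² + 2b² modulo 2.
--
-- The factor d(N)/2 becomes even because an exponent e ≡ 3 (mod 4) of p contributes e + 1. For κ,
-- the number 5p² has six divisors if p ≠ 5 but four if p = 5, and the Legendre symbol is ±1 in the
-- former case and 0 in the latter, so the parities of the two summands always match.

module RingIdentities {r₁ r₂} (R : CommutativeRing r₁ r₂) where

  open CommutativeRing R renaming (zero to *-zero)
  open import Algebra.Properties.AbelianGroup +-abelianGroup using (ε⁻¹≈ε)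
  open import Algebra.Properties.CommutativeSemigroup +-commutativeSemigroup using (interchange)
  open import Algebra.Properties.CommutativeSemiring.Exp commutativeSemiring public using (^-distrib-*)
  open import Algebra.Properties.Ring ring using (-‿distribˡ-*; -‿distribʳ-*; -‿involutive; -‿+-comm)
  open import Algebra.Properties.Semiring.Exp semiring public using (_^_; ^-congˡ; ^-homo-*; ^-assocʳ)
  open import Algebra.Properties.Semiring.Mult semiring using (_×_; ×-homo-+; ×1-homo-*; ×-congˡ)
  open import Algebra.Solver.Ring.AlmostCommutativeRing
    using (fromCommutativeRing; _-Raw-AlmostCommutative⟶_)
  open import Data.Bool.Base using (Bool; true; false; if_then_else_)
  open import Data.List.Base using (List; []; _∷_; _++_; _∷ʳ_; concatMap; upTo)
  open import Data.List.Properties using (concatMap-++; ++-assoc; ++-identityʳ; upTo-∷ʳ)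
  open import Data.List.Relation.Unary.All as All using (All; []; _∷_)
  import Data.List.Relation.Unary.All.Properties as All
  open import Data.List.Relation.Unary.AllPairs using (AllPairs; []; _∷_)
  open import Data.Maybe.Base using (Maybe; just; nothing)
  open import Data.Nat.Base as ℕ using (ℕ; zero; suc)
  import Data.Nat.Properties as ℕ
  open import Data.Nat.Tactic.RingSolver using (solve-∀)
  open import Data.Product.Base as Product using (_,_; ∃; ∃₂) renaming (_×_ to _⊗_)
  import Relation.Binary.PropositionalEquality as ≡
  open import Relation.Binary.Reasoning.Setoid setoid
  open import Relation.Nullary.Decidable using (yes; no)

  -- Integer coefficients for the ring solver: formal differences of naturals,
  -- kept in lowest terms.
  private
    reduce : ℕ ⊗ ℕ → ℕ ⊗ ℕ
    reduce (suc a , suc b) = reduce (a , b)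
    reduce d               = d

    differences : RawRing _ _
    differences = record
      { Carrier = ℕ ⊗ ℕ
      ; _≈_     = ≡._≡_
      ; _+_     = λ (a , b) (c , d) → reduce (a ℕ.+ c , b ℕ.+ d)
      ; _*_     = λ (a , b) (c , d) → reduce (a ℕ.* c ℕ.+ b ℕ.* d , a ℕ.* d ℕ.+ b ℕ.* c)
      ; -_      = λ (a , b) → b , a
      ; 0#      = 0 , 0
      ; 1#      = 1 , 0
      }

    open RawRing differences using () renaming (_+_ to _⊕_; _*_ to _⊛_; -_ to ⊖_)

    raw : ℕ ⊗ ℕ → Carrier
    raw (a , b) = a × 1# + - (b × 1#)

    raw-reduce : ∀ d → raw (reduce d) ≈ raw d
    raw-reduce (zero , b)      = refl
    raw-reduce (suc a , zero)  = refl
    raw-reduce (suc a , suc b) = trans (raw-reduce (a , b)) (begin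
      A + - B                    ≈⟨ +-identityˡ _ ⟨
      0# + (A + - B)             ≈⟨ +-congʳ (-‿inverseʳ 1#) ⟨
      1# + - 1# + (A + - B)      ≈⟨ interchange _ _ _ _ ⟩
      1# + A + (- 1# + - B)      ≈⟨ +-congˡ (-‿+-comm _ _) ⟩
      1# + A + - (1# + B)        ∎)
      where
      A = a × 1#
      B = b × 1#

    -- 0 and 1 are interpreted by 0# and 1# themselves, so that goals can mention them.
    ⟦_⟧ : ℕ ⊗ ℕ → Carrier
    ⟦ 0 , 0 ⟧ = 0#
    ⟦ 1 , 0 ⟧ = 1#
    ⟦ d ⟧     = raw d

    ⟦⟧≈raw : ∀ d → ⟦ d ⟧ ≈ raw d
    ⟦⟧≈raw (0 , 0)           = sym (-‿inverseʳ 0#)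
    ⟦⟧≈raw (0 , suc _)       = refl
    ⟦⟧≈raw (1 , 0)           = sym (trans (+-cong (+-identityʳ 1#) ε⁻¹≈ε) (+-identityʳ 1#))
    ⟦⟧≈raw (1 , suc _)       = refl
    ⟦⟧≈raw (suc (suc _) , _) = refl

    *-homo : ∀ a b c d → (a ℕ.* c ℕ.+ b ℕ.* d) × 1# + - ((a ℕ.* d ℕ.+ b ℕ.* c) × 1#)
                         ≈ (a × 1# + - (b × 1#)) * (c × 1# + - (d × 1#))
    *-homo a b c d = begin
      (a ℕ.* c ℕ.+ b ℕ.* d) × 1# + - ((a ℕ.* d ℕ.+ b ℕ.* c) × 1#)
        ≈⟨ +-cong (expand a c b d) (-‿cong (expand a d b c)) ⟩
      (A * C + B * D) + - (A * D + B * C)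
        ≈⟨ +-congˡ (sym (-‿+-comm _ _)) ⟩
      (A * C + B * D) + (- (A * D) + - (B * C))
        ≈⟨ interchange _ _ _ _ ⟩
      (A * C + - (A * D)) + (B * D + - (B * C))
        ≈⟨ +-cong (+-congˡ (-‿distribʳ-* A D)) (trans (+-comm _ _) (+-cong (-‿distribˡ-* B C) negneg)) ⟩
      (A * C + A * - D) + (- B * C + - B * - D)
        ≈⟨ +-cong (sym (distribˡ _ _ _)) (sym (distribˡ _ _ _)) ⟩
      A * (C + - D) + - B * (C + - D)
        ≈⟨ sym (distribʳ _ _ _) ⟩
      (A + - B) * (C + - D) ∎
      where
      A = a × 1#
      B = b × 1#
      C = c × 1#
      D = d × 1#
      expand : ∀ i j k l → (i ℕ.* j ℕ.+ k ℕ.* l) × 1# ≈ (i × 1#) * (j × 1#) + (k × 1#) * (l × 1#)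
      expand i j k l = trans (×-homo-+ 1# (i ℕ.* j) (k ℕ.* l)) (+-cong (×1-homo-* i j) (×1-homo-* k l))
      negneg : B * D ≈ - B * - D
      negneg = trans (sym (-‿involutive _)) (trans (-‿cong (-‿distribˡ-* B D)) (-‿distribʳ-* (- B) D))

    morphism : differences -Raw-AlmostCommutative⟶ fromCommutativeRing R
    morphism = record
      { ⟦_⟧    = ⟦_⟧
      ; +-homo = λ { x@(a , b) y@(c , d) → trans (⟦⟧≈raw (x ⊕ y)) (trans (raw-reduce (a ℕ.+ c , b ℕ.+ d)) (trans (trans
          (+-cong (×-homo-+ 1# a c) (trans (-‿cong (×-homo-+ 1# b d)) (sym (-‿+-comm _ _))))
          (interchange _ _ _ _)) (sym (+-cong (⟦⟧≈raw x) (⟦⟧≈raw y))))) }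
      ; *-homo = λ { x@(a , b) y@(c , d) → trans (⟦⟧≈raw (x ⊛ y)) (trans (raw-reduce (a ℕ.* c ℕ.+ b ℕ.* d , a ℕ.* d ℕ.+ b ℕ.* c)) (trans (*-homo a b c d)
          (sym (*-cong (⟦⟧≈raw x) (⟦⟧≈raw y))))) }
      ; -‿homo = λ { x@(a , b) → trans (⟦⟧≈raw (⊖ x)) (trans (trans (+-comm _ _)
          (trans (+-congˡ (sym (-‿involutive _))) (-‿+-comm _ _))) (-‿cong (sym (⟦⟧≈raw x)))) }
      ; 0-homo = refl
      ; 1-homo = refl
      }

    decide : ∀ x y → Maybe (⟦ x ⟧ ≈ ⟦ y ⟧)
    decide x@(a , b) y@(c , d) with a ℕ.+ d ℕ.≟ c ℕ.+ b
    ... | no _  = nothing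
    ... | yes e = just (trans (⟦⟧≈raw x) (trans (begin
      A + - B                 ≈⟨ +-congʳ (sym (trans (+-assoc _ _ _) (trans (+-congˡ (-‿inverseʳ D)) (+-identityʳ A)))) ⟩
      A + D + - D + - B       ≈⟨ +-congʳ (+-congʳ (trans (sym (×-homo-+ 1# a d)) (trans (×-congˡ e) (×-homo-+ 1# c b)))) ⟩
      C + B + - D + - B       ≈⟨ +-congʳ (trans (+-assoc _ _ _) (trans (+-congˡ (+-comm _ _)) (sym (+-assoc _ _ _)))) ⟩
      C + - D + B + - B       ≈⟨ trans (+-assoc _ _ _) (trans (+-congˡ (-‿inverseʳ B)) (+-identityʳ _)) ⟩
      C + - D                 ∎) (sym (⟦⟧≈raw y))))
      where
      A = a × 1#
      B = b × 1#
      C = c × 1#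
      D = d × 1#

  open import Algebra.Solver.Ring differences (fromCommutativeRing R) morphism decide public
    using (solve; _:=_; _:+_; _:*_; _:-_; :-_; con; Polynomial)

  nil one : ∀ {n} → Polynomial n
  nil = con (0 , 0)
  one = con (1 , 0)

  -- Finite sums, finite products and units in a commutative ring.

  two : Carrier
  two = 1# + 1#

  ∑< ∏< : (ℕ → Carrier) → ℕ → Carrier
  ∑< g zero    = 0#
  ∑< g (suc n) = ∑< g n + g n
  ∏< g zero    = 1#
  ∏< g (suc n) = ∏< g n * g n

  ∏<-cong : ∀ {g h} → (∀ i → g i ≈ h i) → ∀ n → ∏< g n ≈ ∏< h n
  ∏<-cong g≈h zero    = refl
  ∏<-cong g≈h (suc n) = *-cong (∏<-cong g≈h n) (g≈h n)

  ∑<-cong : ∀ {g h} → (∀ i → g i ≈ h i) → ∀ n → ∑< g n ≈ ∑< h n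
  ∑<-cong g≈h zero    = refl
  ∑<-cong g≈h (suc n) = +-cong (∑<-cong g≈h n) (g≈h n)

  ∏<-* : ∀ g h n → ∏< (λ i → g i * h i) n ≈ ∏< g n * ∏< h n
  ∏<-* g h zero    = sym (*-identityˡ 1#)
  ∏<-* g h (suc n) = trans (*-congʳ (∏<-* g h n))
    (solve 4 (λ a b c d → (a :* b) :* (c :* d) := (a :* c) :* (b :* d)) refl _ _ _ _)

  1^n≈1 : ∀ n → 1# ^ n ≈ 1#
  1^n≈1 zero    = refl
  1^n≈1 (suc n) = trans (*-identityˡ _) (1^n≈1 n)

  ^suc≈0 : ∀ {z} n → z ≈ 0# → z ^ suc n ≈ 0#
  ^suc≈0 n z≈0 = trans (*-congʳ z≈0) (zeroˡ _)

  binomial-square : ∀ a b → (a + b) * (a + b) ≈ a * a + b * b + two * (a * b)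
  binomial-square = solve 2 (λ a b → (a :+ b) :* (a :+ b) := a :* a :+ b :* b :+ (one :+ one) :* (a :* b)) refl

  Unit : Carrier → Set _
  Unit a = ∃ λ b → a * b ≈ 1#

  unit-resp : ∀ {a b} → a ≈ b → Unit a → Unit b
  unit-resp a≈b (c , ac≈1) = c , trans (*-congʳ (sym a≈b)) ac≈1

  unit-1 : Unit 1#
  unit-1 = 1# , *-identityˡ 1#

  unit-* : ∀ {a b} → Unit a → Unit b → Unit (a * b)
  unit-* {a} {b} (c , ac≈1) (d , bd≈1) = c * d ,
    trans (solve 4 (λ a b c d → (a :* b) :* (c :* d) := (a :* c) :* (b :* d)) refl a b c d)
          (trans (*-cong ac≈1 bd≈1) (*-identityˡ 1#))

  unit-factorˡ : ∀ {a b} → Unit (a * b) → Unit a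
  unit-factorˡ {a} {b} (c , abc≈1) = b * c , trans (sym (*-assoc a b c)) abc≈1

  unit-^ : ∀ {a} n → Unit a → Unit (a ^ n)
  unit-^ zero    u = unit-1
  unit-^ (suc n) u = unit-* u (unit-^ n u)

  unit-∏< : ∀ {g} → (∀ i → Unit (g i)) → ∀ n → Unit (∏< g n)
  unit-∏< u zero    = unit-1
  unit-∏< u (suc n) = unit-* (unit-∏< u n) (u n)

  unit-cancelʳ : ∀ {a b u} → Unit u → a * u ≈ b * u → a ≈ b
  unit-cancelʳ {a} {b} {u} (v , uv≈1) au≈bu = begin
    a           ≈⟨ *-identityʳ a ⟨
    a * 1#      ≈⟨ *-congˡ uv≈1 ⟨
    a * (u * v) ≈⟨ *-assoc a u v ⟨
    a * u * v   ≈⟨ *-congʳ au≈bu ⟩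
    b * u * v   ≈⟨ *-assoc b u v ⟩
    b * (u * v) ≈⟨ *-congˡ uv≈1 ⟩
    b * 1#      ≈⟨ *-identityʳ b ⟩
    b           ∎

  geometric : ∀ z n → (1# - z) * ∑< (z ^_) n ≈ 1# - z ^ n
  geometric z zero    = solve 1 (λ z → (one :- z) :* nil := one :- one) refl z
  geometric z (suc n) = begin
    (1# - z) * (∑< (z ^_) n + z ^ n)             ≈⟨ distribˡ _ _ _ ⟩
    (1# - z) * ∑< (z ^_) n + (1# - z) * z ^ n    ≈⟨ +-congʳ (geometric z n) ⟩
    (1# - z ^ n) + (1# - z) * z ^ n              ≈⟨ solve 2 (λ z t → (one :- t) :+ (one :- z) :* t := one :- z :* t) refl z (z ^ n) ⟩
    1# - z * z ^ n                               ∎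

  -- On a nilpotent element the geometric series is finite, hence an exact inverse.
  unit-1- : ∀ {z} n → z ^ n ≈ 0# → Unit (1# - z)
  unit-1- {z} n zⁿ≈0 = ∑< (z ^_) n , trans (geometric z n)
    (trans (+-congˡ (trans (-‿cong zⁿ≈0) ε⁻¹≈ε)) (+-identityʳ 1#))

  -- 1 + z divides 1 - z², and z² is again nilpotent, so the geometric series of z² suffices.
  unit-1+ : ∀ {z} n → z ^ n ≈ 0# → Unit (1# + z)
  unit-1+ {z} n zⁿ≈0 = unit-factorˡ (unit-resp
    (solve 1 (λ z → one :- z :* z := (one :+ z) :* (one :- z)) refl z)
    (unit-1- n (trans (^-distrib-* z z n) (trans (*-congʳ zⁿ≈0) (zeroˡ _)))))

  -- Finite forms of Gauss's product identities for φ and ψ.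

  module Gauss (q : Carrier) where

    sgn : ℕ → Carrier
    sgn n = (- 1#) ^ n

    φ-tail : ℕ → Carrier
    φ-tail = ∑< (λ i → sgn (suc i) * q ^ (suc i ℕ.* suc i))

    φ : ℕ → Carrier
    φ n = 1# + two * φ-tail n

    ∏₋ ∏₊ : ℕ → Carrier
    ∏₋ = ∏< (λ i → 1# - q ^ suc i)
    ∏₊ = ∏< (λ i → 1# + q ^ suc i)

    -- Shanks' finite form of φ(-q) = ∏ (1 - qʲ)/(1 + qʲ), denominators cleared:
    -- X n qⁿ⁺¹ = Σₛ ± 2 qˢ⁽ⁿ⁺¹⁾ ∏_{s<j≤n} (1 - qʲ) ∏_{j<s} (1 + qʲ).
    private
      X : ℕ → Carrier → Carrier
      X zero    z = 1#
      X (suc m) z = (1# - q ^ suc m) * X m z + two * (sgn (suc m) * z ^ suc m * ∏₊ m)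

    -- A q-difference equation in the free argument. On the diagonal, the recursion for `X (suc m)`
    -- calls `X m` at q^(m+2), one power too far; the equation with w = q^(m+1) brings it back,
    -- which is why `X` carries an argument at all.
    X-step : ∀ m w → (1# - w) * X m (q * w) - (1# + w) * X m w ≈ two * (sgn (suc m) * ∏₊ m * w ^ suc m)
    X-step zero w = solve 1 (λ w → (one :- w) :* one :- (one :+ w) :* one :=
      (one :+ one) :* ((:- one) :* one :* one :* (w :* one))) refl w
    X-step (suc m) w = begin
      (1# - w) * (p * X m (q * w) + two * (- 1# * s * (q * w) ^ suc m * b))
        - (1# + w) * (p * X m w + two * (- 1# * s * W * b))
        ≈⟨ +-congʳ (*-congˡ (+-congˡ (*-congˡ (*-congʳ (*-congˡ (^-distrib-* q w (suc m))))))) ⟩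
      (1# - w) * (p * X m (q * w) + two * (- 1# * s * (t * W) * b))
        - (1# + w) * (p * X m w + two * (- 1# * s * W * b))
        ≈⟨ solve 7 (λ w t s b W x y →
             (one :- w) :* ((one :- t) :* x :+ (one :+ one) :* ((:- one) :* s :* (t :* W) :* b))
               :- (one :+ w) :* ((one :- t) :* y :+ (one :+ one) :* ((:- one) :* s :* W :* b))
             := (one :- t) :* ((one :- w) :* x :- (one :+ w) :* y)
                :+ (one :+ one) :* ((one :- w) :* ((:- one) :* s :* (t :* W) :* b)
                                    :- (one :+ w) :* ((:- one) :* s :* W :* b)))
             refl w t s b W (X m (q * w)) (X m w) ⟩
      p * ((1# - w) * X m (q * w) - (1# + w) * X m w)
        + two * ((1# - w) * (- 1# * s * (t * W) * b) - (1# + w) * (- 1# * s * W * b))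
        ≈⟨ +-congʳ (*-congˡ (X-step m w)) ⟩
      p * (two * (- 1# * s * b * W))
        + two * ((1# - w) * (- 1# * s * (t * W) * b) - (1# + w) * (- 1# * s * W * b))
        ≈⟨ solve 5 (λ w t s b W →
             (one :- t) :* ((one :+ one) :* ((:- one) :* s :* b :* W))
               :+ (one :+ one) :* ((one :- w) :* ((:- one) :* s :* (t :* W) :* b)
                                   :- (one :+ w) :* ((:- one) :* s :* W :* b))
             := (one :+ one) :* ((:- one) :* ((:- one) :* s) :* (b :* (one :+ t)) :* (w :* W)))
             refl w t s b W ⟩
      two * (- 1# * (- 1# * s) * (b * (1# + t)) * (w * W)) ∎
      where
      s = sgn m
      b = ∏₊ m
      t = q ^ suc m
      p = 1# - t
      W = w ^ suc m

    X-diagonal : ∀ n → X n (q ^ suc n) ≈ φ n * ∏₊ n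
    X-diagonal zero = solve 0 (one := (one :+ (one :+ one) :* nil) :* one) refl
    X-diagonal (suc m) = begin
      (1# - w) * X m (q * w) + two * (σ * (q * w) ^ suc m * b)
        ≈⟨ +-congˡ (*-congˡ (*-congʳ (*-congˡ (^-distrib-* q w (suc m))))) ⟩
      (1# - w) * X m (q * w) + two * (σ * (w * W) * b)
        ≈⟨ solve 5 (λ a c σ t b → a :+ (one :+ one) :* (σ :* t :* b) :=
                      (a :- c) :+ (c :+ (one :+ one) :* (σ :* t :* b))) refl _ ((1# + w) * X m w) σ (w * W) b ⟩
      ((1# - w) * X m (q * w) - (1# + w) * X m w) + ((1# + w) * X m w + two * (σ * (w * W) * b))
        ≈⟨ +-cong (X-step m w) (+-congʳ (*-congˡ (X-diagonal m))) ⟩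
      two * (σ * b * W) + ((1# + w) * ((1# + two * S) * b) + two * (σ * (w * W) * b))
        ≈⟨ solve 5 (λ σ b W w S →
             (one :+ one) :* (σ :* b :* W) :+ ((one :+ w) :* ((one :+ (one :+ one) :* S) :* b) :+ (one :+ one) :* (σ :* (w :* W) :* b))
             := (one :+ (one :+ one) :* (S :+ σ :* W)) :* (b :* (one :+ w))) refl σ b W w S ⟩
      (1# + two * (S + σ * W)) * (b * (1# + w))
        ≈⟨ *-congʳ (+-congˡ (*-congˡ (+-congˡ (*-congˡ (^-assocʳ q (suc m) (suc m)))))) ⟩
      φ (suc m) * ∏₊ (suc m) ∎
      where
      w = q ^ suc m
      W = w ^ suc m
      σ = sgn (suc m)
      b = ∏₊ m
      S = φ-tail m

    X-at-0 : ∀ {z} → z ≈ 0# → ∀ m → X m z ≈ ∏₋ m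
    X-at-0 z≈0 zero    = refl
    X-at-0 {z} z≈0 (suc m) = begin
      p * X m z + two * (sgn (suc m) * z ^ suc m * ∏₊ m)
        ≈⟨ +-cong (*-congˡ (X-at-0 z≈0 m)) (*-congˡ (*-congʳ (*-congˡ (^suc≈0 m z≈0)))) ⟩
      p * ∏₋ m + two * (sgn (suc m) * 0# * ∏₊ m)
        ≈⟨ solve 4 (λ p a s b → p :* a :+ (one :+ one) :* (s :* nil :* b) := a :* p) refl p (∏₋ m) (sgn (suc m)) (∏₊ m) ⟩
      ∏₋ m * p ∎
      where p = 1# - q ^ suc m

    -- `X n` at q^(n+1) is evaluated twice: on the diagonal, and, since that argument is zero, by
    -- its s = 0 term alone.
    gauss-φ : ∀ n → q ^ suc n ≈ 0# → ∏₋ n ≈ φ n * ∏₊ n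
    gauss-φ n q≈0 = trans (sym (X-at-0 q≈0 n)) (X-diagonal n)

    private
      Q : Carrier
      Q = q * q

    ∏odd ∏even : ℕ → Carrier
    ∏odd  = ∏< (λ i → 1# - q * Q ^ i)
    ∏even = ∏< (λ i → 1# - Q ^ suc i)

    -- The exponents i(2i + 1) and (i + 1)(2i + 1) are the triangular numbers
    -- of index 2i and 2i + 1.
    ψ : ℕ → Carrier
    ψ = ∑< (λ i → (q * Q ^ i) ^ i + (q * Q ^ i) ^ suc i)

    -- Shanks' finite form of ψ(q) = ∏ (1 - q²ʲ)/(1 - q²ʲ⁻¹), denominators cleared:
    -- Y n q²ⁿ⁺¹ = Σ_{s<n} q^{s(2n+1)} ∏_{s<j≤n} (1 - q²ʲ) ∏_{j≤s} (1 - q²ʲ⁻¹).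
    private
      Y : ℕ → Carrier → Carrier
      Y zero    z = 0#
      Y (suc m) z = (1# - Q ^ suc m) * (Y m z + ∏odd m * z ^ m)

    -- The counterpart of `X-step`: passing from m to m + 1 multiplies the diagonal argument q Q^m
    -- by Q.
    Y-step : ∀ m w → (1# - q * w) * Y m (Q * w) - (1# - w) * Y m w ≈ (1# - Q ^ m) * ∏odd m * w ^ m
    Y-step zero w = solve 2 (λ q w → (one :- q :* w) :* nil :- (one :- w) :* nil
      := (one :- one) :* one :* one) refl q w
    Y-step (suc m) w = begin
      (1# - q * w) * ((1# - Q * T) * (Y m (Q * w) + C * (Q * w) ^ m)) - (1# - w) * ((1# - Q * T) * (Y m w + C * W))
        ≈⟨ +-congʳ (*-congˡ (*-congˡ (+-congˡ (*-congˡ (^-distrib-* Q w m))))) ⟩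
      (1# - q * w) * ((1# - Q * T) * (Y m (Q * w) + C * (T * W))) - (1# - w) * ((1# - Q * T) * (Y m w + C * W))
        ≈⟨ solve 7 (λ q w T C W x y →
             (one :- q :* w) :* ((one :- q :* q :* T) :* (x :+ C :* (T :* W))) :- (one :- w) :* ((one :- q :* q :* T) :* (y :+ C :* W))
             := (one :- q :* q :* T) :* (((one :- q :* w) :* x :- (one :- w) :* y) :+ ((one :- q :* w) :* (C :* (T :* W)) :- (one :- w) :* (C :* W))))
             refl q w T C W (Y m (Q * w)) (Y m w) ⟩
      (1# - Q * T) * (((1# - q * w) * Y m (Q * w) - (1# - w) * Y m w) + ((1# - q * w) * (C * (T * W)) - (1# - w) * (C * W)))
        ≈⟨ *-congˡ (+-congʳ (Y-step m w)) ⟩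
      (1# - Q * T) * ((1# - T) * C * W + ((1# - q * w) * (C * (T * W)) - (1# - w) * (C * W)))
        ≈⟨ solve 5 (λ q w T C W →
             (one :- q :* q :* T) :* ((one :- T) :* C :* W :+ ((one :- q :* w) :* (C :* (T :* W)) :- (one :- w) :* (C :* W)))
             := (one :- q :* q :* T) :* (C :* (one :- q :* T)) :* (w :* W)) refl q w T C W ⟩
      (1# - Q * T) * (C * (1# - q * T)) * (w * W) ∎
      where
      T = Q ^ m
      C = ∏odd m
      W = w ^ m

    Y-diagonal : ∀ n → Y n (q * Q ^ n) ≈ ∏odd n * ψ n
    Y-diagonal zero    = sym (zeroʳ 1#)
    Y-diagonal (suc m) = begin
      (1# - Q * T) * (Y m (q * (Q * T)) + C * (q * (Q * T)) ^ m)
        ≈⟨ *-congˡ (+-cong (Y-cong m shift) (*-congˡ (trans (^-congˡ m shift) (^-distrib-* Q w m)))) ⟩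
      (1# - Q * T) * (Y m (Q * w) + C * (T * W))
        ≈⟨ solve 6 (λ q T y z C W → (one :- q :* q :* T) :* (z :+ C :* (T :* W)) :=
             ((one :- q :* (q :* T)) :* z :- (one :- q :* T) :* y) :+ ((one :- q :* T) :* y :+ (one :- q :* q :* T) :* (C :* (T :* W))))
             refl q T (Y m w) (Y m (Q * w)) C W ⟩
      ((1# - q * w) * Y m (Q * w) - (1# - w) * Y m w) + ((1# - w) * Y m w + (1# - Q * T) * (C * (T * W)))
        ≈⟨ +-cong (Y-step m w) (+-congʳ (*-congˡ (Y-diagonal m))) ⟩
      (1# - T) * C * W + ((1# - w) * (C * ψ m) + (1# - Q * T) * (C * (T * W)))
        ≈⟨ solve 5 (λ q T C W S →
             (one :- T) :* C :* W :+ ((one :- q :* T) :* (C :* S) :+ (one :- q :* q :* T) :* (C :* (T :* W)))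
             := C :* (one :- q :* T) :* (S :+ (W :+ q :* T :* W))) refl q T C W (ψ m) ⟩
      C * (1# - w) * (ψ m + (W + w * W)) ∎
      where
      T = Q ^ m
      w = q * T
      C = ∏odd m
      W = w ^ m
      shift : q * (Q * T) ≈ Q * w
      shift = solve 2 (λ q T → q :* (q :* q :* T) := q :* q :* (q :* T)) refl q T
      Y-cong : ∀ m {z z′} → z ≈ z′ → Y m z ≈ Y m z′
      Y-cong zero    z≈z′ = refl
      Y-cong (suc m) z≈z′ = *-congˡ (+-cong (Y-cong m z≈z′) (*-congˡ (^-congˡ m z≈z′)))

    -- The index starts at 1 because `Y 0` is an empty sum; from then on the s = 0 term is present,
    -- and at argument zero it is all that remains.
    Y-at-0 : ∀ {z} → z ≈ 0# → ∀ m → Y (suc m) z ≈ ∏even (suc m)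
    Y-at-0 z≈0 zero    = solve 1 (λ p → p :* (nil :+ one :* one) := one :* p) refl _
    Y-at-0 {z} z≈0 (suc m) = trans (*-congˡ (+-cong (Y-at-0 z≈0 m) (*-congˡ (^suc≈0 m z≈0))))
      (solve 3 (λ p e c → p :* (e :+ c :* nil) := e :* p) refl _ _ _)

    ^-double : ∀ i → q ^ (i ℕ.* 2) ≈ Q ^ i
    ^-double zero    = refl
    ^-double (suc i) = trans (sym (*-assoc _ _ _)) (*-congˡ (^-double i))

    ∏₋-double : ∀ m → ∏₋ (m ℕ.* 2) ≈ ∏odd m * ∏even m
    ∏₋-double zero    = sym (*-identityˡ 1#)
    ∏₋-double (suc m) = trans (*-cong (*-cong (∏₋-double m) (+-congˡ (-‿cong (*-congˡ (^-double m)))))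
        (+-congˡ (-‿cong (^-double (suc m)))))
      (solve 4 (λ a b c d → (a :* b) :* c :* d := (a :* c) :* (b :* d)) refl _ _ _ _)

    gauss-ψ : ∀ n → q * Q ^ suc n ≈ 0# → ∏even (suc n) ≈ ∏odd (suc n) * ψ (suc n)
    gauss-ψ n q≈0 = trans (sym (Y-at-0 q≈0 n)) (Y-diagonal (suc n))

  -- Powers of 1 + 4X, and identities in characteristic two.

  2^j×1≈two^j : ∀ j → (2 ℕ.^ j) × 1# ≈ two ^ j
  2^j×1≈two^j zero    = +-identityʳ 1#
  2^j×1≈two^j (suc j) = trans (×1-homo-* 2 (2 ℕ.^ j))
    (*-cong (+-congˡ (+-identityʳ 1#)) (2^j×1≈two^j j))

  -- The coefficients b and c are integers: later only the coefficients of X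
  -- and X² matter, and W is irrelevant.
  power-expansion : ∀ X j b → ∃₂ λ c W →
    (1# + two * two * X) ^ (2 ℕ.^ j ℕ.* b) ≈
    1# + two * two * two ^ j * (b × 1# * X + two * (c × 1# * (X * X)) + two * two * W)
  power-expansion X zero zero    = 0 , 0# , solve 1 (λ X → one :=
    one :+ (one :+ one) :* (one :+ one) :* one :* (nil :* X :+ (one :+ one) :* (nil :* (X :* X)) :+ (one :+ one) :* (one :+ one) :* nil)) refl X
  power-expansion X zero (suc b) with power-expansion X zero b
  ... | c , W , eq = c , W + β * (X * X) + two * (γ * (X * X * X)) + two * two * (X * W) , (begin
    (1# + two * two * X) * (1# + two * two * X) ^ (b ℕ.+ 0)
      ≈⟨ *-congˡ eq ⟩
    (1# + two * two * X) * (1# + two * two * 1# * (β * X + two * (γ * (X * X)) + two * two * W))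
      ≈⟨ solve 4 (λ X β γ W →
           (one :+ t :* t :* X) :* (one :+ t :* t :* one :* (β :* X :+ t :* (γ :* (X :* X)) :+ t :* t :* W))
           := one :+ t :* t :* one :* ((one :+ β) :* X :+ t :* (γ :* (X :* X))
                :+ t :* t :* (W :+ β :* (X :* X) :+ t :* (γ :* (X :* X :* X)) :+ t :* t :* (X :* W)))) refl X β γ W ⟩
    1# + two * two * 1# * ((1# + β) * X + two * (γ * (X * X)) + two * two * (W + β * (X * X) + two * (γ * (X * X * X)) + two * two * (X * W))) ∎)
    where
    β = b × 1#
    γ = c × 1#
    t : ∀ {n} → Polynomial n
    t = one :+ one
  power-expansion X (suc j) b with power-expansion X j b
  -- Squaring 1 + 4TA gives 1 + 8T(A + 2TA²), and A² is β²X² up to even terms; so the coefficient of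
  -- X² grows by T β².
  ... | c , W , eq = c ℕ.+ 2 ℕ.^ j ℕ.* (b ℕ.* b) , W + T * V , (begin
    a ^ (2 ℕ.* 2 ℕ.^ j ℕ.* b)
      ≡⟨ ≡.cong (a ^_) (≡.trans (≡.cong (ℕ._* b) (≡.cong (2 ℕ.^ j ℕ.+_) (ℕ.+-identityʳ _))) (ℕ.*-distribʳ-+ b (2 ℕ.^ j) (2 ℕ.^ j))) ⟩
    a ^ (2 ℕ.^ j ℕ.* b ℕ.+ 2 ℕ.^ j ℕ.* b)
      ≈⟨ ^-homo-* a (2 ℕ.^ j ℕ.* b) (2 ℕ.^ j ℕ.* b) ⟩
    a ^ (2 ℕ.^ j ℕ.* b) * a ^ (2 ℕ.^ j ℕ.* b)
      ≈⟨ *-cong eq eq ⟩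
    (1# + two * two * T * (β * X + two * (γ * (X * X)) + two * two * W)) * (1# + two * two * T * (β * X + two * (γ * (X * X)) + two * two * W))
      ≈⟨ solve 5 (λ X β γ W T →
           let A = β :* X :+ t :* (γ :* (X :* X)) :+ t :* t :* W in
           (one :+ t :* t :* T :* A) :* (one :+ t :* t :* T :* A)
           := one :+ t :* t :* (t :* T) :* (β :* X :+ t :* ((γ :+ T :* (β :* β)) :* (X :* X))
                :+ t :* t :* (W :+ T :* V′ X β γ W))) refl X β γ W T ⟩
    1# + two * two * (two * T) * (β * X + two * ((γ + T * (β * β)) * (X * X)) + two * two * (W + T * V))
      ≈⟨ +-congˡ (*-congˡ (+-congʳ (+-congˡ (*-congˡ (*-congʳ γ-step))))) ⟩
    1# + two * two * (two * T) * (β * X + two * ((c ℕ.+ 2 ℕ.^ j ℕ.* (b ℕ.* b)) × 1# * (X * X)) + two * two * (W + T * V)) ∎)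
    where
    a = 1# + two * two * X
    β = b × 1#
    γ = c × 1#
    T = two ^ j
    U = γ * (X * X) + two * W
    V = two * (β * X * U) + two * (U * U)
    t : ∀ {n} → Polynomial n
    t = one :+ one
    V′ : ∀ {n} → Polynomial n → Polynomial n → Polynomial n → Polynomial n → Polynomial n
    V′ X β γ W = let U = γ :* (X :* X) :+ t :* W in t :* (β :* X :* U) :+ t :* (U :* U)
    γ-step : γ + T * (β * β) ≈ (c ℕ.+ 2 ℕ.^ j ℕ.* (b ℕ.* b)) × 1#
    γ-step = sym (trans (×-homo-+ 1# c _) (+-congˡ (trans (×1-homo-* (2 ℕ.^ j) (b ℕ.* b))
      (*-cong (2^j×1≈two^j j) (×1-homo-* b b)))))

  frobenius : two ≈ 0# → ∀ x y → (x + y) * (x + y) ≈ x * x + y * y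
  frobenius two≈0 x y = trans (binomial-square x y)
    (trans (+-congˡ (trans (*-congʳ two≈0) (zeroˡ _))) (+-identityʳ _))

  frobenius-∑< : two ≈ 0# → ∀ g n → ∑< g n * ∑< g n ≈ ∑< (λ i → g i * g i) n
  frobenius-∑< two≈0 g zero    = zeroˡ 0#
  frobenius-∑< two≈0 g (suc n) = trans (frobenius two≈0 _ _) (+-congʳ (frobenius-∑< two≈0 g n))

  -x≈x : two ≈ 0# → ∀ x → - x ≈ x
  -x≈x two≈0 x = trans (solve 1 (λ x → :- x := x :- (one :+ one) :* x) refl x)
    (trans (+-congˡ (-‿cong (trans (*-congʳ two≈0) (zeroˡ x)))) (solve 1 (λ x → x :- nil := x) refl x))

  ∏<-if : ∀ (g : ℕ → Carrier) (b : ℕ → Bool) n →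
    ∏< g n ≈ ∏< (λ i → if b i then g i else 1#) n * ∏< (λ i → if b i then 1# else g i) n
  ∏<-if g b n = trans (∏<-cong (λ i → split (b i) (g i)) n) (∏<-* _ _ n)
    where
    split : ∀ t x → x ≈ (if t then x else 1#) * (if t then 1# else x)
    split true  x = sym (*-identityʳ x)
    split false x = sym (*-identityˡ x)

  ∏<-if-^ : ∀ (g : ℕ → Carrier) (b : ℕ → Bool) s n →
    ∏< (λ i → g i ^ (if b i then s else 1)) n
      ≈ ∏< (λ i → if b i then g i else 1#) n ^ s * ∏< (λ i → if b i then 1# else g i) n
  ∏<-if-^ g b s zero    = sym (trans (*-congʳ (1^n≈1 s)) (*-identityˡ 1#))
  ∏<-if-^ g b s (suc n) = trans (*-cong (∏<-if-^ g b s n) (split (b n)))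
    (trans (solve 4 (λ a b c d → (a :* b) :* (c :* d) := (a :* c) :* (b :* d)) refl _ _ _ _)
      (*-congʳ (sym (^-distrib-* _ _ s))))
    where
    split : ∀ t → g n ^ (if t then s else 1) ≈ (if t then g n else 1#) ^ s * (if t then 1# else g n)
    split true  = sym (*-identityʳ _)
    split false = sym (trans (*-congʳ (1^n≈1 s)) (solve 1 (λ x → one :* x := x :* one) refl (g n)))

  -- O± and E± are the products of the 1 ± qʲ over odd and even j; so φ = φ(-q),
  -- φ₂ = φ(-q²), and the generating function is G = φ₂ʳ/φʳ⁺¹.
  theta-quotient : ∀ {O₋ O₊ E₋ E₊ φ φ₂ G} r → Unit O₊ → Unit E₊ → Unit E₋ →
    O₋ * E₋ ≈ φ * (O₊ * E₊) → E₋ ≈ φ₂ * E₊ →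
    G * (O₋ ^ suc r * E₋) ≈ O₊ ^ suc r * E₊ →
    G * φ ^ suc r ≈ φ₂ ^ r
  theta-quotient {O₋} {O₊} {E₋} {E₊} {φ} {φ₂} {G} r uO₊ uE₊ uE₋ OE≈ E≈ GOE≈ =
    unit-cancelʳ (unit-* (unit-^ s (unit-* uO₊ uE₊)) uE₋) (begin
      G * φ ^ s * (P ^ s * E₋)               ≈⟨ solve 4 (λ g f p e → g :* f :* (p :* e) := g :* (f :* p) :* e) refl G _ _ E₋ ⟩
      G * (φ ^ s * P ^ s) * E₋               ≈⟨ *-congʳ (*-congˡ (trans (sym (^-distrib-* φ P s)) (trans (^-congˡ s (sym OE≈)) (^-distrib-* O₋ E₋ s)))) ⟩
      G * (O₋ ^ s * E₋ ^ s) * E₋             ≈⟨ solve 4 (λ g o e f → g :* (o :* e) :* f := g :* (o :* f) :* e) refl G _ _ E₋ ⟩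
      G * (O₋ ^ s * E₋) * E₋ ^ s             ≈⟨ *-cong GOE≈ (trans (^-congˡ s E≈) (^-distrib-* φ₂ E₊ s)) ⟩
      O₊ ^ s * E₊ * (φ₂ * φ₂ ^ r * E₊ ^ s)   ≈⟨ solve 5 (λ o e f g h → o :* e :* (f :* g :* h) := g :* (o :* h :* (f :* e))) refl _ E₊ φ₂ _ _ ⟩
      φ₂ ^ r * (O₊ ^ s * E₊ ^ s * (φ₂ * E₊)) ≈⟨ *-congˡ (*-cong (sym (^-distrib-* O₊ E₊ s)) (sym E≈)) ⟩
      φ₂ ^ r * (P ^ s * E₋)                  ∎)
    where
    s = suc r
    P = O₊ * E₊

  one-minus-square : two ≈ 0# → ∀ x → (1# - x) * (1# - x) ≈ 1# - x * x
  one-minus-square two≈0 x = trans (frobenius two≈0 1# (- x))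
    (trans (solve 1 (λ x → one :* one :+ (:- x) :* (:- x) := one :- (:- (x :* x))) refl x) (+-congˡ (-‿cong (-x≈x two≈0 (x * x)))))

  -- Meant for f₁, f₂ and ψ modulo 2. The hypotheses give a⁴ = a p, so a³ = p after cancelling the
  -- unit, and a³b⁶ = a¹⁵ = p⁵.
  cube-times-sixth : ∀ {a b p} → Unit a → b ≈ a * a → b * b ≈ a * p → a ^ 3 * b ^ 6 ≈ p * (p * p * (p * p))
  cube-times-sixth {a} {b} {p} u b≈ bb≈ = begin
    a ^ 3 * b ^ 6                          ≈⟨ *-congˡ (^-congˡ 6 b≈) ⟩
    a ^ 3 * (a * a) ^ 6                    ≈⟨ solve 1 (λ a → let a³ = a :* (a :* (a :* one)) ; a² = a :* a in
                                                a³ :* (a² :* (a² :* (a² :* (a² :* (a² :* (a² :* one)))))) := a³ :* (a³ :* a³ :* (a³ :* a³))) refl a ⟩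
    a ^ 3 * (a ^ 3 * a ^ 3 * (a ^ 3 * a ^ 3)) ≈⟨ *-cong a³≈p (*-cong (*-cong a³≈p a³≈p) (*-cong a³≈p a³≈p)) ⟩
    p * (p * p * (p * p))                  ∎
    where
    a³≈p : a ^ 3 ≈ p
    a³≈p = unit-cancelʳ u (trans (solve 1 (λ a → a :* (a :* (a :* one)) :* a := (a :* a) :* (a :* a)) refl a)
      (trans (*-cong (sym b≈) (sym b≈)) (trans bb≈ (*-comm a p))))

  -- Sums over lists, and words counted by a transfer equation.

  ∑∈ ∏∈ : ∀ {A : Set} → List A → (A → Carrier) → Carrier
  ∑∈ []       g = 0#
  ∑∈ (x ∷ xs) g = g x + ∑∈ xs g
  ∏∈ []       g = 1#
  ∏∈ (x ∷ xs) g = g x * ∏∈ xs g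

  ∑∈-++ : ∀ {A : Set} xs ys (g : A → Carrier) → ∑∈ (xs ++ ys) g ≈ ∑∈ xs g + ∑∈ ys g
  ∑∈-++ []       ys g = sym (+-identityˡ _)
  ∑∈-++ (x ∷ xs) ys g = trans (+-congˡ (∑∈-++ xs ys g)) (sym (+-assoc _ _ _))

  ∏∈-++ : ∀ {A : Set} xs ys (g : A → Carrier) → ∏∈ (xs ++ ys) g ≈ ∏∈ xs g * ∏∈ ys g
  ∏∈-++ []       ys g = sym (*-identityˡ _)
  ∏∈-++ (x ∷ xs) ys g = trans (*-congˡ (∏∈-++ xs ys g)) (sym (*-assoc _ _ _))

  ∑∈-cong : ∀ {A : Set} xs {g h : A → Carrier} → All (λ x → g x ≈ h x) xs → ∑∈ xs g ≈ ∑∈ xs h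
  ∑∈-cong []       []       = refl
  ∑∈-cong (x ∷ xs) (e ∷ es) = +-cong e (∑∈-cong xs es)

  ∑∈-0 : ∀ {A : Set} xs {g : A → Carrier} → All (λ x → g x ≈ 0#) xs → ∑∈ xs g ≈ 0#
  ∑∈-0 []       []       = refl
  ∑∈-0 (x ∷ xs) (e ∷ es) = trans (+-cong e (∑∈-0 xs es)) (+-identityˡ 0#)

  ∏∈-concatMap-upTo : ∀ {A : Set} (h : ℕ → List A) (g : A → Carrier) n →
    ∏∈ (concatMap h (upTo n)) g ≈ ∏< (λ i → ∏∈ (h i) g) n
  ∏∈-concatMap-upTo h g zero    = refl
  ∏∈-concatMap-upTo h g (suc n) = begin
    ∏∈ (concatMap h (upTo (suc n))) g                   ≡⟨ ≡.cong (λ is → ∏∈ (concatMap h is) g) (upTo-∷ʳ n) ⟨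
    ∏∈ (concatMap h (upTo n ∷ʳ n)) g                    ≡⟨ ≡.cong (λ xs → ∏∈ xs g) (concatMap-++ h (upTo n) (n ∷ [])) ⟩
    ∏∈ (concatMap h (upTo n) ++ (h n ++ [])) g          ≡⟨ ≡.cong (λ xs → ∏∈ (concatMap h (upTo n) ++ xs) g) (++-identityʳ (h n)) ⟩
    ∏∈ (concatMap h (upTo n) ++ h n) g                  ≈⟨ ∏∈-++ (concatMap h (upTo n)) (h n) g ⟩
    ∏∈ (concatMap h (upTo n)) g * ∏∈ (h n) g            ≈⟨ *-congʳ (∏∈-concatMap-upTo h g n) ⟩
    ∏< (λ i → ∏∈ (h i) g) n * ∏∈ (h n) g                ∎

  ∑<-suc : ∀ g n → ∑< g (suc n) ≈ g 0 + ∑< (λ i → g (suc i)) n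
  ∑<-suc g zero    = +-comm 0# (g 0)
  ∑<-suc g (suc n) = trans (+-congʳ (∑<-suc g n)) (+-assoc _ _ _)

  ∑<-∑∈-swap : ∀ {A : Set} (b : A → Bool) (u : A → Carrier) (W : ℕ → A → Carrier) xs n →
    ∑< (λ k → ∑∈ xs (λ y → if b y then u y * W k y else 0#)) n
      ≈ ∑∈ xs (λ y → if b y then u y * ∑< (λ k → W k y) n else 0#)
  ∑<-∑∈-swap b u W []       zero    = refl
  ∑<-∑∈-swap b u W []       (suc n) = trans (+-congʳ (∑<-∑∈-swap b u W [] n)) (+-identityˡ 0#)
  ∑<-∑∈-swap b u W (x ∷ xs) n       = trans (∑<-+ n) (+-cong (column (b x) n) (∑<-∑∈-swap b u W xs n))
    where
    ∑<-+ : ∀ {g h} n → ∑< (λ k → g k + h k) n ≈ ∑< g n + ∑< h n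
    ∑<-+ zero    = sym (+-identityˡ 0#)
    ∑<-+ (suc n) = trans (+-congʳ (∑<-+ n)) (solve 4 (λ a b c d → (a :+ b) :+ (c :+ d) := (a :+ c) :+ (b :+ d)) refl _ _ _ _)
    column : ∀ t n → ∑< (λ k → if t then u x * W k x else 0#) n ≈ (if t then u x * ∑< (λ k → W k x) n else 0#)
    column true  zero    = sym (zeroʳ (u x))
    column true  (suc n) = trans (+-congʳ (column true n)) (sym (distribˡ _ _ _))
    column false zero    = refl
    column false (suc n) = trans (+-congʳ (column false n)) (+-identityˡ 0#)

  -- U x is the generating function of the words that may follow x, and each
  -- letter κ comes with an overlined copy bar κ, which starts a run of κ's.
  module Transfer {A : Set} (ks : List A) (bar : A → A) (allows : A → A → Bool) (u U : A → Carrier)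
    (_≺_ : A → A → Set) (increasing : AllPairs _≺_ ks)
    (allows-≺ : ∀ {κ λ′} → κ ≺ λ′ → allows λ′ κ ≡.≡ true)
    (allows-≺-bar : ∀ {κ λ′} → κ ≺ λ′ → allows λ′ (bar κ) ≡.≡ true)
    (allows-≻ : ∀ {κ λ′} → κ ≺ λ′ → allows κ λ′ ≡.≡ false)
    (allows-≻-bar : ∀ {κ λ′} → κ ≺ λ′ → allows κ (bar λ′) ≡.≡ false)
    (allows-self : All (λ κ → allows κ κ ≡.≡ true) ks)
    (allows-self-bar : ∀ κ → allows κ (bar κ) ≡.≡ false)
    (u-bar : ∀ κ → u (bar κ) ≈ u κ) (U-bar : ∀ κ → U (bar κ) ≈ U κ)
    where

    letters : List A → List A
    letters = concatMap (λ κ → κ ∷ bar κ ∷ [])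

    private
      if-true : ∀ {b} {x : Carrier} → b ≡.≡ true → (if b then x else 0#) ≈ x
      if-true ≡.refl = refl

      if-false : ∀ {b} {x : Carrier} → b ≡.≡ false → (if b then x else 0#) ≈ 0#
      if-false ≡.refl = refl

      All-letters : ∀ {p} {P : A → Set p} {xs} → All P xs → All (λ κ → P (bar κ)) xs → All P (letters xs)
      All-letters []       []       = []
      All-letters (p ∷ ps) (r ∷ rs) = p ∷ r ∷ All-letters ps rs

    -- The generating function of the words that are empty or begin with a letter of `letters xs`;
    -- the later letters are restricted only by `allows`.
    G : List A → Carrier
    G xs = 1# + ∑∈ (letters xs) (λ y → u y * U y)

    module _ (U-equation : ∀ x → U x ≈ 1# + ∑∈ (letters ks) (λ y → if allows x y then u y * U y else 0#)) where

      -- After κ comes nothing or a smaller letter, barred or not, which together make `G pre`; or κ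
      -- again, unbarred. The letter `bar κ` and everything larger are forbidden.
      U-split : ∀ pre κ post → ks ≡.≡ pre ++ κ ∷ post → All (_≺ κ) pre → All (κ ≺_) post →
                U κ ≈ G pre + u κ * U κ
      U-split pre κ post ≡.refl below above = begin
        U κ ≈⟨ U-equation κ ⟩
        1# + ∑∈ (letters (pre ++ κ ∷ post)) h
          ≡⟨ ≡.cong (λ xs → 1# + ∑∈ xs h) (concatMap-++ _ pre (κ ∷ post)) ⟩
        1# + ∑∈ (letters pre ++ κ ∷ bar κ ∷ letters post) h
          ≈⟨ +-congˡ (∑∈-++ (letters pre) _ h) ⟩
        1# + (∑∈ (letters pre) h + (h κ + (h (bar κ) + ∑∈ (letters post) h)))
          ≈⟨ +-congˡ (+-cong
               (∑∈-cong (letters pre) (All-letters (All.map (λ p → if-true (allows-≺ p)) below) (All.map (λ p → if-true (allows-≺-bar p)) below)))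
               (+-cong (if-true (All.head (All.++⁻ʳ pre allows-self))) (+-cong (if-false (allows-self-bar κ))
                 (∑∈-0 (letters post) (All-letters (All.map (λ p → if-false (allows-≻ p)) above) (All.map (λ p → if-false (allows-≻-bar p)) above)))))) ⟩
        1# + (∑∈ (letters pre) (λ y → u y * U y) + (u κ * U κ + (0# + 0#)))
          ≈⟨ solve 2 (λ a b → one :+ (a :+ (b :+ (nil :+ nil))) := one :+ a :+ b) refl _ _ ⟩
        G pre + u κ * U κ ∎
        where
        h : A → Carrier
        h y = if allows κ y then u y * U y else 0#

      -- The letters κ and `bar κ` add 2 u U, and the split of U says U (1 - u) = G pre. Multiplying
      -- by 1 - u therefore eliminates U without an inverse.
      G-snoc : ∀ pre κ → U κ ≈ G pre + u κ * U κ → G (pre ∷ʳ κ) * (1# - u κ) ≈ G pre * (1# + u κ)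
      G-snoc pre κ U≈ = begin
        (1# + ∑∈ (letters (pre ∷ʳ κ)) w) * (1# - u κ)
          ≡⟨ ≡.cong (λ xs → (1# + ∑∈ xs w) * (1# - u κ)) (concatMap-++ _ pre (κ ∷ [])) ⟩
        (1# + ∑∈ (letters pre ++ κ ∷ bar κ ∷ []) w) * (1# - u κ)
          ≈⟨ *-congʳ (+-congˡ (trans (∑∈-++ (letters pre) _ w) (+-congˡ (+-congˡ (+-congʳ (*-cong (u-bar κ) (U-bar κ))))))) ⟩
        (1# + (∑∈ (letters pre) w + (u κ * U κ + (u κ * U κ + 0#)))) * (1# - u κ)
          ≈⟨ solve 3 (λ s u v → (one :+ (s :+ (u :* v :+ (u :* v :+ nil)))) :* (one :- u)
               := (one :+ s) :* (one :- u) :+ (one :+ one) :* u :* (v :- u :* v)) refl _ (u κ) (U κ) ⟩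
        G pre * (1# - u κ) + two * u κ * (U κ - u κ * U κ)
          ≈⟨ +-congˡ (*-congˡ (+-congʳ U≈)) ⟩
        G pre * (1# - u κ) + two * u κ * (G pre + u κ * U κ - u κ * U κ)
          ≈⟨ solve 3 (λ g u v → g :* (one :- u) :+ (one :+ one) :* u :* (g :+ v :- v) := g :* (one :+ u)) refl (G pre) (u κ) (u κ * U κ) ⟩
        G pre * (1# + u κ) ∎
        where
        w : A → Carrier
        w y = u y * U y

      G-product : G ks * ∏∈ ks (λ κ → 1# - u κ) ≈ ∏∈ ks (λ κ → 1# + u κ)
      G-product = go [] ks ≡.refl [] increasing (solve 0 ((one :+ nil) :* one := one) refl)
        where
        u₋ u₊ : A → Carrier
        u₋ κ = 1# - u κ
        u₊ κ = 1# + u κ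
        go : ∀ pre post → ks ≡.≡ pre ++ post → All (λ κ → All (κ ≺_) post) pre → AllPairs _≺_ post →
             G pre * ∏∈ pre u₋ ≈ ∏∈ pre u₊ → G ks * ∏∈ ks u₋ ≈ ∏∈ ks u₊
        go pre [] eq _ _ ih = ≡.subst (λ xs → G xs * ∏∈ xs u₋ ≈ ∏∈ xs u₊) (≡.sym (≡.trans eq (++-identityʳ pre))) ih
        go pre (κ ∷ post) eq below (above ∷ inc) ih =
          go (pre ∷ʳ κ) post (≡.trans eq (≡.sym (++-assoc pre (κ ∷ []) post)))
             (All.++⁺ (All.map All.tail below) (above ∷ [])) inc (begin
            G (pre ∷ʳ κ) * ∏∈ (pre ∷ʳ κ) u₋
              ≈⟨ *-congˡ (∏∈-++ pre (κ ∷ []) u₋) ⟩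
            G (pre ∷ʳ κ) * (∏∈ pre u₋ * (u₋ κ * 1#))
              ≈⟨ solve 3 (λ g p u → g :* (p :* (u :* one)) := g :* u :* p) refl _ _ (u₋ κ) ⟩
            G (pre ∷ʳ κ) * u₋ κ * ∏∈ pre u₋
              ≈⟨ *-congʳ (G-snoc pre κ (U-split pre κ post eq (All.map All.head below) above)) ⟩
            G pre * u₊ κ * ∏∈ pre u₋
              ≈⟨ solve 3 (λ g u p → g :* u :* p := g :* p :* (u :* one)) refl _ (u₊ κ) _ ⟩
            G pre * ∏∈ pre u₋ * (u₊ κ * 1#)
              ≈⟨ *-congʳ ih ⟩
            ∏∈ pre u₊ * (u₊ κ * 1#)
              ≈⟨ ∏∈-++ pre (κ ∷ []) u₊ ⟨
            ∏∈ (pre ∷ʳ κ) u₊ ∎)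

  -- From the product formula to a quotient of theta functions.

  module ThetaQuotient (q : Carrier) (h r : ℕ) (odd : ℕ → Bool)
    (odd-2i : ∀ i → odd (i ℕ.* 2) ≡.≡ true) (odd-2i+1 : ∀ i → odd (suc (i ℕ.* 2)) ≡.≡ false)
    (q²-nilpotent : (q * q) ^ suc h ≈ 0#) where

    private
      N : ℕ
      N = suc (h ℕ.* 2)
      q₋ q₊ : ℕ → Carrier
      q₋ i = 1# - q ^ suc i
      q₊ i = 1# + q ^ suc i

      power-nilpotent : ∀ {z} n i → z ^ n ≈ 0# → (z ^ suc i) ^ n ≈ 0#
      power-nilpotent {z} n i z≈0 = trans (^-distrib-* z (z ^ i) n) (trans (*-congʳ z≈0) (zeroˡ _))

    -- Index i stands for part size i + 1, so `odd` is true at even indices. The bound N = 2h + 1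
    -- leaves exactly h even sizes, the last one being 2h.
    onOdd onEven : (ℕ → Carrier) → ℕ → Carrier
    onOdd  g = ∏< (λ i → if odd i then g i else 1#)
    onEven g = ∏< (λ i → if odd i then 1# else g i)

    onEven-halve : ∀ {g f : ℕ → Carrier} → (∀ i → g (suc (i ℕ.* 2)) ≈ f i) → ∀ m → onEven g (suc (m ℕ.* 2)) ≈ ∏< f m
    onEven-halve {g} {f} e m rewrite odd-2i m = trans (*-identityʳ _) (go m)
      where
      go : ∀ m → onEven g (m ℕ.* 2) ≈ ∏< f m
      go zero    = refl
      go (suc m) rewrite odd-2i m | odd-2i+1 m = *-cong (trans (*-identityʳ _) (go m)) (e m)

    square-power : ∀ i → q ^ suc (suc (i ℕ.* 2)) ≈ (q * q) ^ suc i
    square-power i = Gauss.^-double q (suc i)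

    unit-if : ∀ {g : ℕ → Carrier} → (∀ i → Unit (g i)) → ∀ n → Unit (onOdd g n) ⊗ Unit (onEven g n)
    unit-if {g} u n = unit-∏< (λ i → ifˡ (odd i) (u i)) n , unit-∏< (λ i → ifʳ (odd i) (u i)) n
      where
      ifˡ : ∀ b {x} → Unit x → Unit (if b then x else 1#)
      ifˡ true  v = v
      ifˡ false v = unit-1
      ifʳ : ∀ b {x} → Unit x → Unit (if b then 1# else x)
      ifʳ true  v = unit-1
      ifʳ false v = v

    -- Since N + 1 = 2 (h + 1), one truncation serves both uses of Gauss's identity: for q with N
    -- factors and for q² with h factors.
    theta-identity : ∀ {G} → q ^ suc N ≈ 0# →
      G * ∏< (λ i → q₋ i ^ (if odd i then suc r else 1)) N ≈ ∏< (λ i → q₊ i ^ (if odd i then suc r else 1)) N →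
      G * Gauss.φ q N ^ suc r ≈ Gauss.φ (q * q) h ^ r
    theta-identity {G} qᴸ≈0 G≈ = theta-quotient r
      (Product.proj₁ units₊) (Product.proj₂ units₊) (Product.proj₂ units₋)
      (trans (sym (∏<-if q₋ odd N)) (trans (Gauss.gauss-φ q N qᴸ≈0) (*-congˡ (∏<-if q₊ odd N))))
      (trans (onEven-halve (λ i → +-congˡ (-‿cong (square-power i))) h)
        (trans (Gauss.gauss-φ (q * q) h q²-nilpotent)
          (*-congˡ (sym (onEven-halve (λ i → +-congˡ (square-power i)) h)))))
      (trans (*-congˡ (sym (∏<-if-^ q₋ odd (suc r) N))) (trans G≈ (∏<-if-^ q₊ odd (suc r) N)))
      where
      units₊ = unit-if {q₊} (λ i → unit-1+ (suc N) (power-nilpotent (suc N) i qᴸ≈0)) N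
      units₋ = unit-if {q₋} (λ i → unit-1- (suc N) (power-nilpotent (suc N) i qᴸ≈0)) N

  -- Expansion of the generating function in x and y modulo a power of two.

  module Expansion (x y : Carrier) where

    X Y : Carrier
    X = x + x * x
    Y = y + y * y

    private
      t : ∀ {n} → Polynomial n
      t = one :+ one

    square-1+two : ∀ x → (1# + two * x) ^ 2 ≈ 1# + two * two * (x + x * x)
    square-1+two = solve 1 (λ x → (one :+ t :* x) :* ((one :+ t :* x) :* one)
      := one :+ t :* t :* (x :+ x :* x)) refl

    even-power : ∀ x j b → ∃₂ λ c W → (1# + two * x) ^ (2 ℕ.* (2 ℕ.^ j ℕ.* b)) ≈
      1# + two * two * two ^ j * (b × 1# * (x + x * x) + two * (c × 1# * ((x + x * x) * (x + x * x))) + two * two * W)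
    even-power x j b = Product.map₂ (Product.map₂ (trans (trans
      (sym (^-assocʳ (1# + two * x) 2 (2 ℕ.^ j ℕ.* b)))
      (^-congˡ (2 ℕ.^ j ℕ.* b) (square-1+two x))))) (power-expansion (x + x * x) j b)

    -- φ^{8s} = 1 turns division by φˢ into multiplication by φ^{7s}.
    divide : ∀ {G a} s → (1# + two * x) ^ (8 ℕ.* s) ≈ 1# → G * (1# + two * x) ^ s ≈ a →
             G ≈ a * (1# + two * x) ^ (7 ℕ.* s)
    divide {G} {a} s unity e = begin
      G                                       ≈⟨ *-identityʳ G ⟨
      G * 1#                                  ≈⟨ *-congˡ unity ⟨
      G * f ^ (s ℕ.+ 7 ℕ.* s)                 ≈⟨ *-congˡ (^-homo-* f s (7 ℕ.* s)) ⟩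
      G * (f ^ s * f ^ (7 ℕ.* s))             ≈⟨ *-assoc _ _ _ ⟨
      G * f ^ s * f ^ (7 ℕ.* s)               ≈⟨ *-congʳ e ⟩
      a * f ^ (7 ℕ.* s)                       ∎
      where f = 1# + two * x

    -- The exponent 2^(j+2) b of 1 + 4X contributes 2^(j+2) on top of the factor 4, which exhausts
    -- the modulus 2^(j+4).
    unity : ∀ j b → two ^ (4 ℕ.+ j) ≈ 0# → (1# + two * x) ^ (2 ℕ.* (2 ℕ.^ (2 ℕ.+ j) ℕ.* b)) ≈ 1#
    unity j b two≈0 = trans (Product.proj₂ (Product.proj₂ (even-power x (2 ℕ.+ j) b)))
      (trans (+-congˡ (trans (*-congʳ (trans (regroup (two ^ j)) two≈0)) (zeroˡ _))) (+-identityʳ 1#))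
      where
      regroup : ∀ T → two * two * (two * (two * T)) ≈ two * (two * (two * (two * T)))
      regroup = solve 1 (λ T → t :* t :* (t :* (t :* T)) := t :* (t :* (t :* (t :* T)))) refl

    -- Here 7s = 2 · 2^j · 7α, so φ^(7s) - 1 is 4 · 2^j times a bracket that matters only modulo 4.
    -- As r is odd, φ₂ʳ acts on this bracket as 1 + 2y modulo 4, whence the term X y. The lone φ₂ʳ
    -- stays unexpanded because all its exponents are even.
    expand-even : ∀ {G} j α k r → suc r ≡.≡ 2 ℕ.^ suc j ℕ.* α → r ≡.≡ suc (2 ℕ.* k) → two ^ (4 ℕ.+ j) ≈ 0# →
      G * (1# + two * x) ^ suc r ≈ (1# + two * y) ^ r →
      ∃₂ λ b d → G ≈ (1# + two * y) ^ r + two * two * two ^ j * (b × 1# * X + two * (d × 1# * (X * X) + b × 1# * (X * y)))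
    expand-even {G} j α k r s≡ r≡ two≈0 e = 7 ℕ.* α , d , (begin
      G ≈⟨ divide (suc r) (trans (reflexive (≡.cong ((1# + two * x) ^_) exp₈)) (unity j (2 ℕ.* α) two≈0)) e ⟩
      P * (1# + two * x) ^ (7 ℕ.* suc r)
        ≈⟨ *-congˡ (trans (reflexive (≡.cong ((1# + two * x) ^_) exp₇)) e₇) ⟩
      P * (1# + two * two * T * (β * X + two * (γ * (X * X)) + two * two * W))
        ≈⟨ trans (distribˡ _ _ _) (+-cong (*-identityʳ P) (*-congʳ Pe)) ⟩
      P + (1# + two * y) * (1# + two * two * 1# * V) * (two * two * T * (β * X + two * (γ * (X * X)) + two * two * W))
        ≈⟨ +-congˡ (solve 4 (λ y V T B → (one :+ t :* y) :* (one :+ t :* t :* one :* V) :* (t :* t :* T :* B)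
             := t :* t :* T :* ((one :+ t :* y :+ t :* t :* (V :* (one :+ t :* y))) :* B)) refl y V T _) ⟩
      P + two * two * T * ((1# + two * y + two * two * (V * (1# + two * y))) * (β * X + two * (γ * (X * X)) + two * two * W))
        ≈⟨ +-congˡ (*-congˡ (solve 5 (λ y v a g W → (one :+ t :* y :+ t :* t :* v) :* (a :+ t :* g :+ t :* t :* W)
             := a :+ t :* (g :+ a :* y) :+ t :* t :* (g :* y :+ W :* (one :+ t :* y) :+ v :* (a :+ t :* g :+ t :* t :* W)))
             refl y (V * (1# + two * y)) (β * X) (γ * (X * X)) W)) ⟩
      P + two * two * T * (β * X + two * (γ * (X * X) + β * X * y) + two * two * Z)
        ≈⟨ +-congˡ (solve 4 (λ T a b Z → t :* t :* T :* (a :+ t :* b :+ t :* t :* Z)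
             := t :* t :* T :* (a :+ t :* b) :+ t :* (t :* (t :* (t :* T))) :* Z) refl T (β * X) _ Z) ⟩
      P + (two * two * T * (β * X + two * (γ * (X * X) + β * X * y)) + two * (two * (two * (two * T))) * Z)
        ≈⟨ +-congˡ (+-congʳ (*-congˡ (+-congˡ (*-congˡ (+-congˡ (*-assoc β X y)))))) ⟩
      P + (two * two * T * (β * X + two * (γ * (X * X) + β * (X * y))) + two * (two * (two * (two * T))) * Z)
        ≈⟨ +-congˡ (trans (+-congˡ (trans (*-congʳ two≈0) (zeroˡ _))) (+-identityʳ _)) ⟩
      P + two * two * T * (β * X + two * (γ * (X * X) + β * (X * y))) ∎)
      where
      expansion₇ = even-power x j (7 ℕ.* α)
      d = Product.proj₁ expansion₇
      W = Product.proj₁ (Product.proj₂ expansion₇)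
      e₇ = Product.proj₂ (Product.proj₂ expansion₇)
      expansionₖ = even-power y 0 k
      V = k × 1# * Y + two * (Product.proj₁ expansionₖ × 1# * (Y * Y)) + two * two * Product.proj₁ (Product.proj₂ expansionₖ)
      P = (1# + two * y) ^ r
      T = two ^ j
      β = (7 ℕ.* α) × 1#
      γ = d × 1#
      Z = γ * (X * X) * y + W * (1# + two * y) + V * (1# + two * y) * (β * X + two * (γ * (X * X)) + two * two * W)
      Pe : P ≈ (1# + two * y) * (1# + two * two * 1# * V)
      Pe = trans (reflexive (≡.cong ((1# + two * y) ^_) (≡.trans r≡ (≡.cong (λ k → suc (2 ℕ.* k)) (≡.sym (ℕ.+-identityʳ k))))))
                 (*-congˡ (Product.proj₂ (Product.proj₂ expansionₖ)))
      exp₈ : 8 ℕ.* suc r ≡.≡ 2 ℕ.* (2 ℕ.^ (2 ℕ.+ j) ℕ.* (2 ℕ.* α))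
      exp₈ = ≡.trans (≡.cong (8 ℕ.*_) s≡) (eq (2 ℕ.^ j) α)
        where
        eq : ∀ T α → 8 ℕ.* (2 ℕ.* T ℕ.* α) ≡.≡ 2 ℕ.* (2 ℕ.* (2 ℕ.* T) ℕ.* (2 ℕ.* α))
        eq = solve-∀
      exp₇ : 7 ℕ.* suc r ≡.≡ 2 ℕ.* (2 ℕ.^ j ℕ.* (7 ℕ.* α))
      exp₇ = ≡.trans (≡.cong (7 ℕ.*_) s≡) (eq (2 ℕ.^ j) α)
        where
        eq : ∀ T α → 7 ℕ.* (2 ℕ.* T ℕ.* α) ≡.≡ 2 ℕ.* (T ℕ.* (7 ℕ.* α))
        eq = solve-∀

    -- For s = 2k + 1 the exponent 7s is 1 + 2 (7k + 3). The unpaired factor 1 + 2x produces the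
    -- mixed terms x X and x Y, while the product of the two brackets carries 4 · 4 and disappears.
    expand-odd : ∀ {G} k → two ^ 4 ≈ 0# →
      G * (1# + two * x) ^ suc (2 ℕ.* k) ≈ (1# + two * y) ^ (2 ℕ.* k) →
      ∃₂ λ b d → ∃₂ λ b′ d′ → G ≈ 1# + two * x + two * two * (b × 1# * X + b′ × 1# * Y)
        + two * two * two * (d × 1# * (X * X) + d′ × 1# * (Y * Y) + (b × 1# * (x * X) + b′ × 1# * (x * Y)))
    expand-odd {G} k two≈0 e = b , d , k , d′ , (begin
      G ≈⟨ divide (suc (2 ℕ.* k)) (trans (reflexive (≡.cong ((1# + two * x) ^_) exp₈)) (unity 0 (suc (2 ℕ.* k)) two≈0)) e ⟩
      (1# + two * y) ^ (2 ℕ.* k) * (1# + two * x) ^ (7 ℕ.* suc (2 ℕ.* k))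
        ≈⟨ *-cong (trans (reflexive (≡.cong (λ k → (1# + two * y) ^ (2 ℕ.* k)) (≡.sym (ℕ.+-identityʳ k)))) (Product.proj₂ (Product.proj₂ expansionᵧ)))
             (trans (reflexive (≡.cong ((1# + two * x) ^_) exp₇)) (*-congˡ (Product.proj₂ (Product.proj₂ expansionₓ)))) ⟩
      (1# + two * two * 1# * (β′ * Y + two * (γ′ * (Y * Y)) + two * two * W′))
        * ((1# + two * x) * (1# + two * two * 1# * (β * X + two * (γ * (X * X)) + two * two * W)))
        ≈⟨ *-cong (+-congˡ (*-congˡ (regroup (β′ * Y) (γ′ * (Y * Y)) W′))) (*-congˡ (+-congˡ (*-congˡ (regroup (β * X) (γ * (X * X)) W)))) ⟩
      (1# + two * two * 1# * (β′ * Y + two * A)) * ((1# + two * x) * (1# + two * two * 1# * (β * X + two * B)))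
        ≈⟨ solve 5 (λ x a A b B →
             (one :+ t :* t :* one :* (a :+ t :* A)) :* ((one :+ t :* x) :* (one :+ t :* t :* one :* (b :+ t :* B)))
             := one :+ t :* x :+ t :* t :* (b :+ a) :+ t :* t :* t :* (B :+ A :+ (x :* b :+ x :* a))
                :+ t :* (t :* (t :* (t :* one))) :* (x :* (A :+ B) :+ (one :+ t :* x) :* (a :+ t :* A) :* (b :+ t :* B)))
             refl x (β′ * Y) A (β * X) B ⟩
      1# + two * x + two * two * (β * X + β′ * Y) + two * two * two * (B + A + (x * (β * X) + x * (β′ * Y))) + two ^ 4 * Z
        ≈⟨ solve 7 (λ s g W g′ W′ m Z →
             s :+ t :* t :* t :* (g :+ t :* W :+ (g′ :+ t :* W′) :+ m) :+ t :* (t :* (t :* (t :* one))) :* Z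
             := s :+ t :* t :* t :* (g :+ g′ :+ m) :+ t :* (t :* (t :* (t :* one))) :* (Z :+ W :+ W′))
             refl _ (γ * (X * X)) W (γ′ * (Y * Y)) W′ _ Z ⟩
      1# + two * x + two * two * (β * X + β′ * Y)
        + two * two * two * (γ * (X * X) + γ′ * (Y * Y) + (x * (β * X) + x * (β′ * Y)))
        + two ^ 4 * (Z + W + W′)
        ≈⟨ +-congʳ (+-congˡ (*-congˡ (+-congˡ (+-cong (pull β X) (pull β′ Y))))) ⟩
      1# + two * x + two * two * (β * X + β′ * Y)
        + two * two * two * (γ * (X * X) + γ′ * (Y * Y) + (β * (x * X) + β′ * (x * Y)))
        + two ^ 4 * (Z + W + W′)
        ≈⟨ trans (+-congˡ (trans (*-congʳ two≈0) (zeroˡ _))) (+-identityʳ _) ⟩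
      1# + two * x + two * two * (β * X + β′ * Y)
        + two * two * two * (γ * (X * X) + γ′ * (Y * Y) + (β * (x * X) + β′ * (x * Y))) ∎)
      where
      b = 7 ℕ.* k ℕ.+ 3
      expansionₓ = even-power x 0 b
      expansionᵧ = even-power y 0 k
      d = Product.proj₁ expansionₓ
      d′ = Product.proj₁ expansionᵧ
      W = Product.proj₁ (Product.proj₂ expansionₓ)
      W′ = Product.proj₁ (Product.proj₂ expansionᵧ)
      β = b × 1#
      γ = d × 1#
      β′ = k × 1#
      γ′ = d′ × 1#
      B = γ * (X * X) + two * W
      A = γ′ * (Y * Y) + two * W′
      Z = x * (A + B) + (1# + two * x) * (β′ * Y + two * A) * (β * X + two * B)
      regroup : ∀ a g w → a + two * g + two * two * w ≈ a + two * (g + two * w)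
      regroup = solve 3 (λ a g w → a :+ t :* g :+ t :* t :* w := a :+ t :* (g :+ t :* w)) refl
      pull : ∀ b X → x * (b * X) ≈ b * (x * X)
      pull b X = solve 3 (λ x b X → x :* (b :* X) := b :* (x :* X)) refl x b X
      exp₇ : 7 ℕ.* suc (2 ℕ.* k) ≡.≡ suc (2 ℕ.* (1 ℕ.* (7 ℕ.* k ℕ.+ 3)))
      exp₇ = eq k
        where
        eq : ∀ k → 7 ℕ.* (1 ℕ.+ 2 ℕ.* k) ≡.≡ 1 ℕ.+ (2 ℕ.* (1 ℕ.* (7 ℕ.* k ℕ.+ 3)))
        eq = solve-∀
      exp₈ : 8 ℕ.* suc (2 ℕ.* k) ≡.≡ 2 ℕ.* (4 ℕ.* suc (2 ℕ.* k))
      exp₈ = ℕ.*-assoc 2 4 (suc (2 ℕ.* k))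

-- Representations as a² + 4b² and divisor counts modulo 2.

module SumsOfSquares where

  import Level
  open import Data.Empty using (⊥-elim)
  open import Data.List.Base using (List; []; _∷_; _++_; filter; length; cartesianProduct; upTo)
  open import Data.List.Membership.Propositional using (_∈_)
  open import Data.List.Membership.Propositional.Properties
    using (∈-∃++; ∈-++⁺ˡ; ∈-++⁺ʳ; ∈-++⁻; ∈-filter⁺; ∈-filter⁻; ∈-cartesianProduct⁺; ∈-upTo⁺)
  open import Data.List.Properties using (length-++)
  open import Data.List.Relation.Unary.All using (All; []; _∷_; lookup)
  open import Data.List.Relation.Unary.Any using (here; there)
  open import Data.List.Relation.Unary.AllPairs using ([]; _∷_)
  open import Data.List.Relation.Unary.Unique.Propositional using (Unique)
  import Data.List.Relation.Unary.Unique.Propositional.Properties as Unique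
  open import Data.Nat.Base
  open import Data.Nat.Divisibility
    using (_∣_; divides; m∣m*n; _∣?_; ∣m⇒∣m*n)
  open import Data.Nat.DivMod using (_%_; _/_; m%n<n; m≡m%n+[m/n]*n; %-distribˡ-*; %-distribˡ-+; [m+kn]%n≡m%n; m∣n⇒o%n%m≡o%m; m*n/n≡m; m/n*n≡m; m*n%n≡0)
  open import Data.Nat.Primality using (Prime; euclidsLemma; prime⇒nonZero; prime⇒irreducible; prime?; ¬prime[1])
  open import Data.Nat.Properties
  open import Data.Nat.Tactic.RingSolver using (solve-∀)
  open import Data.Product.Base using (∃; _×_; _,_; proj₁; proj₂; swap)
  open import Data.Sum.Base using (_⊎_; inj₁; inj₂)
  open import Function.Base using (_∘_; id)
  open import Relation.Binary.PropositionalEquality hiding ([_])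
  open import Relation.Nullary.Decidable using (yes; no; ¬?; from-yes)
  open import Relation.Nullary.Negation using (¬_; contradiction)
  open import Relation.Unary using (Pred; Decidable)

  -- A finite set as an exhaustive list without repetitions. Its `card` depends only on the
  -- predicate, so counts can be compared by bijections of predicates, whatever boxes were searched.
  record Enumeration {A : Set} (P : A → Set) : Set where
    field
      list     : List A
      unique   : Unique list
      sound    : ∀ {a} → a ∈ list → P a
      complete : ∀ {a} → P a → a ∈ list

    card : ℕ
    card = length list

  open Enumeration

  box₂ : ℕ → List (ℕ × ℕ)
  box₂ n = cartesianProduct (upTo (suc n)) (upTo (suc n))

  box₃ : ℕ → List (ℕ × ℕ × ℕ)
  box₃ n = cartesianProduct (upTo (suc n)) (box₂ n)

  enumerate : ∀ {A : Set} {P : A → Set} (P? : Decidable P) xs → Unique xs → (∀ {a} → P a → a ∈ xs) → Enumeration P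
  enumerate P? xs u c = record
    { list     = filter P? xs
    ; unique   = Unique.filter⁺ P? u
    ; sound    = λ a∈ → proj₂ (∈-filter⁻ P? {xs = xs} a∈)
    ; complete = λ p → ∈-filter⁺ P? (c p) p
    }

  box₂-unique : ∀ n → Unique (box₂ n)
  box₂-unique n = Unique.cartesianProduct⁺ (Unique.upTo⁺ (suc n)) (Unique.upTo⁺ (suc n))

  ∈-box₂ : ∀ {n x y} → x ≤ n → y ≤ n → (x , y) ∈ box₂ n
  ∈-box₂ x≤n y≤n = ∈-cartesianProduct⁺ (∈-upTo⁺ (s≤s x≤n)) (∈-upTo⁺ (s≤s y≤n))

  enumerate₂ : ∀ {P : ℕ × ℕ → Set} (P? : Decidable P) n → (∀ {x y} → P (x , y) → x ≤ n × y ≤ n) → Enumeration P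
  enumerate₂ P? n bound = enumerate P? (box₂ n) (box₂-unique n)
    (λ p → ∈-box₂ (proj₁ (bound p)) (proj₂ (bound p)))

  enumerate₃ : ∀ {P : ℕ × ℕ × ℕ → Set} (P? : Decidable P) n → (∀ {x y z} → P (x , y , z) → x ≤ n × y ≤ n × z ≤ n) → Enumeration P
  enumerate₃ P? n bound = enumerate P? (box₃ n)
    (Unique.cartesianProduct⁺ (Unique.upTo⁺ (suc n)) (box₂-unique n))
    (λ p → let (x≤ , y≤ , z≤) = bound p in ∈-cartesianProduct⁺ (∈-upTo⁺ (s≤s x≤)) (∈-box₂ y≤ z≤))

  restrict : ∀ {A : Set} {P Q : A → Set} → Decidable Q → Enumeration P → Enumeration (λ a → P a × Q a)
  restrict Q? E = record
    { list     = filter Q? (list E)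
    ; unique   = Unique.filter⁺ Q? (unique E)
    ; sound    = λ a∈ → let (a∈E , q) = ∈-filter⁻ Q? {xs = list E} a∈ in sound E a∈E , q
    ; complete = λ (p , q) → ∈-filter⁺ Q? (complete E p) q
    }

  length-filter-split : ∀ {A : Set} {Q : Pred A Level.zero} (Q? : Decidable Q) xs →
    length xs ≡ length (filter Q? xs) + length (filter (¬? ∘ Q?) xs)
  length-filter-split Q? []       = refl
  length-filter-split Q? (x ∷ xs) with Q? x
  ... | yes _ = cong suc (length-filter-split Q? xs)
  ... | no  _ = trans (cong suc (length-filter-split Q? xs)) (sym (+-suc _ _))

  length-injection : ∀ {A B : Set} (f : A → B) {xs ys} → Unique xs →
    (∀ {a} → a ∈ xs → f a ∈ ys) → (∀ {a b} → a ∈ xs → b ∈ xs → f a ≡ f b → a ≡ b) → length xs ≤ length ys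
  length-injection f {[]} _ _ _ = z≤n
  length-injection {B = B} f {x ∷ xs} (x∉xs ∷ u) into inj with ∈-∃++ (into (here refl))
  ... | ys , zs , refl = begin
    suc (length xs)                 ≤⟨ s≤s (length-injection f u into′ (λ p q → inj (there p) (there q))) ⟩
    suc (length (ys ++ zs))         ≡⟨ cong suc (length-++ ys) ⟩
    suc (length ys + length zs)     ≡⟨ +-suc _ _ ⟨
    length ys + suc (length zs)     ≡⟨ length-++ ys ⟨
    length (ys ++ f x ∷ zs)         ∎
    where
    open ≤-Reasoning
    into′ : ∀ {a} → a ∈ xs → f a ∈ ys ++ zs
    into′ {a} a∈xs with ∈-++⁻ ys (into (there a∈xs))
    ... | inj₁ p         = ∈-++⁺ˡ p
    ... | inj₂ (there p) = ∈-++⁺ʳ ys p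
    ... | inj₂ (here fa≡fx) = contradiction (sym (inj (there a∈xs) (here refl) fa≡fx)) (lookup x∉xs a∈xs)

  card-≤ : ∀ {A B : Set} {P : A → Set} {Q : B → Set} (E : Enumeration P) (F : Enumeration Q) (f : A → B) (g : B → A) →
    (∀ {a} → P a → Q (f a)) → (∀ {a} → P a → g (f a) ≡ a) → card E ≤ card F
  card-≤ E F f g f-ok gf = length-injection f (unique E) (complete F ∘ f-ok ∘ sound E)
    (λ p q fa≡fb → trans (sym (gf (sound E p))) (trans (cong g fa≡fb) (gf (sound E q))))

  card-bijection : ∀ {A B : Set} {P : A → Set} {Q : B → Set} (E : Enumeration P) (F : Enumeration Q) (f : A → B) (g : B → A) →
    (∀ {a} → P a → Q (f a)) → (∀ {b} → Q b → P (g b)) →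
    (∀ {a} → P a → g (f a) ≡ a) → (∀ {b} → Q b → f (g b) ≡ b) → card E ≡ card F
  card-bijection E F f g f-ok g-ok gf fg = ≤-antisym (card-≤ E F f g f-ok gf) (card-≤ F E g f g-ok fg)

  -- The orbits of size two are represented by their element of smaller μ.
  involution-parity : ∀ {A : Set} {P : A → Set} (E : Enumeration P) (f : A → A) (μ : A → ℕ) →
    (∀ {a} → P a → P (f a)) → (∀ {a} → P a → f (f a) ≡ a) →
    card E ≡ card (restrict (λ a → μ a ≟ μ (f a)) E) + 2 * card (restrict (λ a → μ a <? μ (f a)) E)
  involution-parity {P = P} E f μ f-ok ff = begin
    card E                              ≡⟨ length-filter-split (λ a → μ a ≟ μ (f a)) (list E) ⟩
    card E≡ + card E≢                   ≡⟨ cong (card E≡ +_) (length-filter-split (λ a → μ a <? μ (f a)) (list E≢)) ⟩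
    card E≡ + (card E≢< + card E≢≮)     ≡⟨ cong (card E≡ +_) (cong₂ _+_ E≢<-card E≢≮-card) ⟩
    card E≡ + (card E< + card E<)       ≡⟨ cong (λ t → card E≡ + (card E< + t)) (+-identityʳ _) ⟨
    card E≡ + 2 * card E<               ∎
    where
    open ≡-Reasoning
    E≡ = restrict (λ a → μ a ≟ μ (f a)) E
    E≢ = restrict (λ a → ¬? (μ a ≟ μ (f a))) E
    E≢< = restrict (λ a → μ a <? μ (f a)) E≢
    E≢≮ = restrict (λ a → ¬? (μ a <? μ (f a))) E≢
    E< = restrict (λ a → μ a <? μ (f a)) E
    E≢<-card : card E≢< ≡ card E<
    E≢<-card = card-bijection E≢< E< id id (λ ((p , _) , lt) → p , lt) (λ (p , lt) → (p , <⇒≢ lt) , lt) (λ _ → refl) (λ _ → refl)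
    E≢≮-card : card E≢≮ ≡ card E<
    E≢≮-card = card-bijection E≢≮ E< f f
      (λ {a} ((p , ne) , nlt) → f-ok p , subst (λ t → μ (f a) < μ t) (sym (ff p)) (≤∧≢⇒< (≮⇒≥ nlt) (ne ∘ sym)))
      (λ {a} (p , lt) → (f-ok p , λ e → <⇒≢ lt (trans (cong μ (sym (ff p))) (sym e)))
                      , λ lt′ → <-asym lt (subst (λ t → μ (f a) < μ t) (ff p) lt′))
      (λ ((p , _) , _) → ff p) (λ (p , _) → ff p)

  residues₈ : ∀ (Q : ℕ → Set) → Q 0 → Q 1 → Q 2 → Q 3 → Q 4 → Q 5 → Q 6 → Q 7 → ∀ x → Q (x % 8)
  residues₈ Q q₀ q₁ q₂ q₃ q₄ q₅ q₆ q₇ x with x % 8 | m%n<n x 8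
  ... | 0 | _ = q₀
  ... | 1 | _ = q₁
  ... | 2 | _ = q₂
  ... | 3 | _ = q₃
  ... | 4 | _ = q₄
  ... | 5 | _ = q₅
  ... | 6 | _ = q₆
  ... | 7 | _ = q₇
  ... | suc (suc (suc (suc (suc (suc (suc (suc _))))))) | s≤s (s≤s (s≤s (s≤s (s≤s (s≤s (s≤s (s≤s ())))))))

  square%8 : ∀ x → (x * x) % 8 ≡ 0 ⊎ (x * x) % 8 ≡ 1 ⊎ (x * x) % 8 ≡ 4
  square%8 x = subst (λ t → t ≡ 0 ⊎ t ≡ 1 ⊎ t ≡ 4) (sym (%-distribˡ-* x x 8))
    (residues₈ (λ r → (r * r) % 8 ≡ 0 ⊎ (r * r) % 8 ≡ 1 ⊎ (r * r) % 8 ≡ 4)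
      (inj₁ refl) (inj₂ (inj₁ refl)) (inj₂ (inj₂ refl)) (inj₂ (inj₁ refl))
      (inj₁ refl) (inj₂ (inj₁ refl)) (inj₂ (inj₂ refl)) (inj₂ (inj₁ refl)) x)

  four-multiple%8 : ∀ x → (4 * x) % 8 ≡ 0 ⊎ (4 * x) % 8 ≡ 4
  four-multiple%8 x = subst (λ t → t ≡ 0 ⊎ t ≡ 4) (sym (%-distribˡ-* 4 x 8))
    (residues₈ (λ r → (4 * r) % 8 ≡ 0 ⊎ (4 * r) % 8 ≡ 4)
      (inj₁ refl) (inj₂ refl) (inj₁ refl) (inj₂ refl) (inj₁ refl) (inj₂ refl) (inj₁ refl) (inj₂ refl) x)

  square≢5 : ∀ x → (x * x) % 8 ≢ 5
  square≢5 x e with square%8 x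
  ... | inj₁ e₀        = contradiction (trans (sym e₀) e) λ ()
  ... | inj₂ (inj₁ e₁) = contradiction (trans (sym e₁) e) λ ()
  ... | inj₂ (inj₂ e₄) = contradiction (trans (sym e₄) e) λ ()

  four-multiple≢5 : ∀ x → (4 * x) % 8 ≢ 5
  four-multiple≢5 x e with four-multiple%8 x
  ... | inj₁ e₀ = contradiction (trans (sym e₀) e) λ ()
  ... | inj₂ e₄ = contradiction (trans (sym e₄) e) λ ()

  -- Zagier's involution on the solutions of x² + 4yz = N. The boundaries x + z = y and x = 2y may
  -- fall into any branch: on them N is the square of x + 2z or a multiple of 4, both impossible for
  -- N ≡ 5 (mod 8).
  zagier : ℕ × ℕ × ℕ → ℕ × ℕ × ℕ
  zagier (x , y , z) with x + z <? y | x <? 2 * y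
  ... | yes _ | _     = x + 2 * z , z , y ∸ (x + z)
  ... | no _  | yes _ = 2 * y ∸ x , y , (x + z) ∸ y
  ... | no _  | no _  = x ∸ 2 * y , (x + z) ∸ y , y

  zagier₁ : ∀ {x y z} → x + z < y → zagier (x , y , z) ≡ (x + 2 * z , z , y ∸ (x + z))
  zagier₁ {x} {y} {z} p with x + z <? y
  ... | yes _ = refl
  ... | no ¬p = contradiction p ¬p

  zagier₂ : ∀ {x y z} → ¬ (x + z < y) → x < 2 * y → zagier (x , y , z) ≡ (2 * y ∸ x , y , (x + z) ∸ y)
  zagier₂ {x} {y} {z} ¬p q with x + z <? y | x <? 2 * y
  ... | yes p | _     = contradiction p ¬p
  ... | no _  | yes _ = refl
  ... | no _  | no ¬q = contradiction q ¬q

  zagier₃ : ∀ {x y z} → ¬ (x + z < y) → ¬ (x < 2 * y) → zagier (x , y , z) ≡ (x ∸ 2 * y , (x + z) ∸ y , y)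
  zagier₃ {x} {y} {z} ¬p ¬q with x + z <? y | x <? 2 * y
  ... | yes p | _     = contradiction p ¬p
  ... | no _  | yes q = contradiction q ¬q
  ... | no _  | no _  = refl

  triple-≡ : ∀ {x y z x′ y′ z′ : ℕ} → x ≡ x′ → y ≡ y′ → z ≡ z′ → (x , y , z) ≡ (x′ , y′ , z′)
  triple-≡ refl refl refl = refl

  module FiveModEight (N : ℕ) (N%8≡5 : N % 8 ≡ 5) where

    Z : ℕ × ℕ × ℕ → Set
    Z (x , y , z) = x * x + 4 * (y * z) ≡ N

    nonsquare : ∀ x → x * x ≢ N
    nonsquare x e = square≢5 x (trans (cong (_% 8) e) N%8≡5)

    non-four-multiple : ∀ x → 4 * x ≢ N
    non-four-multiple x e = four-multiple≢5 x (trans (cong (_% 8) e) N%8≡5)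

    x-positive : ∀ {x y z} → Z (x , y , z) → 0 < x
    x-positive {zero}  {y} {z} e = contradiction e (non-four-multiple (y * z))
    x-positive {suc x}         e = z<s

    y-positive : ∀ {x y z} → Z (x , y , z) → 0 < y
    y-positive {x} {zero}  e = contradiction (trans (sym (+-identityʳ _)) e) (nonsquare x)
    y-positive {x} {suc y} e = z<s

    z-positive : ∀ {x y z} → Z (x , y , z) → 0 < z
    z-positive {x} {y} {zero}  e =
      contradiction (trans (sym (trans (cong (λ t → x * x + 4 * t) (*-zeroʳ y)) (+-identityʳ _))) e) (nonsquare x)
    z-positive {x} {y} {suc z} e = z<s

    -- A view of the three branches in which every truncated difference becomes an explicit summand,
    -- so that the ring solver applies.
    data Case : ℕ × ℕ × ℕ → Set where
      case₁ : ∀ x z t → Case (x , x + z + suc t , z)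
      case₂ : ∀ x y z u v → x + suc u ≡ 2 * y → y + v ≡ x + z → Case (x , y , z)
      case₃ : ∀ u y z → Case (2 * y + u , y , z)

    case : ∀ a → Case a
    case (x , y , z) with x + z <? y | x <? 2 * y
    ... | yes p | _     = subst (λ y → Case (x , y , z)) (trans (+-suc (x + z) _) (m+[n∸m]≡n p)) (case₁ x z (y ∸ suc (x + z)))
    ... | no ¬p | yes q = case₂ x y z (2 * y ∸ suc x) ((x + z) ∸ y) (trans (+-suc x _) (m+[n∸m]≡n q)) (m+[n∸m]≡n (≮⇒≥ ¬p))
    ... | no _  | no ¬q = subst (λ x → Case (x , y , z)) (m+[n∸m]≡n (≮⇒≥ ¬q)) (case₃ (x ∸ 2 * y) y z)

    value₁ : ∀ x z t → zagier (x , x + z + suc t , z) ≡ (x + 2 * z , z , suc t)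
    value₁ x z t = trans (zagier₁ (m<m+n (x + z) z<s)) (triple-≡ refl refl (m+n∸m≡n (x + z) (suc t)))

    value₂ : ∀ x y z u v → x + suc u ≡ 2 * y → y + v ≡ x + z → zagier (x , y , z) ≡ (suc u , y , v)
    value₂ x y z u v e f = trans
      (zagier₂ (≤⇒≯ (subst (y ≤_) f (m≤m+n y v))) (subst (x <_) e (m<m+n x z<s)))
      (triple-≡ (trans (cong (_∸ x) (sym e)) (m+n∸m≡n x (suc u))) refl (trans (cong (_∸ y) (sym f)) (m+n∸m≡n y v)))

    value₃ : ∀ u y z → zagier (2 * y + u , y , z) ≡ (u , u + y + z , y)
    value₃ u y z = trans
      (zagier₃ (≤⇒≯ (subst (y ≤_) (eq u y z) (m≤m+n y (u + y + z)))) (≤⇒≯ (m≤m+n (2 * y) u)))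
      (triple-≡ (m+n∸m≡n (2 * y) u) (trans (cong (_∸ y) (sym (eq u y z))) (m+n∸m≡n y (u + y + z))) refl)
      where eq : ∀ u y z → y + (u + y + z) ≡ 2 * y + u + z
            eq = solve-∀

    zagier-Z : ∀ {a} → Z a → Z (zagier a)
    zagier-Z {a} e with case a
    ... | case₁ x z t = subst Z (sym (value₁ x z t)) (trans (eq x z (suc t)) e)
      where eq : ∀ x z t → (x + 2 * z) * (x + 2 * z) + 4 * (z * t) ≡ x * x + 4 * ((x + z + t) * z)
            eq = solve-∀
    ... | case₃ u y z = subst Z (sym (value₃ u y z)) (trans (eq u y z) e)
      where eq : ∀ u y z → u * u + 4 * ((u + y + z) * y) ≡ (2 * y + u) * (2 * y + u) + 4 * (y * z)
            eq = solve-∀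
    ... | case₂ x y z u′ v e₁ e₂ = subst Z (sym (value₂ x y z u′ v e₁ e₂))
          -- With 4y² added to both sides, the values 2y - x and x + z - y enter only through the
          -- sums in `e₁` and `e₂`.
          (trans (+-cancelˡ-≡ (4 * (y * y)) _ _ (begin
            4 * (y * y) + (u * u + 4 * (y * v))     ≡⟨ eq₁ y u v ⟩
            u * u + 4 * (y * (y + v))               ≡⟨ cong (λ t → u * u + 4 * (y * t)) e₂ ⟩
            u * u + 4 * (y * (x + z))               ≡⟨ eq₂ x y z u ⟩
            u * u + 2 * (2 * y * x) + 4 * (y * z)   ≡⟨ cong (λ t → u * u + 2 * (t * x) + 4 * (y * z)) e₁ ⟨
            u * u + 2 * ((x + u) * x) + 4 * (y * z) ≡⟨ eq₃ x y z u ⟩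
            (x + u) * (x + u) + (x * x + 4 * (y * z)) ≡⟨ cong (λ t → t * t + (x * x + 4 * (y * z))) e₁ ⟩
            (2 * y) * (2 * y) + (x * x + 4 * (y * z)) ≡⟨ eq₄ x y z ⟩
            4 * (y * y) + (x * x + 4 * (y * z))     ∎)) e)
      where
      open ≡-Reasoning
      u = suc u′
      eq₁ : ∀ y u v → 4 * (y * y) + (u * u + 4 * (y * v)) ≡ u * u + 4 * (y * (y + v))
      eq₁ = solve-∀
      eq₂ : ∀ x y z u → u * u + 4 * (y * (x + z)) ≡ u * u + 2 * (2 * y * x) + 4 * (y * z)
      eq₂ = solve-∀
      eq₃ : ∀ x y z u → u * u + 2 * ((x + u) * x) + 4 * (y * z) ≡ (x + u) * (x + u) + (x * x + 4 * (y * z))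
      eq₃ = solve-∀
      eq₄ : ∀ x y z → (2 * y) * (2 * y) + (x * x + 4 * (y * z)) ≡ 4 * (y * y) + (x * x + 4 * (y * z))
      eq₄ = solve-∀

    -- The outer branches are exchanged and the middle one is its own inverse. Positivity of z,
    -- respectively of x, places the image strictly inside the branch that undoes the step.
    zagier-involutive : ∀ {a} → Z a → zagier (zagier a) ≡ a
    zagier-involutive {a} e with case a
    ... | case₁ x z t = trans (cong zagier (trans (value₁ x z t) (triple-≡ (+-comm x (2 * z)) refl refl)))
      (trans (value₃ x z (suc t)) refl)
    ... | case₃ u y zero    = contradiction (z-positive {2 * y + u} {y} e) λ ()
    ... | case₃ u y (suc z) = trans (cong zagier (value₃ u y (suc z)))
      (trans (value₁ u y z) (triple-≡ (+-comm u (2 * y)) refl refl))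
    ... | case₂ zero    y z u v e₁ e₂ = contradiction (x-positive {zero} {y} {z} e) λ ()
    ... | case₂ (suc x) y z u v e₁ e₂ = trans (cong zagier (value₂ (suc x) y z u v e₁ e₂))
      (value₂ (suc u) y v x z (trans (+-comm (suc u) (suc x)) e₁)
        (+-cancelˡ-≡ (suc x) _ _ (begin
          suc x + (y + z)       ≡⟨ eq₁ (suc x) y z ⟩
          y + (suc x + z)       ≡⟨ cong (y +_) e₂ ⟨
          y + (y + v)           ≡⟨ eq₂ y v ⟩
          2 * y + v             ≡⟨ cong (_+ v) e₁ ⟨
          suc x + suc u + v     ≡⟨ +-assoc (suc x) (suc u) v ⟩
          suc x + (suc u + v)   ∎)))
      where
      open ≡-Reasoning
      eq₁ : ∀ x y z → x + (y + z) ≡ y + (x + z)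
      eq₁ = solve-∀
      eq₂ : ∀ y v → y + (y + v) ≡ 2 * y + v
      eq₂ = solve-∀

  n≤n*n : ∀ n → n ≤ n * n
  n≤n*n zero    = z≤n
  n≤n*n (suc n) = m≤m*n (suc n) (suc n)

  reps? : ∀ N → Decidable (λ ((x , y) : ℕ × ℕ) → x * x + 4 * (y * y) ≡ N)
  reps? N (x , y) = x * x + 4 * (y * y) ≟ N

  representations : ∀ N → Enumeration (λ (x , y) → x * x + 4 * (y * y) ≡ N)
  representations N = enumerate₂ (reps? N) N λ {x} {y} e →
      subst (x ≤_) e (≤-trans (n≤n*n x) (m≤m+n _ _))
    , subst (y ≤_) e (≤-trans (≤-trans (n≤n*n y) (m≤n*m (y * y) 4)) (m≤n+m _ (x * x)))

  reps : ℕ → ℕ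
  reps N = card (representations N)

  factorisations : ∀ N → .{{NonZero N}} → Enumeration (λ (d , e) → d * e ≡ N)
  factorisations N = enumerate₂ (λ (d , e) → d * e ≟ N) N λ { {d} {e} refl →
      m≤m*n d e {{m*n≢0⇒n≢0 d}} , m≤n*m e d {{m*n≢0⇒m≢0 d}} }

  τ : ∀ N → .{{NonZero N}} → ℕ
  τ N = card (factorisations N)

  -- Modulo 4 the product is 1, so both factors are the same odd residue. This makes z = (e - d)/4
  -- an integer when a factorisation d e = N is turned back into a solution.
  four∣difference : ∀ d t → (d * (d + t)) % 8 ≡ 5 → t % 4 ≡ 0
  four∣difference d t e = go (d % 4) (t % 4) (m%n<n d 4) (m%n<n t 4) (begin
    ((d % 4) * ((d % 4 + t % 4) % 4)) % 4     ≡⟨ cong (λ s → ((d % 4) * s) % 4) (%-distribˡ-+ d t 4) ⟨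
    ((d % 4) * ((d + t) % 4)) % 4             ≡⟨ %-distribˡ-* d (d + t) 4 ⟨
    (d * (d + t)) % 4                         ≡⟨ %-remove-8 (d * (d + t)) ⟩
    ((d * (d + t)) % 8) % 4                   ≡⟨ cong (_% 4) e ⟩
    1 ∎)
    where
    open ≡-Reasoning
    %-remove-8 : ∀ n → n % 4 ≡ (n % 8) % 4
    %-remove-8 n = sym (m∣n⇒o%n%m≡o%m 4 8 n (divides 2 refl))
    go : ∀ r s → r < 4 → s < 4 → (r * ((r + s) % 4)) % 4 ≡ 1 → s ≡ 0
    go r 0 _ _ _ = refl
    go 0 _ _ _ ()
    go 1 1 _ _ ()
    go 1 2 _ _ ()
    go 1 3 _ _ ()
    go 2 1 _ _ ()
    go 2 2 _ _ ()
    go 2 3 _ _ ()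
    go 3 1 _ _ ()
    go 3 2 _ _ ()
    go 3 3 _ _ ()
    go (suc (suc (suc (suc _)))) _ (s≤s (s≤s (s≤s (s≤s ())))) _ _
    go _ (suc (suc (suc (suc _)))) _ (s≤s (s≤s (s≤s (s≤s ())))) _

  -- Heath-Brown and Zagier: the solutions of x² + 4yz = N are counted modulo 2
  -- by the fixed points y = z of the swap, and by the fixed points x = y of
  -- Zagier's involution, where N = x(x + 4z).
  reps-parity : ∀ N → .{{_ : NonZero N}} → N % 8 ≡ 5 →
    ∃ λ h → τ N ≡ 2 * h × ∃ λ a → ∃ λ b → reps N + 2 * a ≡ h + 2 * b
  reps-parity N N%8≡5 =
    card half , τ≡ , card swapped , card moved ,
    trans (cong (_+ 2 * card swapped) (sym fix-swap))
      (trans (sym (involution-parity E swap-yz (proj₁ ∘ proj₂) (λ {a} → swap-Z {a}) (λ _ → refl)))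
        (trans (involution-parity E zagier proj₁ (λ {a} → zagier-Z {a}) (λ {a} → zagier-involutive {a})) (cong (_+ 2 * card moved) fix-zagier)))
    where
    open FiveModEight N N%8≡5

    E : Enumeration Z
    E = enumerate₃ (λ (x , y , z) → x * x + 4 * (y * z) ≟ N) N λ {x} {y} {z} e →
        subst (x ≤_) e (≤-trans (n≤n*n x) (m≤m+n _ _))
      , subst (y ≤_) e (≤-trans (≤-trans (m≤m*n y z {{>-nonZero (z-positive {x} {y} e)}}) (m≤n*m (y * z) 4)) (m≤n+m _ (x * x)))
      , subst (z ≤_) e (≤-trans (≤-trans (m≤n*m z y {{>-nonZero (y-positive {x} {y} {z} e)}}) (m≤n*m (y * z) 4)) (m≤n+m _ (x * x)))

    swap-yz : ℕ × ℕ × ℕ → ℕ × ℕ × ℕ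
    swap-yz (x , y , z) = x , z , y

    swapped : Enumeration (λ a → Z a × proj₁ (proj₂ a) < proj₁ (proj₂ (swap-yz a)))
    swapped = restrict (λ a → proj₁ (proj₂ a) <? proj₁ (proj₂ (swap-yz a))) E

    moved : Enumeration (λ a → Z a × proj₁ a < proj₁ (zagier a))
    moved = restrict (λ a → proj₁ a <? proj₁ (zagier a)) E

    swap-Z : ∀ {a} → Z a → Z (swap-yz a)
    swap-Z {x , y , z} e = trans (cong (λ t → x * x + 4 * t) (*-comm z y)) e

    fix-swap : card (restrict (λ (x , y , z) → y ≟ z) E) ≡ reps N
    fix-swap = card-bijection (restrict (λ (x , y , z) → y ≟ z) E) (representations N) (λ (x , y , z) → x , y) (λ (x , y) → x , y , y)
      (λ { (e , refl) → e }) (λ e → e , refl) (λ { (e , refl) → refl }) (λ _ → refl)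

    half : Enumeration (λ ((d , e) : ℕ × ℕ) → d * e ≡ N × d < e)
    half = restrict (λ (d , e) → d <? e) (factorisations N)

    -- Exchanging the two factors fixes no pair, because N ≡ 5 (mod 8) is not a square.
    τ≡ : τ N ≡ 2 * card half
    τ≡ = trans (involution-parity (factorisations N) swap proj₁ (λ {(d , e)} p → trans (*-comm e d) p) (λ _ → refl))
               (cong (_+ 2 * card half) (≤-antisym (length-injection id {ys = []} (unique diagonal) (λ a∈ → ⊥-elim (off-diagonal (sound diagonal a∈))) (λ _ _ e → e)) z≤n))
      where
      diagonal : Enumeration (λ ((d , e) : ℕ × ℕ) → d * e ≡ N × d ≡ e)
      diagonal = restrict (λ (d , e) → d ≟ e) (factorisations N)
      off-diagonal : ∀ {a : ℕ × ℕ} → ¬ (proj₁ a * proj₂ a ≡ N × proj₁ a ≡ proj₂ a)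
      off-diagonal {d , e} (p , refl) = nonsquare d p

    -- The outer branches change x by 2z or 2y, which are positive; the middle branch preserves x
    -- only if 2x = 2y.
    fixed : ∀ {x y z} → Z (x , y , z) → x ≡ proj₁ (zagier (x , y , z)) → x ≡ y
    fixed {x} {y} {z} e p with case (x , y , z)
    ... | case₁ x z t = contradiction (m+1+n≢m x (sym (trans p (trans (cong proj₁ (value₁ x z t)) (cong (x +_) (2z≡ (z-positive {x} {x + z + suc t} e))))))) id
      where
      2z≡ : ∀ {z} → 0 < z → 2 * z ≡ suc (pred z + z)
      2z≡ {suc z} _ = cong suc (trans (cong (z +_) (+-identityʳ (suc z))) refl)
    ... | case₂ x y z u v e₁ e₂ = *-cancelˡ-≡ x y 2 (trans (cong (x +_) (trans (+-identityʳ x) (trans p (cong proj₁ (value₂ x y z u v e₁ e₂))))) e₁)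
    ... | case₃ u y z = contradiction (trans (sym (cong proj₁ (value₃ u y z))) (sym p)) (<⇒≢ (m<n+m u (≤-trans (y-positive {2 * y + u} {y} {z} e) (m≤n*m y 2))))

    fix-zagier : card (restrict (λ a → proj₁ a ≟ proj₁ (zagier a)) E) ≡ card half
    fix-zagier = card-bijection (restrict (λ a → proj₁ a ≟ proj₁ (zagier a)) E) half to from
      (λ {a} → to-ok {a}) (λ {b} → from-ok {b}) (λ {a} → from-to {a}) (λ {b} → to-from {b})
      where
      to : ℕ × ℕ × ℕ → ℕ × ℕ
      to (x , y , z) = x , x + 4 * z
      from : ℕ × ℕ → ℕ × ℕ × ℕ
      from (d , e) = d , d , (e ∸ d) / 4
      exact : ∀ {d e} → d * e ≡ N → d < e → e ≡ d + 4 * ((e ∸ d) / 4)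
      exact {d} {e} p d<e = trans (sym (m+[n∸m]≡n (<⇒≤ d<e))) (cong (d +_) (trans
        (trans (m≡m%n+[m/n]*n (e ∸ d) 4) (cong (_+ (e ∸ d) / 4 * 4) (four∣difference d (e ∸ d)
          (trans (cong (_% 8) (trans (cong (d *_) (m+[n∸m]≡n (<⇒≤ d<e))) p)) N%8≡5))))
        (*-comm ((e ∸ d) / 4) 4)))
      expand : ∀ x z → x * (x + 4 * z) ≡ x * x + 4 * (x * z)
      expand = solve-∀
      to-ok : ∀ {a} → Z a × proj₁ a ≡ proj₁ (zagier a) → proj₁ (to a) * proj₂ (to a) ≡ N × proj₁ (to a) < proj₂ (to a)
      to-ok {x , y , z} (e , p) = trans (expand x z) (trans (cong (λ t → x * x + 4 * (t * z)) (fixed {x} {y} {z} e p)) e)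
                                , m<m+n x (≤-trans (z-positive {x} {y} e) (m≤n*m z 4))
      from-ok : ∀ {b} → proj₁ b * proj₂ b ≡ N × proj₁ b < proj₂ b → Z (from b) × proj₁ (from b) ≡ proj₁ (zagier (from b))
      from-ok {d , e} (p , d<e) = zeq , fix (2*-split (x-positive {d} {d} {(e ∸ d) / 4} zeq))
        where
        zeq : Z (from (d , e))
        zeq = trans (sym (expand d _)) (trans (cong (d *_) (sym (exact p d<e))) p)
        2*-split : 0 < d → d + suc (pred d) ≡ 2 * d
        2*-split 0<d = cong (d +_) (trans (suc-pred d {{>-nonZero 0<d}}) (sym (+-identityʳ d)))
        fix : d + suc (pred d) ≡ 2 * d → d ≡ proj₁ (zagier (from (d , e)))
        fix s = sym (trans (cong proj₁ (value₂ d d ((e ∸ d) / 4) (pred d) ((e ∸ d) / 4) s refl)) (suc-pred d {{>-nonZero (x-positive {d} {d} {(e ∸ d) / 4} zeq)}}))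
      from-to : ∀ {a} → Z a × proj₁ a ≡ proj₁ (zagier a) → from (to a) ≡ a
      from-to {x , y , z} (e , p) = triple-≡ refl (fixed {x} {y} {z} e p)
        (trans (cong (_/ 4) (trans (m+n∸m≡n x (4 * z)) (*-comm 4 z))) (m*n/n≡m z 4))
      to-from : ∀ {b} → proj₁ b * proj₂ b ≡ N × proj₁ b < proj₂ b → to (from b) ≡ b
      to-from {d , e} (p , d<e) = cong (d ,_) (sym (exact p d<e))

  coprime-factorisations : ∀ p N → .{{_ : NonZero N}} → Enumeration (λ ((d , e) : ℕ × ℕ) → d * e ≡ N × ¬ (p ∣ d))
  coprime-factorisations p N = restrict (λ (d , e) → ¬? (p ∣? d)) (factorisations N)

  module PrimePowers {p} (p-prime : Prime p) where

    private instance
      p≢0 : NonZero p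
      p≢0 = prime⇒nonZero p-prime

    τ₀ : ∀ N → .{{NonZero N}} → ℕ
    τ₀ N = card (coprime-factorisations p N)

    [p*m]/p≡m : ∀ m → p * m / p ≡ m
    [p*m]/p≡m m = trans (cong (_/ p) (*-comm p m)) (m*n/n≡m m p)

    p*[n/p]≡n : ∀ {n} → p ∣ n → p * (n / p) ≡ n
    p*[n/p]≡n p∣n = trans (*-comm p _) (m/n*n≡m p∣n)

    -- If p does not divide d, Euclid's lemma puts the extra factor p into e.
    τ₀-p* : ∀ N .{{_ : NonZero N}} .{{_ : NonZero (p * N)}} → τ₀ (p * N) ≡ τ₀ N
    τ₀-p* N = card-bijection (coprime-factorisations p (p * N)) (coprime-factorisations p N)
      (λ (d , e) → d , e / p) (λ (d , e) → d , p * e)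
      (λ {a} (eq , ∤d) → *-cancelˡ-≡ _ _ p (trans (pull (proj₁ a) (proj₂ a / p)) (trans (cong (proj₁ a *_) (p*[n/p]≡n (p∣e a eq ∤d))) eq)) , ∤d)
      (λ {b} (eq , ∤d) → trans (sym (pull (proj₁ b) (proj₂ b))) (cong (p *_) eq) , ∤d)
      (λ {a} (eq , ∤d) → cong (proj₁ a ,_) (p*[n/p]≡n (p∣e a eq ∤d)))
      (λ {b} _ → cong (proj₁ b ,_) ([p*m]/p≡m (proj₂ b)))
      where
      pull : ∀ d e → p * (d * e) ≡ d * (p * e)
      pull d e = trans (sym (*-assoc p d e)) (trans (cong (_* e) (*-comm p d)) (*-assoc d p e))
      p∣e : ∀ ((d , e) : ℕ × ℕ) → d * e ≡ p * N → ¬ (p ∣ d) → p ∣ e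
      p∣e (d , e) eq ∤d with euclidsLemma d e p-prime (subst (p ∣_) (sym eq) (m∣m*n N))
      ... | inj₁ p∣d = contradiction p∣d ∤d
      ... | inj₂ p∣e = p∣e

    -- Pairs with p dividing d lose that p and become arbitrary factorisations of N; the other pairs
    -- are counted by `τ₀`, which an extra p leaves alone.
    τ-p* : ∀ N .{{_ : NonZero N}} .{{_ : NonZero (p * N)}} → τ (p * N) ≡ τ₀ N + τ N
    τ-p* N = begin
      τ (p * N)                     ≡⟨ length-filter-split (λ (d , e) → p ∣? d) (list (factorisations (p * N))) ⟩
      card multiples + τ₀ (p * N)   ≡⟨ cong₂ _+_ multiples-card (τ₀-p* N) ⟩
      τ N + τ₀ N                    ≡⟨ +-comm (τ N) (τ₀ N) ⟩
      τ₀ N + τ N                    ∎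
      where
      open ≡-Reasoning
      multiples : Enumeration (λ ((d , e) : ℕ × ℕ) → d * e ≡ p * N × p ∣ d)
      multiples = restrict (λ (d , e) → p ∣? d) (factorisations (p * N))
      multiples-card : card multiples ≡ τ N
      multiples-card = card-bijection multiples (factorisations N) (λ (d , e) → d / p , e) (λ (d , e) → p * d , e)
        (λ {a} (eq , p∣d) → *-cancelˡ-≡ _ _ p (trans (sym (*-assoc p (proj₁ a / p) (proj₂ a))) (trans (cong (_* proj₂ a) (p*[n/p]≡n p∣d)) eq)))
        (λ {b} eq → trans (*-assoc p (proj₁ b) (proj₂ b)) (cong (p *_) eq) , m∣m*n (proj₁ b))
        (λ {a} (eq , p∣d) → cong (_, proj₂ a) (p*[n/p]≡n p∣d))
        (λ {b} _ → cong (_, proj₂ b) ([p*m]/p≡m (proj₁ b)))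

    τ₀-coprime : ∀ M .{{_ : NonZero M}} → ¬ (p ∣ M) → τ₀ M ≡ τ M
    τ₀-coprime M ∤M = card-bijection (coprime-factorisations p M) (factorisations M) id id
      proj₁ (λ {a} eq → eq , λ p∣d → ∤M (subst (p ∣_) eq (∣m⇒∣m*n (proj₂ a) p∣d))) (λ _ → refl) (λ _ → refl)

    private
      p^e*M≢0 : ∀ e M .{{_ : NonZero M}} → NonZero (p ^ e * M)
      p^e*M≢0 e M = m*n≢0 (p ^ e) M {{m^n≢0 p e}}

    τ₀-prime-power : ∀ e M .{{_ : NonZero M}} .{{_ : NonZero (p ^ e * M)}} → ¬ (p ∣ M) → τ₀ (p ^ e * M) ≡ τ M
    τ₀-prime-power zero    M ∤M rewrite *-identityˡ M = τ₀-coprime M ∤M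
    τ₀-prime-power (suc e) M {{M≢0}} ∤M rewrite *-assoc p (p ^ e) M =
      trans (τ₀-p* (p ^ e * M) {{p^e*M≢0 e M}}) (τ₀-prime-power e M {{M≢0}} {{p^e*M≢0 e M}} ∤M)

    τ-prime-power : ∀ e M .{{_ : NonZero M}} .{{_ : NonZero (p ^ e * M)}} → ¬ (p ∣ M) → τ (p ^ e * M) ≡ suc e * τ M
    τ-prime-power zero    M ∤M rewrite *-identityˡ M = sym (*-identityˡ (τ M))
    τ-prime-power (suc e) M {{M≢0}} ∤M rewrite *-assoc p (p ^ e) M =
      trans (τ-p* (p ^ e * M) {{p^e*M≢0 e M}})
        (cong₂ _+_ (τ₀-prime-power e M {{M≢0}} {{p^e*M≢0 e M}} ∤M) (τ-prime-power e M {{M≢0}} {{p^e*M≢0 e M}} ∤M))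

  reps%2 : ∀ N → .{{_ : NonZero N}} → N % 8 ≡ 5 → ∀ h → τ N ≡ 2 * h → reps N % 2 ≡ h % 2
  reps%2 N N%8≡5 h τ≡ with reps-parity N N%8≡5
  ... | h′ , τ≡′ , a , b , e with *-cancelˡ-≡ h′ h 2 (trans (sym τ≡′) τ≡)
  ... | refl = begin
    reps N % 2             ≡⟨ [m+kn]%n≡m%n (reps N) a 2 ⟨
    (reps N + a * 2) % 2   ≡⟨ cong (_% 2) (trans (cong (reps N +_) (*-comm a 2)) (trans e (cong (h +_) (*-comm 2 b)))) ⟩
    (h + b * 2) % 2        ≡⟨ [m+kn]%n≡m%n h b 2 ⟩
    h % 2 ∎
    where open ≡-Reasoning

  %8≡5⇒nonZero : ∀ {N} → N % 8 ≡ 5 → NonZero N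
  %8≡5⇒nonZero {suc N} _ = _

  -- The exponent 3 + 4j contributes 4 (j + 1) to the divisor count, so half of that count is still
  -- even.
  reps-even : ∀ {p} → Prime p → ∀ j M → ¬ (p ∣ M) → (p ^ (3 + 4 * j) * M) % 8 ≡ 5 → reps (p ^ (3 + 4 * j) * M) % 2 ≡ 0
  reps-even {p} p-prime j M ∤M N%8≡5 = trans (reps%2 N N%8≡5 (2 * (suc j * τ M))
      (trans (PrimePowers.τ-prime-power p-prime (3 + 4 * j) M ∤M) (eq j (τ M))))
    (m*n%n≡0′ (suc j * τ M))
    where
    N = p ^ (3 + 4 * j) * M
    instance
      N≢0 : NonZero N
      N≢0 = %8≡5⇒nonZero N%8≡5
      M≢0 : NonZero M
      M≢0 = m*n≢0⇒n≢0 (p ^ (3 + 4 * j))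
    eq : ∀ j t → (4 + 4 * j) * t ≡ 2 * (2 * (suc j * t))
    eq = solve-∀
    m*n%n≡0′ : ∀ k → (2 * k) % 2 ≡ 0
    m*n%n≡0′ k = trans (cong (_% 2) (*-comm 2 k)) (m*n%n≡0 k 2)

  odd-square%8 : ∀ x → x % 2 ≡ 1 → (x * x) % 8 ≡ 1
  odd-square%8 x x-odd = trans (%-distribˡ-* x x 8)
    (residues₈ (λ r → r % 2 ≡ 1 → (r * r) % 8 ≡ 1) (λ ()) (λ _ → refl) (λ ()) (λ _ → refl) (λ ()) (λ _ → refl) (λ ()) (λ _ → refl) x
      (trans (m∣n⇒o%n%m≡o%m 2 8 x (divides 4 refl)) x-odd))

  odd-square*5%8 : ∀ x → x % 2 ≡ 1 → (x ^ 2 * 5) % 8 ≡ 5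
  odd-square*5%8 x x-odd = trans (cong (λ t → (x * t * 5) % 8) (*-identityʳ x))
    (trans (%-distribˡ-* (x * x) 5 8) (cong (λ r → (r * 5) % 8) (odd-square%8 x x-odd)))

  prime∣5⇒≡5 : ∀ {p} → Prime p → p ∣ 5 → p ≡ 5
  prime∣5⇒≡5 p-prime p∣5 with prime⇒irreducible (from-yes (prime? 5)) p∣5
  ... | inj₁ refl = contradiction p-prime ¬prime[1]
  ... | inj₂ p≡5  = p≡5

  -- There are 3 · 2 = 6 divisors, and half of 6 is odd.
  reps-p²*5 : ∀ {p} → Prime p → p % 2 ≡ 1 → p ≢ 5 → reps (p ^ 2 * 5) % 2 ≡ 1
  reps-p²*5 {p} p-prime p-odd p≢5 = reps%2 (p ^ 2 * 5) N%8≡5 3 (PrimePowers.τ-prime-power p-prime 2 5 ∤5)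
    where
    N%8≡5 = odd-square*5%8 p p-odd
    instance
      N≢0 : NonZero (p ^ 2 * 5)
      N≢0 = %8≡5⇒nonZero N%8≡5
    ∤5 : ¬ (p ∣ 5)
    ∤5 p∣5 = p≢5 (prime∣5⇒≡5 p-prime p∣5)

open import Defs

-- Truncated power series modulo k, supports and counting series.

module PowerSeries where

  open import Algebra.Bundles using (CommutativeRing)
  open import Data.Bool.Base using (Bool; true; false; if_then_else_; T)
  open import Data.Bool.Properties using (if-float)
  open import Data.Integer.Base using (ℤ; +_; 0ℤ; _+_; _*_; -_; _-_)
  open import Data.Integer.Divisibility.Signed using (_∣_; divides; ∣m∣n⇒∣m+n; ∣m⇒∣-m; ∣n⇒∣m*n; ∣m⇒∣m*n; 0∣⇒≡0)
  import Data.Integer.Properties as ℤ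
  open import Data.Integer.Tactic.RingSolver using (solve-∀)
  open import Data.List.Base using (List; []; _∷_; _++_; map; filter; length; cartesianProduct)
  open import Data.Nat.Base as ℕ using (ℕ; zero; suc; _≤_; _<_; z≤n; s≤s)
  open import Data.Nat.Properties as ℕ using (_≟_)
  open import Data.Product.Base using (_,_; _×_)
  open import Function.Base using (_∘_; _$_)
  open import Relation.Binary.PropositionalEquality hiding ([_])
  open import Relation.Nullary.Decidable using (yes; no; does)
  open import Relation.Nullary.Negation using (¬_; contradiction)
  import Level
  open import Relation.Unary using (Pred; Decidable)

  0S : Series
  0S _ = 0ℤ

  _⊞_ : Series → Series → Series
  (a ⊞ b) n = a n + b n

  ⊟_ : Series → Series
  (⊟ a) n = - a n

  infix 4 _≡_[_]
  -- The modulus 0 is allowed and means equality of integers, so exact identities of series come out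
  -- as instances of congruences.
  record _≡_[_] (x y : ℤ) (k : ℕ) : Set where
    constructor congruent
    field difference : + k ∣ x - y
  open _≡_[_]

  module _ {k : ℕ} where

    mod-reflexive : ∀ {x y} → x ≡ y → x ≡ y [ k ]
    mod-reflexive {x} refl = congruent $ divides 0ℤ (ℤ.+-inverseʳ x)

    mod-sym : ∀ {x y} → x ≡ y [ k ] → y ≡ x [ k ]
    mod-sym {x} {y} p = congruent $ subst (+ k ∣_) (eq x y) (∣m⇒∣-m (difference p))
      where eq : ∀ x y → - (x - y) ≡ y - x
            eq = solve-∀

    mod-trans : ∀ {x y z} → x ≡ y [ k ] → y ≡ z [ k ] → x ≡ z [ k ]
    mod-trans {x} {y} {z} p q = congruent $ subst (+ k ∣_) (eq x y z) (∣m∣n⇒∣m+n (difference p) (difference q))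
      where eq : ∀ x y z → (x - y) + (y - z) ≡ x - z
            eq = solve-∀

    mod-+ : ∀ {x x′ y y′} → x ≡ x′ [ k ] → y ≡ y′ [ k ] → x + y ≡ x′ + y′ [ k ]
    mod-+ {x} {x′} {y} {y′} p q = congruent $ subst (+ k ∣_) (eq x x′ y y′) (∣m∣n⇒∣m+n (difference p) (difference q))
      where eq : ∀ x x′ y y′ → (x - x′) + (y - y′) ≡ (x + y) - (x′ + y′)
            eq = solve-∀

    mod-* : ∀ {x x′ y y′} → x ≡ x′ [ k ] → y ≡ y′ [ k ] → x * y ≡ x′ * y′ [ k ]
    mod-* {x} {x′} {y} {y′} p q = congruent $
      subst (+ k ∣_) (eq x x′ y y′) (∣m∣n⇒∣m+n (∣m⇒∣m*n y (difference p)) (∣n⇒∣m*n x′ (difference q)))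
      where eq : ∀ x x′ y y′ → (x - x′) * y + x′ * (y - y′) ≡ x * y - x′ * y′
            eq = solve-∀

    mod-neg : ∀ {x x′} → x ≡ x′ [ k ] → - x ≡ - x′ [ k ]
    mod-neg {x} {x′} p = congruent $ subst (+ k ∣_) (eq x x′) (∣m⇒∣-m (difference p))
      where eq : ∀ x x′ → - (x - x′) ≡ - x - - x′
            eq = solve-∀

    ∣-resp-mod : ∀ {x y} → x ≡ y [ k ] → + k ∣ y → + k ∣ x
    ∣-resp-mod {x} {y} p q = subst (+ k ∣_) (eq x y) (∣m∣n⇒∣m+n (difference p) q)
      where eq : ∀ x y → (x - y) + y ≡ x
            eq = solve-∀

    ∣⇒mod-0 : ∀ {x} → + k ∣ x → x ≡ 0ℤ [ k ]
    ∣⇒mod-0 {x} p = congruent $ subst (+ k ∣_) (sym (ℤ.+-identityʳ x)) p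

    ⊛-mod : ∀ n {a a′ b b′} → (∀ i → i ≤ n → a i ≡ a′ i [ k ]) → (∀ i → i ≤ n → b i ≡ b′ i [ k ]) →
            (a ⊛ b) n ≡ (a′ ⊛ b′) n [ k ]
    ⊛-mod zero    p q = mod-+ (mod-* (p 0 z≤n) (q 0 z≤n)) (mod-reflexive refl)
    ⊛-mod (suc n) {a} {a′} {b} {b′} p q = mod-+ (mod-* (p 0 z≤n) (q (suc n) ℕ.≤-refl))
      (⊛-mod n {a ∘ suc} {a′ ∘ suc} {b} {b′} (λ i i≤n → p (suc i) (s≤s i≤n)) (λ i i≤n → q i (ℕ.m≤n⇒m≤1+n i≤n)))

  mod-0⇒≡ : ∀ {x y} → x ≡ y [ 0 ] → x ≡ y
  mod-0⇒≡ {x} {y} p = ℤ.i-j≡0⇒i≡j x y (0∣⇒≡0 (difference p))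

  ⊛-cong : ∀ {a a′ b b′} → a ≗ a′ → b ≗ b′ → a ⊛ b ≗ a′ ⊛ b′
  ⊛-cong {a} {a′} {b} {b′} p q n = mod-0⇒≡ (⊛-mod n {a} {a′} {b} {b′} (λ i _ → mod-reflexive (p i)) (λ i _ → mod-reflexive (q i)))

  ⊛-distribʳ : ∀ a b c n → ((a ⊞ b) ⊛ c) n ≡ (a ⊛ c) n + (b ⊛ c) n
  ⊛-distribʳ a b c zero    = eq (a 0) (b 0) (c 0)
    where eq : ∀ x y z → (x + y) * z + 0ℤ ≡ (x * z + 0ℤ) + (y * z + 0ℤ)
          eq = solve-∀
  ⊛-distribʳ a b c (suc n) =
    trans (cong (λ t → (a 0 + b 0) * c (suc n) + t) (⊛-distribʳ (a ∘ suc) (b ∘ suc) c n))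
      (eq (a 0) (b 0) (c (suc n)) (((a ∘ suc) ⊛ c) n) (((b ∘ suc) ⊛ c) n))
    where eq : ∀ x y z u v → (x + y) * z + (u + v) ≡ (x * z + u) + (y * z + v)
          eq = solve-∀

  ⊛-scale : ∀ r a b n → ((λ i → r * a i) ⊛ b) n ≡ r * (a ⊛ b) n
  ⊛-scale r a b zero    = eq r (a 0) (b 0)
    where eq : ∀ r x y → r * x * y + 0ℤ ≡ r * (x * y + 0ℤ)
          eq = solve-∀
  ⊛-scale r a b (suc n) = trans (cong (λ t → r * a 0 * b (suc n) + t) (⊛-scale r (a ∘ suc) b n))
      (eq r (a 0) (b (suc n)) (((a ∘ suc) ⊛ b) n))
    where eq : ∀ r x y z → r * x * y + r * z ≡ r * (x * y + z)
          eq = solve-∀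

  ⊛-zeroˡ : ∀ b n → (0S ⊛ b) n ≡ 0ℤ
  ⊛-zeroˡ b zero    = refl
  ⊛-zeroˡ b (suc n) = trans (ℤ.+-identityˡ _) (⊛-zeroˡ b n)

  -- The product unfolds by detaching the first coefficient of its left factor. The two sides become
  -- symmetric only after one coefficient of each factor is detached, hence the induction in steps
  -- of two.
  ⊛-comm : ∀ a b n → (a ⊛ b) n ≡ (b ⊛ a) n
  ⊛-comm a b zero          = cong (_+ 0ℤ) (ℤ.*-comm (a 0) (b 0))
  ⊛-comm a b (suc zero)    = eq (a 0) (a 1) (b 0) (b 1)
    where eq : ∀ x x′ y y′ → x * y′ + (x′ * y + 0ℤ) ≡ y * x′ + (y′ * x + 0ℤ)
          eq = solve-∀
  ⊛-comm a b (suc (suc n)) = begin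
    a 0 * b (2 ℕ.+ n) + ((a ∘ suc) ⊛ b) (suc n)
      ≡⟨ cong (_+_ (a 0 * b (2 ℕ.+ n))) (⊛-comm (a ∘ suc) b (suc n)) ⟩
    a 0 * b (2 ℕ.+ n) + (b 0 * a (2 ℕ.+ n) + ((b ∘ suc) ⊛ (a ∘ suc)) n)
      ≡⟨ cong (λ t → a 0 * b (2 ℕ.+ n) + (b 0 * a (2 ℕ.+ n) + t)) (⊛-comm (b ∘ suc) (a ∘ suc) n) ⟩
    a 0 * b (2 ℕ.+ n) + (b 0 * a (2 ℕ.+ n) + ((a ∘ suc) ⊛ (b ∘ suc)) n)
      ≡⟨ eq (a 0 * b (2 ℕ.+ n)) (b 0 * a (2 ℕ.+ n)) (((a ∘ suc) ⊛ (b ∘ suc)) n) ⟩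
    b 0 * a (2 ℕ.+ n) + (a 0 * b (2 ℕ.+ n) + ((a ∘ suc) ⊛ (b ∘ suc)) n)
      ≡⟨ cong (_+_ (b 0 * a (2 ℕ.+ n))) (⊛-comm a (b ∘ suc) (suc n)) ⟩
    b 0 * a (2 ℕ.+ n) + ((b ∘ suc) ⊛ a) (suc n) ∎
    where
    open ≡-Reasoning
    eq : ∀ x y z → x + (y + z) ≡ y + (x + z)
    eq = solve-∀

  ⊛-assoc : ∀ a b c n → ((a ⊛ b) ⊛ c) n ≡ (a ⊛ (b ⊛ c)) n
  ⊛-assoc a b c zero    = eq (a 0) (b 0) (c 0)
    where eq : ∀ x y z → (x * y + 0ℤ) * z + 0ℤ ≡ x * (y * z + 0ℤ) + 0ℤ
          eq = solve-∀
  ⊛-assoc a b c (suc n) = begin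
    (a 0 * b 0 + 0ℤ) * c (suc n) + (((λ i → a 0 * b (suc i)) ⊞ ((a ∘ suc) ⊛ b)) ⊛ c) n
      ≡⟨ cong (_+_ ((a 0 * b 0 + 0ℤ) * c (suc n))) (⊛-distribʳ (λ i → a 0 * b (suc i)) ((a ∘ suc) ⊛ b) c n) ⟩
    (a 0 * b 0 + 0ℤ) * c (suc n) + (((λ i → a 0 * b (suc i)) ⊛ c) n + (((a ∘ suc) ⊛ b) ⊛ c) n)
      ≡⟨ cong₂ (λ s t → (a 0 * b 0 + 0ℤ) * c (suc n) + (s + t)) (⊛-scale (a 0) (b ∘ suc) c n) (⊛-assoc (a ∘ suc) b c n) ⟩
    (a 0 * b 0 + 0ℤ) * c (suc n) + (a 0 * ((b ∘ suc) ⊛ c) n + ((a ∘ suc) ⊛ (b ⊛ c)) n)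
      ≡⟨ eq (a 0) (b 0) (c (suc n)) (((b ∘ suc) ⊛ c) n) (((a ∘ suc) ⊛ (b ⊛ c)) n) ⟩
    a 0 * (b 0 * c (suc n) + ((b ∘ suc) ⊛ c) n) + ((a ∘ suc) ⊛ (b ⊛ c)) n ∎
    where
    open ≡-Reasoning
    eq : ∀ x y z u v → (x * y + 0ℤ) * z + (x * u + v) ≡ x * (y * z + u) + v
    eq = solve-∀

  ⊛-distribˡ : ∀ a b c n → (a ⊛ (b ⊞ c)) n ≡ (a ⊛ b) n + (a ⊛ c) n
  ⊛-distribˡ a b c n = trans (⊛-comm a (b ⊞ c) n)
    (trans (⊛-distribʳ b c a n) (cong₂ _+_ (⊛-comm b a n) (⊛-comm c a n)))

  ⊛-identityˡ : ∀ b n → ((q^ 0) ⊛ b) n ≡ b n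
  ⊛-identityˡ b zero    = trans (ℤ.+-identityʳ _) (ℤ.*-identityˡ (b 0))
  ⊛-identityˡ b (suc n) = trans (cong₂ _+_ (ℤ.*-identityˡ (b (suc n))) (⊛-zeroˡ b n)) (ℤ.+-identityʳ _)

  infix 4 _≈_[_,_]
  record _≈_[_,_] (a b : Series) (k L : ℕ) : Set where
    constructor agree
    field coeff : ∀ n → n < L → a n ≡ b n [ k ]
  open _≈_[_,_] public

  ≗⇒≈ : ∀ {a b k L} → a ≗ b → a ≈ b [ k , L ]
  ≗⇒≈ a≗b = agree (λ n _ → mod-reflexive (a≗b n))

  -- The quotient of the power series ring by `k` and q^L, realised as a setoid on the full
  -- coefficient sequences. Multiplication respects it because the coefficient of qⁿ sees only
  -- coefficients up to n.
  truncated : ℕ → ℕ → CommutativeRing _ _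
  truncated k L = record
    { Carrier = Series
    ; _≈_     = λ a b → a ≈ b [ k , L ]
    ; _+_     = _⊞_
    ; _*_     = _⊛_
    ; -_      = ⊟_
    ; 0#      = 0S
    ; 1#      = q^ 0
    ; isCommutativeRing = record
      { isRing = record
        { +-isAbelianGroup = record
          { isGroup = record
            { isMonoid = record
              { isSemigroup = record
                { isMagma = record
                  { isEquivalence = record
                    { refl  = ≗⇒≈ (λ _ → refl)
                    ; sym   = λ p → agree (λ n l → mod-sym (coeff p n l))
                    ; trans = λ p q → agree (λ n l → mod-trans (coeff p n l) (coeff q n l))
                    }
                  ; ∙-cong = λ p q → agree (λ n l → mod-+ (coeff p n l) (coeff q n l))
                  }
                ; assoc = λ a b c → ≗⇒≈ (λ n → ℤ.+-assoc (a n) (b n) (c n))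
                }
              ; identity = (λ a → ≗⇒≈ (λ n → ℤ.+-identityˡ (a n))) , (λ a → ≗⇒≈ (λ n → ℤ.+-identityʳ (a n)))
              }
            ; inverse = (λ a → ≗⇒≈ (λ n → ℤ.+-inverseˡ (a n))) , (λ a → ≗⇒≈ (λ n → ℤ.+-inverseʳ (a n)))
            ; ⁻¹-cong = λ p → agree (λ n l → mod-neg (coeff p n l))
            }
          ; comm = λ a b → ≗⇒≈ (λ n → ℤ.+-comm (a n) (b n))
          }
        ; *-cong = λ {x} {y} {u} {v} p q → agree (λ n l → ⊛-mod n {x} {y} {u} {v} (λ i i≤n → coeff p i (ℕ.≤-<-trans i≤n l)) (λ i i≤n → coeff q i (ℕ.≤-<-trans i≤n l)))
        ; *-assoc = λ a b c → ≗⇒≈ (⊛-assoc a b c)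
        ; *-identity = (λ a → ≗⇒≈ (⊛-identityˡ a)) , (λ a → ≗⇒≈ (λ n → trans (⊛-comm a (q^ 0) n) (⊛-identityˡ a n)))
        ; distrib = (λ a b c → ≗⇒≈ (⊛-distribˡ a b c))
                  , (λ a b c → ≗⇒≈ (⊛-distribʳ b c a))
        }
      ; *-comm = λ a b → ≗⇒≈ (⊛-comm a b)
      }
    }

  q^-⊛ : ∀ m n → (q^ m) ⊛ (q^ n) ≗ (q^ (m ℕ.+ n))
  q^-⊛ zero    n i       = ⊛-identityˡ (q^ n) i
  q^-⊛ (suc m) n zero    = refl
  q^-⊛ (suc m) n (suc i) = trans (ℤ.+-identityˡ _) (q^-⊛ m n i)

  q^-≢ : ∀ {m n} → n ≢ m → (q^ m) n ≡ 0ℤ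
  q^-≢ {zero}  {zero}  n≢m = contradiction refl n≢m
  q^-≢ {zero}  {suc n} n≢m = refl
  q^-≢ {suc m} {zero}  n≢m = refl
  q^-≢ {suc m} {suc n} n≢m = q^-≢ {m} {n} (n≢m ∘ cong suc)

  q^-truncate : ∀ {m k L} → L ≤ m → (q^ m) ≈ 0S [ k , L ]
  q^-truncate {m} L≤m = agree (λ n n<L → mod-reflexive (q^-≢ {m} {n} (ℕ.<⇒≢ (ℕ.<-≤-trans n<L L≤m))))

  q^-^ : ∀ k L m i → let open RingIdentities (truncated k L) in ((q^ m) ^ i) ≈ q^ (i ℕ.* m) [ k , L ]
  q^-^ k L m zero    = CommutativeRing.refl (truncated k L)
  q^-^ k L m (suc i) = CommutativeRing.trans (truncated k L)
    (CommutativeRing.*-congˡ (truncated k L) {q^ m} (q^-^ k L m i)) (≗⇒≈ (q^-⊛ m (i ℕ.* m)))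

  -- Modulo `k` the series has exponents in `P` only. Supports of products are then bounded by
  -- residues of exponents alone, and a coefficient outside the support is divisible by `k`.
  Supp : ∀ {ℓ} → ℕ → Pred ℕ ℓ → Series → Set ℓ
  Supp k P a = ∀ n → ¬ P n → + k ∣ a n

  module _ {k : ℕ} where

    Supp-0 : ∀ {ℓ} {P : Pred ℕ ℓ} → Supp k P 0S
    Supp-0 n _ = divides 0ℤ refl

    Supp-⊞ : ∀ {ℓ} {P : Pred ℕ ℓ} {a b} → Supp k P a → Supp k P b → Supp k P (a ⊞ b)
    Supp-⊞ p q n ¬Pn = ∣m∣n⇒∣m+n (p n ¬Pn) (q n ¬Pn)

    Supp-⊟ : ∀ {ℓ} {P : Pred ℕ ℓ} {a} → Supp k P a → Supp k P (⊟ a)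
    Supp-⊟ p n ¬Pn = ∣m⇒∣-m (p n ¬Pn)

    Supp-q^ : ∀ {ℓ} {P : Pred ℕ ℓ} {m} → P m → Supp k P (q^ m)
    Supp-q^ {P = P} {m} Pm n ¬Pn = divides 0ℤ (q^-≢ {m} {n} (λ { refl → ¬Pn Pm }))

    Supp-⊛ : ∀ {P Q T : Pred ℕ Level.zero} {a b} → Decidable P → Decidable Q →
             (∀ i j → P i → Q j → T (i ℕ.+ j)) → Supp k P a → Supp k Q b → Supp k T (a ⊛ b)
    Supp-⊛ {P} {Q} {T} {a} {b} P? Q? PQT p q n ¬Tn = go n {P} {T} P? p PQT ¬Tn
      where
      term : ∀ {P : Pred ℕ Level.zero} {a : Series} i j → Decidable P → Supp k P a → ¬ (P i × Q j) → + k ∣ a i * b j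
      term {P} {a} i j P? p ¬PQ with P? i | Q? j
      ... | no ¬Pi | _      = ∣m⇒∣m*n (b j) (p i ¬Pi)
      ... | yes _  | no ¬Qj = ∣n⇒∣m*n (a i) (q j ¬Qj)
      ... | yes Pi | yes Qj = contradiction (Pi , Qj) ¬PQ
      -- The induction shifts the left factor by one, so its support and that of the product must
      -- vary with it.
      go : ∀ n {P T : Pred ℕ Level.zero} {a : Series} → Decidable P → Supp k P a →
           (∀ i j → P i → Q j → T (i ℕ.+ j)) → ¬ T n → + k ∣ (a ⊛ b) n
      go zero {P} {T} P? p h ¬Tn = ∣m∣n⇒∣m+n (term {P} 0 0 P? p (λ (x , y) → ¬Tn (h 0 0 x y))) (divides 0ℤ refl)
      go (suc n) {P} {T} P? p h ¬Tn = ∣m∣n⇒∣m+n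
        (term {P} 0 (suc n) P? p (λ (x , y) → ¬Tn (h 0 (suc n) x y)))
        (go n {P ∘ suc} {T ∘ suc} (P? ∘ suc) (λ i → p (suc i)) (λ i → h (suc i)) ¬Tn)

  -- A coefficient of such a series counts list elements with a given exponent, which makes
  -- coefficients of products of theta series into numbers of representations.
  monomials : ∀ {A : Set} → (A → ℕ) → List A → Series
  monomials e []       = 0S
  monomials e (x ∷ xs) = (q^ (e x)) ⊞ monomials e xs

  filter-length-∷ : ∀ {A : Set} {P : Pred A Level.zero} (P? : Decidable P) x xs →
    length (filter P? (x ∷ xs)) ≡ (if does (P? x) then 1 else 0) ℕ.+ length (filter P? xs)
  filter-length-∷ P? x xs with does (P? x)
  ... | true  = refl
  ... | false = refl

  q^-does : ∀ m n → (q^ m) n ≡ + (if does (n ≟ m) then 1 else 0)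
  q^-does m n = sym (if-float +_ (n ℕ.≡ᵇ m) {1} {0})

  monomials-coeff : ∀ {A : Set} (e : A → ℕ) xs n → monomials e xs n ≡ + length (filter (λ x → n ≟ e x) xs)
  monomials-coeff e []       n = refl
  monomials-coeff e (x ∷ xs) n = trans
    (cong₂ _+_ (q^-does (e x) n) (monomials-coeff e xs n))
    (trans (sym (ℤ.pos-+ (if does (n ≟ e x) then 1 else 0) (length (filter (λ x → n ≟ e x) xs))))
      (cong +_ (sym (filter-length-∷ (λ x → n ≟ e x) x xs))))

  monomials-++ : ∀ {A : Set} (e : A → ℕ) xs ys → monomials e (xs ++ ys) ≗ monomials e xs ⊞ monomials e ys
  monomials-++ e []       ys n = sym (ℤ.+-identityˡ (monomials e ys n))
  monomials-++ e (x ∷ xs) ys n = trans (cong (λ t → (q^ (e x)) n + t) (monomials-++ e xs ys n)) (sym (ℤ.+-assoc ((q^ (e x)) n) (monomials e xs n) (monomials e ys n)))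

  monomials-⊛ : ∀ {A B : Set} (e : A → ℕ) (f : B → ℕ) xs ys →
    monomials e xs ⊛ monomials f ys ≗ monomials (λ (x , y) → e x ℕ.+ f y) (cartesianProduct xs ys)
  monomials-⊛ e f []       ys n = ⊛-zeroˡ (monomials f ys) n
  monomials-⊛ e f (x ∷ xs) ys n = begin
    (((q^ (e x)) ⊞ monomials e xs) ⊛ monomials f ys) n
      ≡⟨ ⊛-distribʳ (q^ (e x)) (monomials e xs) (monomials f ys) n ⟩
    ((q^ (e x)) ⊛ monomials f ys) n + (monomials e xs ⊛ monomials f ys) n
      ≡⟨ cong₂ _+_ (row ys n) (monomials-⊛ e f xs ys n) ⟩
    monomials ef (map (x ,_) ys) n + monomials ef (cartesianProduct xs ys) n
      ≡⟨ monomials-++ ef (map (x ,_) ys) (cartesianProduct xs ys) n ⟨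
    monomials ef (map (x ,_) ys ++ cartesianProduct xs ys) n ∎
    where
    open ≡-Reasoning
    ef = λ (x , y) → e x ℕ.+ f y
    row : ∀ ys → (q^ (e x)) ⊛ monomials f ys ≗ monomials ef (map (x ,_) ys)
    row []       n = trans (⊛-comm (q^ (e x)) 0S n) (⊛-zeroˡ (q^ (e x)) n)
    row (y ∷ ys) n = trans (⊛-distribˡ (q^ (e x)) (q^ (f y)) (monomials f ys) n)
      (cong₂ _+_ (q^-⊛ (e x) (f y) n) (row ys n))

-- The generating function of the coloured overpartitions.

module OverpartitionSeries where

  open PowerSeries
  open import Algebra.Bundles using (CommutativeRing)
  open import Data.Bool.Base using (Bool; true; false; if_then_else_; _∧_)
  open import Data.Fin.Base as Fin using (Fin)
  open import Data.Integer.Base using (ℤ; +_; 0ℤ; _+_)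
  open import Data.Integer.Divisibility.Signed using (_∣_)
  import Data.Integer.Properties as ℤ
  open import Data.List.Base using (List; []; _∷_; _++_; _∷ʳ_; map; filter; length; cartesianProductWith; concatMap; upTo; allFin)
  open import Data.List.Properties using (filter-++; filter-≐; concatMap-++; ++-identityʳ; upTo-∷ʳ; length-tabulate)
  open import Data.List.Relation.Unary.All as All using (All; []; _∷_)
  import Data.List.Relation.Unary.All.Properties as All
  open import Data.List.Relation.Unary.AllPairs using (AllPairs; []; _∷_)
  import Data.List.Relation.Unary.AllPairs.Properties as AllPairs
  open import Data.List.Relation.Unary.Linked using (Linked; linked?)
  open import Data.Nat.Base as ℕ using (ℕ; zero; suc; _≤_; _<_; z≤n; s≤s)
  open import Data.Nat.ListAction using (sum)
  open import Data.Nat.Properties as ℕ using (_≟_; _≤?_)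
  open import Data.Product.Base using (_,_; _×_)
  open import Data.Sum.Base using (_⊎_; inj₁; inj₂)
  open import Function.Base using (_∘_; id)
  open import Level using () renaming (zero to 0ℓ)
  open import Relation.Binary.PropositionalEquality hiding ([_])
  open import Relation.Nullary.Decidable using (does; dec-true; dec-false)
  open import Relation.Nullary.Negation using (¬_; contradiction)
  open import Relation.Unary using (Pred; Decidable)

  module Overpartitions (modulus s N : ℕ) where

    R : CommutativeRing _ _
    R = truncated modulus (suc N)

    private module R = CommutativeRing R
    open RingIdentities R using (∑<; ∏<; _^_; ∑<-cong; ∏<-cong)
    open RingIdentities R using (∑∈; ∏∈; ∑∈-cong; ∑<-suc; ∑<-∑∈-swap; ∏∈-concatMap-upTo; module Transfer)

    weight : List (Part s) → ℕ
    weight w = sum (map size w)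

    after? : ∀ (x : Part s) → Decidable (λ w → Linked _⊒_ (x ∷ w))
    after? x w = linked? _⊒?_ (x ∷ w)

    monomials-filter-∷ : ∀ {A : Set} (e : A → ℕ) {P : Pred A 0ℓ} (P? : Decidable P) w ws n →
      monomials e (filter P? (w ∷ ws)) n ≡ (if does (P? w) then (q^ (e w)) n else 0ℤ) + monomials e (filter P? ws) n
    monomials-filter-∷ e P? w ws n with does (P? w)
    ... | true  = refl
    ... | false = sym (ℤ.+-identityˡ (monomials e (filter P? ws) n))

    words-row : {P : Pred (List (Part s)) 0ℓ} (P? : Decidable P) (b : Bool) (y : Part s) →
      (∀ w → does (P? (y ∷ w)) ≡ b ∧ does (after? y w)) → ∀ ws n →
      monomials weight (filter P? (map (y ∷_) ws)) n
        ≡ (if b then (q^ (size y)) ⊛ monomials weight (filter (after? y) ws) else 0S) n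
    words-row P? false y P≡ []       n = refl
    words-row P? true  y P≡ []       n = sym (trans (⊛-comm (q^ (size y)) 0S n) (⊛-zeroˡ (q^ (size y)) n))
    words-row P? b     y P≡ (w ∷ ws) n = begin
      monomials weight (filter P? (map (y ∷_) (w ∷ ws))) n
        ≡⟨ monomials-filter-∷ weight P? (y ∷ w) (map (y ∷_) ws) n ⟩
      (if does (P? (y ∷ w)) then (q^ (size y ℕ.+ weight w)) n else 0ℤ) + monomials weight (filter P? (map (y ∷_) ws)) n
        ≡⟨ cong₂ (λ t z → (if t then (q^ (size y ℕ.+ weight w)) n else 0ℤ) + z) (P≡ w) (words-row P? b y P≡ ws n) ⟩
      (if b ∧ does (after? y w) then (q^ (size y ℕ.+ weight w)) n else 0ℤ) + (if b then (q^ (size y)) ⊛ M else 0S) n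
        ≡⟨ merge b (does (after? y w)) ⟩
      (if b then (q^ (size y)) ⊛ ((λ i → if does (after? y w) then (q^ (weight w)) i else 0ℤ) ⊞ M) else 0S) n
        ≡⟨ rejoin b ⟩
      (if b then (q^ (size y)) ⊛ monomials weight (filter (after? y) (w ∷ ws)) else 0S) n ∎
      where
      open ≡-Reasoning
      M : Series
      M = monomials weight (filter (after? y) ws)
      merge : ∀ b t → (if b ∧ t then (q^ (size y ℕ.+ weight w)) n else 0ℤ) + (if b then (q^ (size y)) ⊛ M else 0S) n
                      ≡ (if b then (q^ (size y)) ⊛ ((λ i → if t then (q^ (weight w)) i else 0ℤ) ⊞ M) else 0S) n
      merge false t     = refl
      merge true  true  = trans (cong (_+ ((q^ (size y)) ⊛ M) n) (sym (q^-⊛ (size y) (weight w) n))) (sym (⊛-distribˡ (q^ (size y)) (q^ (weight w)) M n))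
      merge true  false = trans (ℤ.+-identityˡ _) (⊛-cong {q^ (size y)} {q^ (size y)} {M} {0S ⊞ M} (λ _ → refl) (λ i → sym (ℤ.+-identityˡ (M i))) n)
      rejoin : ∀ b → (if b then (q^ (size y)) ⊛ ((λ i → if does (after? y w) then (q^ (weight w)) i else 0ℤ) ⊞ M) else 0S) n
                     ≡ (if b then (q^ (size y)) ⊛ monomials weight (filter (after? y) (w ∷ ws)) else 0S) n
      rejoin false = refl
      rejoin true  = ⊛-cong {q^ (size y)} {q^ (size y)}
        {(λ i → if does (after? y w) then (q^ (weight w)) i else 0ℤ) ⊞ M} {monomials weight (filter (after? y) (w ∷ ws))}
        (λ _ → refl) (λ i → sym (monomials-filter-∷ weight (after? y) w ws i)) n

    -- The test of a nonempty word has to factor into a test of its first letter and linkedness from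
    -- there on. Linkedness itself and linkedness after a given part both do so by computation.
    words-step : {P : Pred (List (Part s)) 0ℓ} (P? : Decidable P) (b : Part s → Bool) →
      (∀ y w → does (P? (y ∷ w)) ≡ b y ∧ does (after? y w)) → ∀ ys ws n →
      monomials weight (filter P? (cartesianProductWith _∷_ ys ws)) n
        ≡ ∑∈ ys (λ y → if b y then (q^ (size y)) ⊛ monomials weight (filter (after? y) ws) else 0S) n
    words-step P? b P≡ []       ws n = refl
    words-step P? b P≡ (y ∷ ys) ws n = begin
      monomials weight (filter P? (map (y ∷_) ws ++ cartesianProductWith _∷_ ys ws)) n
        ≡⟨ cong (λ l → monomials weight l n) (filter-++ P? (map (y ∷_) ws) _) ⟩
      monomials weight (filter P? (map (y ∷_) ws) ++ filter P? (cartesianProductWith _∷_ ys ws)) n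
        ≡⟨ monomials-++ weight (filter P? (map (y ∷_) ws)) _ n ⟩
      monomials weight (filter P? (map (y ∷_) ws)) n + monomials weight (filter P? (cartesianProductWith _∷_ ys ws)) n
        ≡⟨ cong₂ _+_ (words-row P? (b y) y (P≡ y) ws n) (words-step P? b P≡ ys ws n) ⟩
      ∑∈ (y ∷ ys) (λ y → if b y then (q^ (size y)) ⊛ monomials weight (filter (after? y) ws) else 0S) n ∎
      where open ≡-Reasoning

    xs : List (Part s)
    xs = parts s N

    u : Part s → Series
    u y = q^ (size y)

    W : ℕ → Part s → Series
    W k x = monomials weight (filter (after? x) (words xs k))

    V : ℕ → Series
    V k = monomials weight (filter (linked? _⊒?_) (words xs k))

    U : Part s → Series
    U x = ∑< (λ k → W k x) (suc N)

    W-suc : ∀ k x → W (suc k) x R.≈ ∑∈ xs (λ y → if does (x ⊒? y) then u y ⊛ W k y else 0S)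
    W-suc k x = ≗⇒≈ (words-step (after? x) (λ y → does (x ⊒? y)) (λ y w → refl) xs (words xs k))

    V-suc : ∀ k → V (suc k) R.≈ ∑∈ xs (λ y → if true then u y ⊛ W k y else 0S)
    V-suc k = ≗⇒≈ (words-step (linked? _⊒?_) (λ y → true) (λ y w → refl) xs (words xs k))

    sizes-positive : All (λ y → 1 ≤ size y) xs
    sizes-positive = All.concat⁺ (All.map⁺ (All.universal (λ i → block i (allFin (colours s (suc i)))) (upTo N)))
      where
      block : ∀ i cs → All (λ y → 1 ≤ size y) (cartesianProductWith (part (suc i)) cs (false ∷ true ∷ []))
      block i []       = []
      block i (c ∷ cs) = s≤s z≤n ∷ s≤s z≤n ∷ block i cs

    -- Every letter weighs at least 1, so k letters weigh at least k. This justifies stopping at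
    -- length N.
    W-order : ∀ k x → Supp modulus (k ≤_) (W k x)
    W-order zero    x n ¬p = contradiction z≤n ¬p
    W-order (suc k) x n ¬p = subst (+ modulus ∣_) (sym (words-step (after? x) (λ y → does (x ⊒? y)) (λ y w → refl) xs (words xs k) n))
      (sum-order xs sizes-positive n ¬p)
      where
      sum-order : ∀ ys → All (λ y → 1 ≤ size y) ys → Supp modulus (suc k ≤_) (∑∈ ys (λ y → if does (x ⊒? y) then u y ⊛ W k y else 0S))
      sum-order []       []       = Supp-0 {P = suc k ≤_}
      sum-order (y ∷ ys) (p ∷ ps) = Supp-⊞ {P = suc k ≤_} (term (does (x ⊒? y))) (sum-order ys ps)
        where
        term : ∀ b → Supp modulus (suc k ≤_) (if b then u y ⊛ W k y else 0S)
        term true  = Supp-⊛ {P = 1 ≤_} {Q = k ≤_} {T = suc k ≤_} {u y} {W k y} (1 ≤?_) (k ≤?_) (λ i j → ℕ.+-mono-≤) (Supp-q^ {P = 1 ≤_} p) (W-order k y)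
        term false = Supp-0 {P = suc k ≤_}

    uW≈0 : ∀ y → 1 ≤ size y → u y ⊛ W N y R.≈ 0S
    uW≈0 y p = agree λ n n<L → ∣⇒mod-0 (Supp-⊛ {P = 1 ≤_} {Q = N ≤_} {T = suc N ≤_} {u y} {W N y} (1 ≤?_) (N ≤?_) (λ i j → ℕ.+-mono-≤)
      (Supp-q^ {P = 1 ≤_} p) (W-order N y) n (ℕ.<⇒≱ n<L))

    -- Prefixing a letter costs one length, so only lengths below N appear on the left. Restoring
    -- length N adds words of N + 1 letters, which are too heavy to be seen modulo q^(N+1).
    collect : ∀ (b : Part s → Bool) →
      ∑< (λ k → ∑∈ xs (λ y → if b y then u y ⊛ W k y else 0S)) N R.≈ ∑∈ xs (λ y → if b y then u y ⊛ U y else 0S)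
    collect b = R.trans (∑<-∑∈-swap b u W xs N) (∑∈-cong xs (All.map (λ {y} p → extend y p (b y)) sizes-positive))
      where
      extend : ∀ y → 1 ≤ size y → ∀ t → (if t then u y ⊛ ∑< (λ k → W k y) N else 0S) R.≈ (if t then u y ⊛ U y else 0S)
      extend y p false = R.refl
      extend y p true  = R.sym (R.trans (R.distribˡ (u y) (∑< (λ k → W k y) N) (W N y))
        (R.trans (R.+-congˡ {x = u y ⊛ ∑< (λ k → W k y) N} (uW≈0 y p)) (R.+-identityʳ (u y ⊛ ∑< (λ k → W k y) N))))

    ∑<-expand : ∀ (g : ℕ → Series) (b : Part s → Bool) → g 0 ≗ (q^ 0) ⊞ 0S →
      (∀ k → g (suc k) R.≈ ∑∈ xs (λ y → if b y then u y ⊛ W k y else 0S)) →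
      ∑< g (suc N) R.≈ (q^ 0) ⊞ ∑∈ xs (λ y → if b y then u y ⊛ U y else 0S)
    ∑<-expand g b g0 gs = R.trans (∑<-suc g N)
      (R.+-cong {g 0} {q^ 0} {∑< (g ∘ suc) N} {∑∈ xs (λ y → if b y then u y ⊛ U y else 0S)}
        (R.trans (≗⇒≈ g0) (R.+-identityʳ (q^ 0)))
        (R.trans (∑<-cong gs N) (collect b)))

    U-equation : ∀ x → U x R.≈ (q^ 0) ⊞ ∑∈ xs (λ y → if does (x ⊒? y) then u y ⊛ U y else 0S)
    U-equation x = ∑<-expand (λ k → W k x) (λ y → does (x ⊒? y)) (λ _ → refl) (λ k → W-suc k x)

    total : Series
    total = ∑< V (suc N)

    total≈ : total R.≈ (q^ 0) ⊞ ∑∈ xs (λ y → u y ⊛ U y)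
    total≈ = ∑<-expand V (λ _ → true) (λ _ → refl) V-suc

    -- `ā` tests linkedness and weight at once; here linkedness is filtered first, and taking the
    -- coefficient of q^N then selects the weight.
    total-coeff : total N ≡ + ā s N
    total-coeff = begin
      total N
        ≡⟨ flatten (suc N) N ⟨
      monomials weight (filter (linked? _⊒?_) candidates) N
        ≡⟨ monomials-coeff weight (filter (linked? _⊒?_) candidates) N ⟩
      + length (filter (λ w → N ≟ weight w) (filter (linked? _⊒?_) candidates))
        ≡⟨ cong (λ l → + length l) (filter-≐ (λ w → N ≟ weight w) (λ w → weight w ≟ N) (sym , sym) (filter (linked? _⊒?_) candidates)) ⟩
      + length (filter (λ w → weight w ≟ N) (filter (linked? _⊒?_) candidates))
        ≡⟨ cong +_ (filter-filter candidates) ⟩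
      + ā s N ∎
      where
      open ≡-Reasoning
      candidates : List (List (Part s))
      candidates = concatMap (words xs) (upTo (suc N))
      filter-filter : ∀ ws → length (filter (λ w → weight w ≟ N) (filter (linked? _⊒?_) ws)) ≡ length (filter (isOverpartition? N) ws)
      filter-filter []       = refl
      filter-filter (w ∷ ws) with does (linked? _⊒?_ w)
      ... | false = filter-filter ws
      ... | true with does (weight w ≟ N)
      ...   | false = filter-filter ws
      ...   | true  = cong suc (filter-filter ws)
      flatten : ∀ m n → monomials weight (filter (linked? _⊒?_) (concatMap (words xs) (upTo m))) n ≡ ∑< V m n
      flatten zero    n = refl
      flatten (suc m) n = begin
        monomials weight (filter (linked? _⊒?_) (concatMap (words xs) (upTo (suc m)))) n
          ≡⟨ cong (λ is → monomials weight (filter (linked? _⊒?_) (concatMap (words xs) is)) n) (upTo-∷ʳ m) ⟨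
        monomials weight (filter (linked? _⊒?_) (concatMap (words xs) (upTo m ∷ʳ m))) n
          ≡⟨ cong (λ l → monomials weight (filter (linked? _⊒?_) l) n) (trans (concatMap-++ (words xs) (upTo m) (m ∷ []))
               (cong (concatMap (words xs) (upTo m) ++_) (++-identityʳ (words xs m)))) ⟩
        monomials weight (filter (linked? _⊒?_) (concatMap (words xs) (upTo m) ++ words xs m)) n
          ≡⟨ cong (λ l → monomials weight l n) (filter-++ (linked? _⊒?_) (concatMap (words xs) (upTo m)) (words xs m)) ⟩
        monomials weight (filter (linked? _⊒?_) (concatMap (words xs) (upTo m)) ++ filter (linked? _⊒?_) (words xs m)) n
          ≡⟨ monomials-++ weight (filter (linked? _⊒?_) (concatMap (words xs) (upTo m))) (filter (linked? _⊒?_) (words xs m)) n ⟩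
        monomials weight (filter (linked? _⊒?_) (concatMap (words xs) (upTo m))) n + V m n
          ≡⟨ cong (_+ V m n) (flatten m n) ⟩
        ∑< V m n + V m n ∎

    kindsOfSize : ℕ → List (Part s)
    kindsOfSize i = map (λ c → part (suc i) c false) (allFin (colours s (suc i)))

    -- A kind is represented by its part without overline. The list ascends whereas overpartitions
    -- are written in descending order, so the kinds preceding κ are the smaller ones that may
    -- follow it in a word.
    kinds : List (Part s)
    kinds = concatMap kindsOfSize (upTo N)

    bar : Part s → Part s
    bar κ = part (size κ) (colour κ) true

    _≺_ : Part s → Part s → Set
    κ ≺ κ′ = size κ < size κ′ ⊎ (size κ ≡ size κ′ × Fin.toℕ (colour κ) < Fin.toℕ (colour κ′))

    ≺⇒⊒ : ∀ {κ κ′ b} → κ ≺ κ′ → κ′ ⊒ part (size κ) (colour κ) b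
    ≺⇒⊒ (inj₁ lt)       = inj₁ lt
    ≺⇒⊒ (inj₂ (eq , lt)) = inj₂ (inj₁ (eq , lt))

    ≺⇒⋣ : ∀ {κ κ′ b} → κ ≺ κ′ → ¬ (κ ⊒ part (size κ′) (colour κ′) b)
    ≺⇒⋣ (inj₁ lt)       (inj₁ gt)                    = ℕ.<-asym lt gt
    ≺⇒⋣ (inj₁ lt)       (inj₂ (inj₁ (eq , _)))       = ℕ.<-irrefl (sym eq) lt
    ≺⇒⋣ (inj₁ lt)       (inj₂ (inj₂ (eq , _)))       = ℕ.<-irrefl (sym eq) lt
    ≺⇒⋣ (inj₂ (eq , _)) (inj₁ gt)                    = ℕ.<-irrefl (sym eq) gt
    ≺⇒⋣ (inj₂ (_ , lt)) (inj₂ (inj₁ (_ , gt)))       = ℕ.<-asym lt gt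
    ≺⇒⋣ (inj₂ (_ , lt)) (inj₂ (inj₂ (_ , eq , _)))   = ℕ.<-irrefl (sym eq) lt

    kinds-increasing : AllPairs _≺_ kinds
    kinds-increasing = AllPairs.concat⁺
      (All.map⁺ (All.universal (λ i → AllPairs.map⁺ (AllPairs.tabulate⁺-< (λ i<j → inj₂ (refl , i<j)))) (upTo N)))
      (AllPairs.map⁺ (AllPairs.applyUpTo⁺₁ id N (λ i<j _ → All.map⁺ (All.universal (λ c → All.map⁺ (All.universal (λ c′ → inj₁ (s≤s i<j)) _)) _))))

    ⋣-bar : ∀ κ → ¬ (κ ⊒ bar κ)
    ⋣-bar κ (inj₁ lt)              = ℕ.<-irrefl refl lt
    ⋣-bar κ (inj₂ (inj₁ (_ , lt))) = ℕ.<-irrefl refl lt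
    ⋣-bar κ (inj₂ (inj₂ (_ , _ , ())))

    module T = Transfer kinds bar (λ x y → does (x ⊒? y)) u U _≺_ kinds-increasing
      (λ {κ} {κ′} p → dec-true (κ′ ⊒? κ) (≺⇒⊒ {κ} {κ′} {overlined κ} p)) (λ {κ} {κ′} p → dec-true (κ′ ⊒? bar κ) (≺⇒⊒ {κ} {κ′} {true} p))
      (λ {κ} {κ′} p → dec-false (κ ⊒? κ′) (≺⇒⋣ {κ} {κ′} {overlined κ′} p)) (λ {κ} {κ′} p → dec-false (κ ⊒? bar κ′) (≺⇒⋣ {κ} {κ′} {true} p))
      -- Only parts without overline may repeat directly, so this property is claimed for the listed
      -- kinds and not for all parts.
      (All.concat⁺ (All.map⁺ (All.universal (λ i → All.map⁺ (All.universal (λ c →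
        dec-true (part (suc i) c false ⊒? part (suc i) c false) (inj₂ (inj₂ (refl , refl , refl)))) _)) (upTo N))))
      (λ κ → dec-false (κ ⊒? bar κ) (⋣-bar κ))
      (λ κ → R.refl {u κ}) (λ κ → R.trans (U-equation (bar κ)) (R.sym (U-equation κ)))

    letters≡ : T.letters kinds ≡ xs
    letters≡ = go (upTo N)
      where
      block : ∀ i cs → T.letters (map (λ c → part (suc i) c false) cs) ≡ cartesianProductWith (part (suc i)) cs (false ∷ true ∷ [])
      block i []       = refl
      block i (c ∷ cs) = cong (λ l → part (suc i) c false ∷ part (suc i) c true ∷ l) (block i cs)
      go : ∀ is → T.letters (concatMap kindsOfSize is) ≡ concatMap (λ i → cartesianProductWith (part (suc i)) (allFin (colours s (suc i))) (false ∷ true ∷ [])) is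
      go []       = refl
      go (i ∷ is) = trans (concatMap-++ _ (kindsOfSize i) (concatMap kindsOfSize is))
        (cong₂ _++_ (block i (allFin (colours s (suc i)))) (go is))

    kinds-product : ∀ (g : ℕ → Series) → ∏∈ kinds (g ∘ size) R.≈ ∏< (λ i → g (suc i) ^ colours s (suc i)) N
    kinds-product g = R.trans (∏∈-concatMap-upTo kindsOfSize (g ∘ size) N)
      (∏<-cong (λ i → R.reflexive (trans (power i (allFin (colours s (suc i)))) (cong (g (suc i) ^_) (length-tabulate {n = colours s (suc i)} id)))) N)
      where
      power : ∀ i (cs : List (Fin (colours s (suc i)))) → ∏∈ (map (λ c → part (suc i) c false) cs) (g ∘ size) ≡ g (suc i) ^ length cs
      power i []       = refl
      power i (c ∷ cs) = cong (g (suc i) ⊛_) (power i cs)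

    -- With denominators cleared and sizes cut at N, this is the product of ((1 + qʲ)/(1 - qʲ)) over
    -- all coloured sizes, the quotient of f₁, f₂ and f₄ in the definition.
    generating-function :
      (total ⊛ ∏< (λ i → ((q^ 0) ⊞ (⊟ (q^ (suc i)))) ^ colours s (suc i)) N)
        R.≈ ∏< (λ i → ((q^ 0) ⊞ (q^ (suc i))) ^ colours s (suc i)) N
    generating-function = R.trans
      (R.*-cong {total} {T.G kinds} {_} {∏∈ kinds (λ κ → (q^ 0) ⊞ (⊟ u κ))}
        (R.trans total≈ (R.reflexive (cong (λ l → (q^ 0) ⊞ ∑∈ l (λ y → u y ⊛ U y)) (sym letters≡))))
        (R.sym (kinds-product (λ j → (q^ 0) ⊞ (⊟ (q^ j))))))
      (R.trans (T.G-product (λ x → R.trans (U-equation x)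
          (R.reflexive (cong (λ l → (q^ 0) ⊞ ∑∈ l (λ y → if does (x ⊒? y) then u y ⊛ U y else 0S)) (sym letters≡)))))
        (kinds-product (λ j → (q^ 0) ⊞ (q^ j))))

-- Coefficients at exponents congruent to 5 modulo 8.

module Congruences where

  open OverpartitionSeries using (module Overpartitions)
  open PowerSeries
  open SumsOfSquares
  open Enumeration using (card)

  import Algebra.Properties.Ring
  import Algebra.Properties.Semiring.Mult
  open import Algebra.Bundles using (CommutativeRing)
  open import Data.Bool.Base using (Bool; true; false; if_then_else_)
  open import Data.Fin.Base using (toℕ)
  open import Data.Fin.Properties using (any?)
  open import Data.Integer.Base using (ℤ; +_; 0ℤ; 1ℤ; -1ℤ; _+_; _*_; -_; _-_; _%ℕ_; _/ℕ_)
  open import Data.Integer.DivMod using (n%ℕd<d; a≡a%ℕn+[a/ℕn]*n)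
  open import Data.Integer.Divisibility.Signed
    using (_∣_; divides; ∣m∣n⇒∣m+n; ∣m⇒∣-m; ∣n⇒∣m*n; ∣m+n∣n⇒∣m; ∣⇒∣ᵤ; ∣ᵤ⇒∣)
    renaming (_∣?_ to _ℤ∣?_)
  import Data.Integer.Properties as ℤ
  open import Data.Integer.Tactic.RingSolver using () renaming (solve-∀ to ℤ-solve-∀)
  open import Data.List.Base using (cartesianProduct; downFrom)
  open import Data.List.Membership.Propositional.Properties using (∈-cartesianProduct⁺; ∈-downFrom⁺)
  import Data.List.Relation.Unary.Unique.Propositional.Properties as Unique
  open import Data.Nat.Base as ℕ using (ℕ; zero; suc; _≤_; _<_; _≥_; z≤n; s≤s; _∸_; NonZero)
  import Data.Nat.Divisibility as ℕ∣
  open import Data.Nat.DivMod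
    using (_%_; _/_; m≡m%n+[m/n]*n; %-distribˡ-+; %-distribˡ-*; [m+kn]%n≡m%n; m%n<n; m*n%n≡0; m*n/n≡m; m∣n⇒o%n%m≡o%m)
  open import Data.Nat.Primality using (Prime; prime⇒irreducible; ¬prime[1]; euclidsLemma)
  open import Data.Nat.Properties as ℕ using (_≟_)
  open import Data.Nat.Tactic.RingSolver using (solve-∀)
  open import Data.Product.Base using (_,_; _×_; proj₁; proj₂)
  open import Data.Sum.Base using (_⊎_; inj₁; inj₂)
  open import Relation.Binary.PropositionalEquality hiding ([_])
  open import Relation.Nullary.Decidable using (Dec; yes; no; does; dec-true; dec-false; _⊎-dec_)
  open import Relation.Nullary.Negation using (¬_; contradiction)
  open import Relation.Unary using (Decidable)

  ∑S : (ℕ → Series) → ℕ → Series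
  ∑S g zero    = 0S
  ∑S g (suc n) = ∑S g n ⊞ g n

  -- The sign (-1)ⁿ as iterated negation, which passes through supports directly.
  alternating : ℕ → Series → Series
  alternating zero    a = a
  alternating (suc n) a = ⊟ alternating n a

  Supp-∑S : ∀ k {P : ℕ → Set} {g} → (∀ i → Supp k P (g i)) → ∀ n → Supp k P (∑S g n)
  Supp-∑S k {P} p zero    = Supp-0 {P = P}
  Supp-∑S k {P} {g} p (suc n) = Supp-⊞ {P = P} {a = ∑S g n} {b = g n} (Supp-∑S k p n) (p n)

  Supp-alternating : ∀ k {P : ℕ → Set} n {a} → Supp k P a → Supp k P (alternating n a)
  Supp-alternating k         zero    p = p
  Supp-alternating k {P} (suc n) {a} p = Supp-⊟ {P = P} {a = alternating n a} (Supp-alternating k n p)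

  ∑S-monomials : ∀ (e : ℕ → ℕ) n → ∑S (λ i → q^ (e i)) n ≗ monomials e (downFrom n)
  ∑S-monomials e zero    i = refl
  ∑S-monomials e (suc n) i = trans (cong (_+ (q^ (e n)) i) (∑S-monomials e n i)) (ℤ.+-comm (monomials e (downFrom n) i) ((q^ (e n)) i))

  module Truncated (k L : ℕ) where

    R : CommutativeRing _ _
    R = truncated k L

    private module R = CommutativeRing R
    open RingIdentities R

    infix 4 _≈_
    _≈_ : Series → Series → Set
    _≈_ = R._≈_

    q : Series
    q = q^ 1

    q-^ : ∀ m → q ^ m ≈ q^ m
    q-^ m = R.trans (q^-^ k L 1 m) (R.reflexive (cong q^_ (ℕ.*-identityʳ m)))

    qq-^ : ∀ m → (q ⊛ q) ^ m ≈ q^ (m ℕ.* 2)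
    qq-^ m = R.trans (^-congˡ m (≗⇒≈ (q^-⊛ 1 1))) (q^-^ k L 2 m)

    ∑<≈∑S : ∀ {g h} → (∀ i → g i ≈ h i) → ∀ n → ∑< g n ≈ ∑S h n
    ∑<≈∑S         e zero    = R.refl
    ∑<≈∑S {g} {h} e (suc n) = R.+-cong {∑< g n} {∑S h n} {g n} {h n} (∑<≈∑S e n) (e n)

    ∑S-cong : ∀ {g h} → (∀ i → g i ≈ h i) → ∀ n → ∑S g n ≈ ∑S h n
    ∑S-cong {g} {h} e n = R.trans (R.sym (∑<≈∑S {g} {g} (λ i → R.refl {g i}) n)) (∑<≈∑S e n)

    sgn≈alternating : ∀ n a → ((R.- R.1#) ^ n) ⊛ a ≈ alternating n a
    sgn≈alternating zero    a = R.*-identityˡ a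
    sgn≈alternating (suc n) a = R.trans (R.*-assoc (R.- R.1#) ((R.- R.1#) ^ n) a)
      (R.trans (R.*-congˡ {R.- R.1#} (sgn≈alternating n a)) (-1*x≈-x (alternating n a)))
      where open Algebra.Properties.Ring R.ring using (-1*x≈-x)

    φ-tail≈ : ∀ m z {e : ℕ → ℕ} → (∀ i → z ^ (suc i ℕ.* suc i) ≈ q^ (e i)) →
      Gauss.φ-tail z m ≈ ∑S (λ i → alternating (suc i) (q^ (e i))) m
    φ-tail≈ m z {e} p = ∑<≈∑S {λ i → ((R.- R.1#) ^ suc i) ⊛ (z ^ (suc i ℕ.* suc i))} {λ i → alternating (suc i) (q^ (e i))} (λ i → R.trans (R.*-congˡ {(R.- R.1#) ^ suc i} (p i)) (sgn≈alternating (suc i) (q^ (e i)))) m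

    alternating≈ : two ≈ 0S → ∀ n a → alternating n a ≈ a
    alternating≈ two≈0 zero    a = R.refl {a}
    alternating≈ two≈0 (suc n) a = R.trans (-x≈x two≈0 (alternating n a)) (alternating≈ two≈0 n a)

    ∑S-alternating≈ : two ≈ 0S → ∀ (g : ℕ → Series) n → ∑S (λ i → alternating (suc i) (g i)) n ≈ ∑S g n
    ∑S-alternating≈ two≈0 g n = ∑S-cong {λ i → alternating (suc i) (g i)} {g} (λ i → alternating≈ two≈0 (suc i) (g i)) n

    ∑S-square : two ≈ 0S → ∀ (e : ℕ → ℕ) n → ∑S (λ i → q^ (e i)) n ⊛ ∑S (λ i → q^ (e i)) n ≈ ∑S (λ i → q^ (e i ℕ.* 2)) n
    ∑S-square two≈0 e n = R.trans (R.sym (R.*-cong {x} {x′} {x} {x′} same same)) (R.trans (frobenius-∑< two≈0 (λ i → q^ (e i)) n)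
      (∑<≈∑S {λ i → (q^ (e i)) ⊛ (q^ (e i))} {λ i → q^ (e i ℕ.* 2)}
        (λ i → R.trans (≗⇒≈ (q^-⊛ (e i) (e i))) (R.reflexive (cong q^_ (double (e i))))) n))
      where
      x x′ : Series
      x  = ∑< (λ i → q^ (e i)) n
      x′ = ∑S (λ i → q^ (e i)) n
      same : ∑< (λ i → q^ (e i)) n ≈ ∑S (λ i → q^ (e i)) n
      same = ∑<≈∑S {λ i → q^ (e i)} {λ i → q^ (e i)} (λ i → R.refl {q^ (e i)}) n
      double : ∀ m → m ℕ.+ m ≡ m ℕ.* 2
      double = solve-∀

    two⊛ : ∀ a n → (two ⊛ a) n ≡ a n + a n
    two⊛ a n = trans (⊛-distribʳ (q^ 0) (q^ 0) a n) (cong₂ _+_ (⊛-identityˡ a n) (⊛-identityˡ a n))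

    two⊛-∣ : ∀ {d a n} → + d ∣ a n → + (2 ℕ.* d) ∣ (two ⊛ a) n
    two⊛-∣ {d} {a} {n} (divides c e) = divides c (trans (two⊛ a n) (trans (cong₂ _+_ e e)
      (trans (sym (ℤ.*-distribˡ-+ c (+ d) (+ d))) (cong (λ t → c * + (d ℕ.+ t)) (sym (ℕ.+-identityʳ d))))))

    two^⊛-∣ : ∀ j {d a n} → + d ∣ a n → + (2 ℕ.^ j ℕ.* d) ∣ ((two ^ j) ⊛ a) n
    two^⊛-∣ zero    {d} {a} {n} p = subst₂ _∣_ (cong +_ (sym (ℕ.*-identityˡ d))) (sym (⊛-identityˡ a n)) p
    two^⊛-∣ (suc j) {d} {a} {n} p = subst₂ _∣_ (cong +_ (sym (ℕ.*-assoc 2 (2 ℕ.^ j) d))) (sym (⊛-assoc two (two ^ j) a n))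
      (two⊛-∣ {a = (two ^ j) ⊛ a} {n} (two^⊛-∣ j {d} {a} {n} p))

    open Algebra.Properties.Semiring.Mult R.semiring using () renaming (_×_ to _·_)

    multiple⊛-∣ : ∀ b {d a n} → + d ∣ a n → + d ∣ ((b · (q^ 0)) ⊛ a) n
    multiple⊛-∣ zero    {a = a} {n} p = subst (_ ∣_) (sym (⊛-zeroˡ a n)) (divides 0ℤ refl)
    multiple⊛-∣ (suc b) {a = a} {n} p = subst (_ ∣_) (sym (trans (⊛-distribʳ (q^ 0) (b · (q^ 0)) a n) (cong (_+ ((b · (q^ 0)) ⊛ a) n) (⊛-identityˡ a n))))
      (∣m∣n⇒∣m+n p (multiple⊛-∣ b {a = a} {n} p))

    two^≈0 : ∀ j → k ≡ 2 ℕ.^ j → two ^ j ≈ 0S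
    two^≈0 j refl = R.trans (R.sym (R.*-identityʳ (two ^ j))) (agree (λ n _ → ∣⇒mod-0
      (subst (λ d → + d ∣ ((two ^ j) ⊛ (q^ 0)) n) (ℕ.*-identityʳ (2 ℕ.^ j)) (two^⊛-∣ j {1} {q^ 0} {n} (divides ((q^ 0) n) (sym (ℤ.*-identityʳ ((q^ 0) n))))))))

  parity : ∀ {a b N} → a ≈ b [ 2 , suc N ] → + 2 ∣ b N → + 2 ∣ a N
  parity {N = N} e = ∣-resp-mod (coeff e N (ℕ.n<1+n N))

  Square Double Even Odd Not5 : ℕ → Set
  Square n   = n % 8 ≡ 0 ⊎ n % 8 ≡ 1 ⊎ n % 8 ≡ 4
  Double n   = n % 8 ≡ 0 ⊎ n % 8 ≡ 2
  Even n     = n % 2 ≡ 0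
  Odd n      = n % 2 ≡ 1
  Not5 n     = n % 8 ≢ 5

  square? : Decidable Square
  square? n = (n % 8 ≟ 0) ⊎-dec (n % 8 ≟ 1) ⊎-dec (n % 8 ≟ 4)

  double? : Decidable Double
  double? n = (n % 8 ≟ 0) ⊎-dec (n % 8 ≟ 2)

  even? : Decidable Even
  even? n = n % 2 ≟ 0

  odd? : Decidable Odd
  odd? n = n % 2 ≟ 1

  doubled-square : ∀ x → Double (x ℕ.* x ℕ.* 2)
  doubled-square x with square%8 x
  ... | inj₁ e        = inj₁ (trans (%-distribˡ-* (x ℕ.* x) 2 8) (cong (λ r → (r ℕ.* 2) % 8) e))
  ... | inj₂ (inj₁ e) = inj₂ (trans (%-distribˡ-* (x ℕ.* x) 2 8) (cong (λ r → (r ℕ.* 2) % 8) e))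
  ... | inj₂ (inj₂ e) = inj₁ (trans (%-distribˡ-* (x ℕ.* x) 2 8) (cong (λ r → (r ℕ.* 2) % 8) e))

  m*2-even : ∀ m → Even (m ℕ.* 2)
  m*2-even m = m*n%n≡0 m 2

  even+even : ∀ i j → Even i → Even j → Even (i ℕ.+ j)
  even+even i j e f = trans (%-distribˡ-+ i j 2) (cong₂ (λ r s → (r ℕ.+ s) % 2) e f)

  odd+odd : ∀ i j → Odd i → Odd j → Even (i ℕ.+ j)
  odd+odd i j e f = trans (%-distribˡ-+ i j 2) (cong₂ (λ r s → (r ℕ.+ s) % 2) e f)

  odd+even : ∀ i j → Odd i → Even j → Odd (i ℕ.+ j)
  odd+even i j e f = trans (%-distribˡ-+ i j 2) (cong₂ (λ r s → (r ℕ.+ s) % 2) e f)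

  odd*odd : ∀ i j → Odd i → Odd j → Odd (i ℕ.* j)
  odd*odd i j e f = trans (%-distribˡ-* i j 2) (cong₂ (λ r s → (r ℕ.* s) % 2) e f)

  square+double : ∀ i j → Square i → Double j → Not5 (i ℕ.+ j)
  square+double i j s d e = go (i % 8) (j % 8) s d (trans (sym (%-distribˡ-+ i j 8)) e)
    where
    go : ∀ r t → r ≡ 0 ⊎ r ≡ 1 ⊎ r ≡ 4 → t ≡ 0 ⊎ t ≡ 2 → (r ℕ.+ t) % 8 ≢ 5
    go _ _ (inj₁ refl)        (inj₁ refl) ()
    go _ _ (inj₁ refl)        (inj₂ refl) ()
    go _ _ (inj₂ (inj₁ refl)) (inj₁ refl) ()
    go _ _ (inj₂ (inj₁ refl)) (inj₂ refl) ()
    go _ _ (inj₂ (inj₂ refl)) (inj₁ refl) ()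
    go _ _ (inj₂ (inj₂ refl)) (inj₂ refl) ()

  ∑S-split : ∀ g m → ∑S g (suc (m ℕ.* 2)) ≗ ∑S (λ i → g (i ℕ.* 2)) (suc m) ⊞ ∑S (λ i → g (suc (i ℕ.* 2))) m
  ∑S-split g zero    n = sym (ℤ.+-identityʳ _)
  ∑S-split g (suc m) n = trans (cong (λ t → t + g (suc (m ℕ.* 2)) n + g (suc (suc (m ℕ.* 2))) n) (∑S-split g m n))
    (eq (∑S (λ i → g (i ℕ.* 2)) (suc m) n) (∑S (λ i → g (suc (i ℕ.* 2))) m n) (g (suc (m ℕ.* 2)) n) (g (suc m ℕ.* 2) n))
    where
    eq : ∀ a b c d → a + b + c + d ≡ a + d + (b + c)
    eq = ℤ-solve-∀

  -- Modulo 2 the signs disappear and squaring doubles exponents: there `x₊` is `x`, while `x²` and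
  -- `y²` are the squares of `x` and `y`. For the same reason `x²` is also `y` modulo 2.
  x y x₊ x² y² : ℕ → Series
  x  = ∑S (λ i → alternating (suc i) (q^ (suc i ℕ.* suc i)))
  y  = ∑S (λ i → alternating (suc i) (q^ (suc i ℕ.* suc i ℕ.* 2)))
  x₊ = ∑S (λ i → q^ (suc i ℕ.* suc i))
  x² = ∑S (λ i → q^ (suc i ℕ.* suc i ℕ.* 2))
  y² = ∑S (λ i → q^ (suc i ℕ.* suc i ℕ.* 2 ℕ.* 2))

  Supp-x : ∀ k n → Supp k Square (x n)
  Supp-x k n = Supp-∑S k {Square} (λ i → Supp-alternating k {Square} (suc i) (Supp-q^ {P = Square} (square%8 (suc i)))) n

  Supp-y : ∀ k n → Supp k Double (y n)
  Supp-y k n = Supp-∑S k {Double} (λ i → Supp-alternating k {Double} (suc i) (Supp-q^ {P = Double} (doubled-square (suc i)))) n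

  Supp-x² : ∀ k n → Supp k Double (x² n)
  Supp-x² k n = Supp-∑S k {Double} (λ i → Supp-q^ {P = Double} (doubled-square (suc i))) n

  even-x² : ∀ k n → Supp k Even (x² n)
  even-x² k n = Supp-∑S k {Even} (λ i → Supp-q^ {P = Even} (m*2-even (suc i ℕ.* suc i))) n

  even-y : ∀ k n → Supp k Even (y n)
  even-y k n = Supp-∑S k {Even} (λ i → Supp-alternating k {Even} (suc i) (Supp-q^ {P = Even} (m*2-even (suc i ℕ.* suc i)))) n

  even⊛even : ∀ k a b → Supp k Even a → Supp k Even b → Supp k Even (a ⊛ b)
  even⊛even k a b = Supp-⊛ {P = Even} {Q = Even} {T = Even} {a} {b} even? even? even+even

  even⊞even : ∀ k a b → Supp k Even a → Supp k Even b → Supp k Even (a ⊞ b)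
  even⊞even k a b = Supp-⊞ {P = Even} {a = a} {b = b}

  even-1 : ∀ k → Supp k Even (q^ 0)
  even-1 k = Supp-q^ {P = Even} {0} refl

  even-^ : ∀ k L r a → Supp k Even a → Supp k Even (RingIdentities._^_ (truncated k L) a r)
  even-^ k L zero    a p = even-1 k
  even-^ k L (suc r) a p = even⊛even k a _ p (even-^ k L r a p)

  -- The terms of the two expansions at N = 2h + 1.

  module Coefficients (h : ℕ) (N%8≡5 : suc (h ℕ.* 2) % 8 ≡ 5) (reps-even : reps (suc (h ℕ.* 2)) % 2 ≡ 0) where

    N : ℕ
    N = suc (h ℕ.* 2)

    N-odd : ¬ Even N
    N-odd e = contradiction (trans (sym (odd+even 1 (h ℕ.* 2) refl (m*2-even h))) e) λ ()

    N-not5 : ¬ Not5 N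
    N-not5 f = f N%8≡5

    X Y : Series
    X = x N ⊞ (x N ⊛ x N)
    Y = y h ⊞ (y h ⊛ y h)

    private
      open Truncated 2 (suc N)
      module R₂ = CommutativeRing (truncated 2 (suc N))
      open RingIdentities (truncated 2 (suc N)) using (frobenius)

      two≈0 : RingIdentities.two (truncated 2 (suc N)) ≈ 0S
      two≈0 = R₂.trans (R₂.sym (R₂.*-identityʳ _)) (two^≈0 1 refl)

      x≈ : ∀ n → x n ≈ x₊ n
      x≈ = ∑S-alternating≈ two≈0 (λ i → q^ (suc i ℕ.* suc i))

      y≈ : ∀ n → y n ≈ x² n
      y≈ = ∑S-alternating≈ two≈0 (λ i → q^ (suc i ℕ.* suc i ℕ.* 2))

      x⊛x≈ : x N ⊛ x N ≈ x² N
      x⊛x≈ = R₂.trans (R₂.*-cong {x N} {x₊ N} {x N} {x₊ N} (x≈ N) (x≈ N)) (∑S-square two≈0 (λ i → suc i ℕ.* suc i) N)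

      y⊛y≈ : y h ⊛ y h ≈ y² h
      y⊛y≈ = R₂.trans (R₂.*-cong {y h} {x² h} {y h} {x² h} (y≈ h) (y≈ h)) (∑S-square two≈0 (λ i → suc i ℕ.* suc i ℕ.* 2) h)

      x⊛y-N : + 2 ∣ (x N ⊛ y h) N
      x⊛y-N = Supp-⊛ {P = Square} {Q = Double} {T = Not5} {x N} {y h} square? double? square+double (Supp-x 2 N) (Supp-y 2 h) N N-not5

      x⊛x²-N : + 2 ∣ (x N ⊛ x² N) N
      x⊛x²-N = Supp-⊛ {P = Square} {Q = Double} {T = Not5} {x N} {x² N} square? double? square+double (Supp-x 2 N) (Supp-x² 2 N) N N-not5

    squares-sum : ℕ × ℕ → ℕ
    squares-sum (i , j) = suc i ℕ.* suc i ℕ.+ suc j ℕ.* suc j ℕ.* 2 ℕ.* 2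

    in-range : ∀ i j → N ≡ squares-sum (i , j) → i < N × j < h
    in-range i j e =
        subst (i <_) (sym e) (ℕ.≤-trans (n≤n*n (suc i)) (ℕ.m≤m+n _ _))
      , ℕ.*-cancelʳ-≤ (suc j) h 2 (ℕ.s≤s⁻¹ (subst (suc (suc j ℕ.* 2) ≤_) (sym e)
          (ℕ.+-mono-≤ (ℕ.≤-trans (s≤s z≤n) (n≤n*n (suc i))) (ℕ.*-monoˡ-≤ 2 (ℕ.≤-trans (n≤n*n (suc j)) (ℕ.m≤m*n _ 2))))))

    pairs : Enumeration (λ a → N ≡ squares-sum a)
    pairs = enumerate (λ a → N ≟ squares-sum a) (cartesianProduct (downFrom N) (downFrom h))
      (Unique.cartesianProduct⁺ (Unique.downFrom⁺ N) (Unique.downFrom⁺ h))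
      (λ {a} e → let (i< , j<) = in-range (proj₁ a) (proj₂ a) e in ∈-cartesianProduct⁺ (∈-downFrom⁺ i<) (∈-downFrom⁺ j<))

    -- The two series omit the zero squares that `reps` admits; a = 0 would make N a multiple of 4,
    -- and b = 0 a square.
    x₊⊛y²-coeff : (x₊ N ⊛ y² h) N ≡ + reps N
    x₊⊛y²-coeff = begin
      (x₊ N ⊛ y² h) N
        ≡⟨ ⊛-cong {x₊ N} {_} {y² h} {_} (∑S-monomials (λ i → suc i ℕ.* suc i) N) (∑S-monomials (λ i → suc i ℕ.* suc i ℕ.* 2 ℕ.* 2) h) N ⟩
      (monomials (λ i → suc i ℕ.* suc i) (downFrom N) ⊛ monomials (λ i → suc i ℕ.* suc i ℕ.* 2 ℕ.* 2) (downFrom h)) N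
        ≡⟨ monomials-⊛ (λ i → suc i ℕ.* suc i) (λ i → suc i ℕ.* suc i ℕ.* 2 ℕ.* 2) (downFrom N) (downFrom h) N ⟩
      monomials squares-sum (cartesianProduct (downFrom N) (downFrom h)) N
        ≡⟨ monomials-coeff squares-sum (cartesianProduct (downFrom N) (downFrom h)) N ⟩
      + card pairs
        ≡⟨ cong +_ (card-bijection pairs (representations N) (λ (i , j) → suc i , suc j) (λ (a , b) → ℕ.pred a , ℕ.pred b)
             (λ {a} e → trans (cong (suc (proj₁ a) ℕ.* suc (proj₁ a) ℕ.+_) (fourfold (suc (proj₂ a)))) (sym e))
             (λ {b} e → trans (sym e) (trans (cong (proj₁ b ℕ.* proj₁ b ℕ.+_) (fourfold (proj₂ b)))
               (cong (λ (c , d) → c ℕ.* c ℕ.+ d ℕ.* d ℕ.* 2 ℕ.* 2) (sym (back b e)))))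
             (λ _ → refl) (λ {b} e → back b e)) ⟩
      + reps N ∎
      where
      open ≡-Reasoning
      open FiveModEight N N%8≡5
      fourfold : ∀ b → 4 ℕ.* (b ℕ.* b) ≡ b ℕ.* b ℕ.* 2 ℕ.* 2
      fourfold = solve-∀
      back : ∀ ((a , b) : ℕ × ℕ) → a ℕ.* a ℕ.+ 4 ℕ.* (b ℕ.* b) ≡ N → (suc (ℕ.pred a) , suc (ℕ.pred b)) ≡ (a , b)
      back (zero  , b)     e = contradiction e (non-four-multiple (b ℕ.* b))
      back (suc a , zero)  e = contradiction (trans (sym (ℕ.+-identityʳ _)) e) (nonsquare (suc a))
      back (suc a , suc b) e = refl

    private
      x₊⊛y²-N : + 2 ∣ (x₊ N ⊛ y² h) N
      x₊⊛y²-N = subst (+ 2 ∣_) (sym x₊⊛y²-coeff) (even⇒∣ (reps N) reps-even)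
        where
        even⇒∣ : ∀ m → Even m → + 2 ∣ + m
        even⇒∣ m e = divides (+ (m / 2)) (trans (cong +_ (trans (m≡m%n+[m/n]*n m 2) (cong (ℕ._+ m / 2 ℕ.* 2) e))) (ℤ.pos-* (m / 2) 2))

      x⊛y²-N : + 2 ∣ (x N ⊛ y² h) N
      x⊛y²-N = parity (R₂.*-cong {x N} {x₊ N} {y² h} {y² h} (x≈ N) R₂.refl) x₊⊛y²-N

      odds evens : Series
      odds  = ∑S (λ i → alternating (suc (i ℕ.* 2)) (q^ (suc (i ℕ.* 2) ℕ.* suc (i ℕ.* 2)))) (suc h)
      evens = ∑S (λ i → alternating (suc (suc (i ℕ.* 2))) (q^ (suc (suc (i ℕ.* 2)) ℕ.* suc (suc (i ℕ.* 2))))) h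

      x≗odds+evens : x N ≗ odds ⊞ evens
      x≗odds+evens = ∑S-split (λ i → alternating (suc i) (q^ (suc i ℕ.* suc i))) h

      even-evens : ∀ k → Supp k Even evens
      even-evens k = Supp-∑S k {Even} (λ i → Supp-alternating k {Even} (suc (suc (i ℕ.* 2))) (Supp-q^ {P = Even}
        (trans (cong (_% 2) (sym (ℕ.*-assoc (suc (suc (i ℕ.* 2))) (suc i) 2))) (m*2-even (suc (suc (i ℕ.* 2)) ℕ.* suc i))))) h

      odd-odds : ∀ k → Supp k Odd odds
      odd-odds k = Supp-∑S k {Odd} (λ i → Supp-alternating k {Odd} (suc (i ℕ.* 2)) (Supp-q^ {P = Odd}
        (odd*odd (suc (i ℕ.* 2)) (suc (i ℕ.* 2)) (odd+even 1 (i ℕ.* 2) refl (m*2-even i)) (odd+even 1 (i ℕ.* 2) refl (m*2-even i))))) (suc h)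

      evens≈ : evens ≈ y² h
      evens≈ = ∑S-cong {λ i → alternating (suc (suc (i ℕ.* 2))) (q^ (suc (suc (i ℕ.* 2)) ℕ.* suc (suc (i ℕ.* 2))))} {λ i → q^ (suc i ℕ.* suc i ℕ.* 2 ℕ.* 2)}
        (λ i → R₂.trans (alternating≈ two≈0 (suc (suc (i ℕ.* 2))) (q^ (suc (suc (i ℕ.* 2)) ℕ.* suc (suc (i ℕ.* 2)))))
          (R₂.reflexive (cong q^_ (eq i)))) h
        where
        eq : ∀ i → (2 ℕ.+ i ℕ.* 2) ℕ.* (2 ℕ.+ i ℕ.* 2) ≡ (1 ℕ.+ i) ℕ.* (1 ℕ.+ i) ℕ.* 2 ℕ.* 2
        eq = solve-∀

      -- Modulo 2 the series `evens` is `y²`, so x · y² is odds · evens + evens², and evens² has no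
      -- odd exponent. The parity at N is thus that of R(N).
      odds⊛evens-N : + 2 ∣ (odds ⊛ evens) N
      odds⊛evens-N = ∣m+n∣n⇒∣m (subst (+ 2 ∣_) (trans (⊛-cong {x N} {odds ⊞ evens} {evens} {evens} x≗odds+evens (λ _ → refl) N)
          (⊛-distribʳ odds evens evens N)) (parity (R₂.*-cong {x N} {x N} {evens} {y² h} R₂.refl evens≈) x⊛y²-N))
        (even⊛even 2 evens evens (even-evens 2) (even-evens 2) N N-odd)

    x-N : ∀ k → + k ∣ x N N
    x-N k = Supp-x k N N λ { (inj₁ e) → clash e λ () ; (inj₂ (inj₁ e)) → clash e λ () ; (inj₂ (inj₂ e)) → clash e λ () }
      where
      clash : ∀ {r} → N % 8 ≡ r → ¬ (5 ≢ r)
      clash e 5≢r = 5≢r (trans (sym N%8≡5) e)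

    -- N is not a square, so x contributes nothing. In x² the squares of `odds` and `evens` have
    -- only even exponents, and the cross term is twice an even number.
    X-N : + 4 ∣ X N
    X-N = ∣m∣n⇒∣m+n (x-N 4) (∣-resp-mod (coeff expand N (ℕ.n<1+n N))
      (∣m∣n⇒∣m+n (∣m∣n⇒∣m+n
        (Supp-⊛ {P = Odd} {Q = Odd} {T = Even} {odds} {odds} odd? odd? odd+odd (odd-odds 4) (odd-odds 4) N N-odd)
        (even⊛even 4 evens evens (even-evens 4) (even-evens 4) N N-odd))
        (T₄.two⊛-∣ {2} {odds ⊛ evens} {N} odds⊛evens-N)))
      where
      module T₄ = Truncated 4 (suc N)
      module R₄ = CommutativeRing (truncated 4 (suc N))
      open RingIdentities (truncated 4 (suc N)) using (two; binomial-square)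
      expand : x N ⊛ x N R₄.≈ ((odds ⊛ odds) ⊞ (evens ⊛ evens)) ⊞ (two ⊛ (odds ⊛ evens))
      expand = R₄.trans (R₄.*-cong {x N} {odds ⊞ evens} {x N} {odds ⊞ evens} (≗⇒≈ x≗odds+evens) (≗⇒≈ x≗odds+evens)) (binomial-square odds evens)

    -- Modulo 2 this is x² + x⁴, a series in even exponents.
    X⊛X-N : + 2 ∣ (X ⊛ X) N
    X⊛X-N = parity (R₂.trans (frobenius two≈0 (x N) (x N ⊛ x N))
        (R₂.+-cong {x N ⊛ x N} {x² N} {(x N ⊛ x N) ⊛ (x N ⊛ x N)} {x² N ⊛ x² N} x⊛x≈ (R₂.*-cong {x N ⊛ x N} {x² N} {x N ⊛ x N} {x² N} x⊛x≈ x⊛x≈)))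
      (even⊞even 2 (x² N) (x² N ⊛ x² N) (even-x² 2 N) (even⊛even 2 (x² N) (x² N) (even-x² 2 N) (even-x² 2 N)) N N-odd)

    -- Of the two terms, x y has exponents a² + 2b², and x² y only even exponents modulo 2.
    X⊛y-N : + 2 ∣ (X ⊛ y h) N
    X⊛y-N = subst (+ 2 ∣_) (sym (⊛-distribʳ (x N) (x N ⊛ x N) (y h) N)) (∣m∣n⇒∣m+n x⊛y-N
      (parity (R₂.*-cong {x N ⊛ x N} {x² N} {y h} {y h} x⊛x≈ R₂.refl) (even⊛even 2 (x² N) (y h) (even-x² 2 N) (even-y 2 h) N N-odd)))

    x⊛X-N : + 2 ∣ (x N ⊛ X) N
    x⊛X-N = subst (+ 2 ∣_) (sym (⊛-distribˡ (x N) (x N) (x N ⊛ x N) N)) (∣m∣n⇒∣m+n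
      (parity x⊛x≈ (even-x² 2 N N N-odd))
      (parity (R₂.*-cong {x N} {x N} {x N ⊛ x N} {x² N} R₂.refl x⊛x≈) x⊛x²-N))

    -- Residues modulo 8 dispose of x y, but x y² counts representations a² + 4b²: here the parity
    -- of R(N) is used a second time.
    x⊛Y-N : + 2 ∣ (x N ⊛ Y) N
    x⊛Y-N = subst (+ 2 ∣_) (sym (⊛-distribˡ (x N) (y h) (y h ⊛ y h) N)) (∣m∣n⇒∣m+n x⊛y-N
      (parity (R₂.*-cong {x N} {x N} {y h ⊛ y h} {y² h} R₂.refl y⊛y≈) x⊛y²-N))

    even-Y : ∀ k → Supp k Even Y
    even-Y k = even⊞even k (y h) (y h ⊛ y h) (even-y k h) (even⊛even k (y h) (y h) (even-y k h) (even-y k h))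

    φ₂^r-N : ∀ k r → let open RingIdentities (truncated k (suc N)) in + k ∣ (((q^ 0) ⊞ (two ⊛ y h)) ^ r) N
    φ₂^r-N k r = even-^ k (suc N) r ((q^ 0) ⊞ (two ⊛ y h)) (even⊞even k (q^ 0) (two ⊛ y h) (even-1 k)
      (even⊛even k two (y h) (even⊞even k (q^ 0) (q^ 0) (even-1 k) (even-1 k)) (even-y k h))) N N-odd
      where open RingIdentities (truncated k (suc N)) using (two)

    overpartitions-equation : ∀ k r → let open RingIdentities (truncated k (suc N)) in
      (Overpartitions.total k (suc r) N ⊛ (((q^ 0) ⊞ (two ⊛ x N)) ^ suc r)) ≈ (((q^ 0) ⊞ (two ⊛ y h)) ^ r) [ k , suc N ]
    overpartitions-equation k r = R.trans (R.*-congˡ {G} (^-congˡ (suc r) (R.sym φ≈)))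
      (R.trans (theta-identity {G} qᴸ≈0 G≈) (^-congˡ r φ₂≈))
      where
      module T = Truncated k (suc N)
      module R = CommutativeRing (truncated k (suc N))
      open RingIdentities (truncated k (suc N)) using (_^_; ^-congˡ; two; ∏<; ∏<-cong; module Gauss)
      open RingIdentities (truncated k (suc N)) using (module ThetaQuotient)
      odd : ℕ → Bool
      odd i = suc i % 2 ℕ.≡ᵇ 1
      qᴸ≈0 : q ^ suc N R.≈ 0S
      qᴸ≈0 = R.trans (T.q-^ (suc N)) (q^-truncate {suc N} ℕ.≤-refl)
      open ThetaQuotient q h r odd (λ i → cong (ℕ._≡ᵇ 1) (odd+even 1 (i ℕ.* 2) refl (m*2-even i)))
        (λ i → cong (ℕ._≡ᵇ 1) (m*2-even (suc i))) (R.trans (T.qq-^ (suc h)) (q^-truncate {suc h ℕ.* 2} ℕ.≤-refl))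
      G : Series
      G = Overpartitions.total k (suc r) N
      φ≈ : Gauss.φ q N R.≈ (q^ 0) ⊞ (two ⊛ x N)
      φ≈ = R.+-congˡ {q^ 0} (R.*-congˡ {two} (T.φ-tail≈ N q (λ i → T.q-^ (suc i ℕ.* suc i))))
      φ₂≈ : Gauss.φ (q ⊛ q) h R.≈ (q^ 0) ⊞ (two ⊛ y h)
      φ₂≈ = R.+-congˡ {q^ 0} (R.*-congˡ {two} (T.φ-tail≈ h (q ⊛ q) (λ i → T.qq-^ (suc i ℕ.* suc i))))
      product : (Series → Series) → Series
      product g = ∏< (λ i → g (q ^ suc i) ^ colours (suc r) (suc i)) N
      product≈ : ∀ g → (∀ {a b} → a R.≈ b → g a R.≈ g b) → product g R.≈ ∏< (λ i → g (q^ suc i) ^ colours (suc r) (suc i)) N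
      product≈ g g-cong = ∏<-cong (λ i → ^-congˡ (colours (suc r) (suc i)) (g-cong (T.q-^ (suc i)))) N
      1-_ 1+_ : Series → Series
      1- a = (q^ 0) ⊞ (⊟ a)
      1+ a = (q^ 0) ⊞ a
      G≈ : G ⊛ product 1-_ R.≈ product 1+_
      G≈ = R.trans (R.*-congˡ {G} (product≈ 1-_ (λ {a} {b} e → R.+-congˡ {q^ 0} {⊟ a} {⊟ b} (R.-‿cong e))))
        (R.trans (Overpartitions.generating-function k (suc r) N)
          (R.sym (product≈ 1+_ (λ {a} {b} e → R.+-congˡ {q^ 0} {a} {b} e))))

    total-∣ : ∀ k s {a} → Overpartitions.total k s N ≈ a [ k , suc N ] → + k ∣ a N → k ℕ∣.∣ ā s N
    total-∣ k s e p = ∣⇒∣ᵤ (subst (+ k ∣_) (Overpartitions.total-coeff k s N) (∣-resp-mod (coeff e N (ℕ.n<1+n N)) p))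

    -- φ₂ʳ has only even exponents, and the bracket behind 4 · 2^j is divisible by 4 at N: X by
    -- `X-N`, the rest by its factor 2 and an even coefficient.
    overpartitions-even : ∀ j α k → suc (suc (2 ℕ.* k)) ≡ 2 ℕ.^ suc j ℕ.* α → 2 ℕ.^ (4 ℕ.+ j) ℕ∣.∣ ā (suc (suc (2 ℕ.* k))) N
    overpartitions-even j α k s≡ = total-∣ K (suc r) (proj₂ (proj₂ expansion)) (∣m∣n⇒∣m+n (φ₂^r-N K r)
      (subst (λ e → + e ∣ main N) (power-eq (2 ℕ.^ j)) (subst (+ (2 ℕ.* (2 ℕ.* (2 ℕ.^ j ℕ.* 4))) ∣_) (sym (regroup N)) inner)))
      where
      K r : ℕ
      K = 2 ℕ.^ (4 ℕ.+ j)
      r = suc (2 ℕ.* k)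
      open RingIdentities (truncated K (suc N)) using (two; _^_)
      open RingIdentities (truncated K (suc N)) using (module Expansion)
      module T = Truncated K (suc N)
      open Algebra.Properties.Semiring.Mult (CommutativeRing.semiring (truncated K (suc N))) using () renaming (_×_ to _·_)
      expansion = Expansion.expand-even (x N) (y h) j α k r s≡ refl (T.two^≈0 (4 ℕ.+ j) refl) (overpartitions-equation K r)
      b d : ℕ
      b = proj₁ expansion
      d = proj₁ (proj₂ expansion)
      B C V main : Series
      B = (b · (q^ 0)) ⊛ X
      C = ((d · (q^ 0)) ⊛ (X ⊛ X)) ⊞ ((b · (q^ 0)) ⊛ (X ⊛ y h))
      V = B ⊞ (two ⊛ C)
      main = ((two ⊛ two) ⊛ (two ^ j)) ⊛ V
      V-N : + 4 ∣ V N
      V-N = ∣m∣n⇒∣m+n (T.multiple⊛-∣ b {4} {X} {N} X-N) (T.two⊛-∣ {2} {C} {N}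
        (∣m∣n⇒∣m+n (T.multiple⊛-∣ d {2} {X ⊛ X} {N} X⊛X-N) (T.multiple⊛-∣ b {2} {X ⊛ y h} {N} X⊛y-N)))
      inner : + (2 ℕ.* (2 ℕ.* (2 ℕ.^ j ℕ.* 4))) ∣ (two ⊛ (two ⊛ ((two ^ j) ⊛ V))) N
      inner = T.two⊛-∣ {2 ℕ.* (2 ℕ.^ j ℕ.* 4)} {two ⊛ ((two ^ j) ⊛ V)} {N} (T.two⊛-∣ {2 ℕ.^ j ℕ.* 4} {(two ^ j) ⊛ V} {N} (T.two^⊛-∣ j {4} {V} {N} V-N))
      regroup : main ≗ two ⊛ (two ⊛ ((two ^ j) ⊛ V))
      regroup n = trans (⊛-assoc (two ⊛ two) (two ^ j) V n) (⊛-assoc two two ((two ^ j) ⊛ V) n)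
      power-eq : ∀ t → 2 ℕ.* (2 ℕ.* (t ℕ.* 4)) ≡ 2 ℕ.* (2 ℕ.* (2 ℕ.* (2 ℕ.* t)))
      power-eq = solve-∀

    -- The terms 1 and 2x vanish at N, the 4 before X meets a coefficient divisible by 4, Y has even
    -- exponents only, and everything behind the factor 8 is even at N.
    overpartitions-odd : ∀ k → 16 ℕ∣.∣ ā (suc (2 ℕ.* k)) N
    overpartitions-odd k = total-∣ 16 (suc (2 ℕ.* k)) (proj₂ (proj₂ (proj₂ (proj₂ expansion))))
      (∣m∣n⇒∣m+n (∣m∣n⇒∣m+n (∣m∣n⇒∣m+n (even-1 16 N N-odd) (16∣⊛ {x N} (x-N 16)))
        (subst (+ 16 ∣_) (sym (⊛-assoc two two D N)) (T.two⊛-∣ {8} {two ⊛ D} {N} (T.two⊛-∣ {4} {D} {N}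
          (∣m∣n⇒∣m+n (T.multiple⊛-∣ b {4} {X} {N} X-N) (T.multiple⊛-∣ b′ {4} {Y} {N} (even-Y 4 N N-odd)))))))
        (subst (+ 16 ∣_) (sym (trans (⊛-assoc (two ⊛ two) two F N) (⊛-assoc two two (two ⊛ F) N)))
          (T.two⊛-∣ {8} {two ⊛ (two ⊛ F)} {N} (T.two⊛-∣ {4} {two ⊛ F} {N} (T.two⊛-∣ {2} {F} {N}
            (∣m∣n⇒∣m+n (∣m∣n⇒∣m+n (T.multiple⊛-∣ d {2} {X ⊛ X} {N} X⊛X-N)
                (T.multiple⊛-∣ d′ {2} {Y ⊛ Y} {N} (even⊛even 2 Y Y (even-Y 2) (even-Y 2) N N-odd)))
              (∣m∣n⇒∣m+n (T.multiple⊛-∣ b {2} {x N ⊛ X} {N} x⊛X-N) (T.multiple⊛-∣ b′ {2} {x N ⊛ Y} {N} x⊛Y-N))))))))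
      where
      open RingIdentities (truncated 16 (suc N)) using (two; _^_)
      open RingIdentities (truncated 16 (suc N)) using (module Expansion)
      module T = Truncated 16 (suc N)
      open Algebra.Properties.Semiring.Mult (CommutativeRing.semiring (truncated 16 (suc N))) using () renaming (_×_ to _·_)
      expansion = Expansion.expand-odd (x N) (y h) k (T.two^≈0 4 refl) (overpartitions-equation 16 (2 ℕ.* k))
      b d b′ d′ : ℕ
      b = proj₁ expansion
      d = proj₁ (proj₂ expansion)
      b′ = proj₁ (proj₂ (proj₂ expansion))
      d′ = proj₁ (proj₂ (proj₂ (proj₂ expansion)))
      D F : Series
      D = ((b · (q^ 0)) ⊛ X) ⊞ ((b′ · (q^ 0)) ⊛ Y)
      F = (((d · (q^ 0)) ⊛ (X ⊛ X)) ⊞ ((d′ · (q^ 0)) ⊛ (Y ⊛ Y))) ⊞ (((b · (q^ 0)) ⊛ (x N ⊛ X)) ⊞ ((b′ · (q^ 0)) ⊛ (x N ⊛ Y)))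
      16∣⊛ : ∀ {z} → + 16 ∣ z N → + 16 ∣ (two ⊛ z) N
      16∣⊛ {z} p = subst (+ 16 ∣_) (sym (T.two⊛ z N)) (∣m∣n⇒∣m+n p p)

  triangular : ℕ → ℕ
  triangular zero    = 0
  triangular (suc t) = suc t ℕ.+ triangular t

  triangular-even : ∀ i → triangular (i ℕ.* 2) ≡ i ℕ.* suc (i ℕ.* 2)
  triangular-even zero    = refl
  triangular-even (suc i) = trans (cong (λ t → (2 ℕ.+ i ℕ.* 2) ℕ.+ ((1 ℕ.+ i ℕ.* 2) ℕ.+ t)) (triangular-even i)) (eq i)
    where
    eq : ∀ i → (2 ℕ.+ i ℕ.* 2) ℕ.+ ((1 ℕ.+ i ℕ.* 2) ℕ.+ i ℕ.* (1 ℕ.+ i ℕ.* 2)) ≡ (1 ℕ.+ i) ℕ.* (3 ℕ.+ i ℕ.* 2)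
    eq = solve-∀

  8*triangular+1 : ∀ i → suc (8 ℕ.* triangular i) ≡ suc (i ℕ.* 2) ℕ.* suc (i ℕ.* 2)
  8*triangular+1 zero    = refl
  8*triangular+1 (suc i) = trans (eq₁ i (triangular i)) (trans (cong (λ t → 8 ℕ.* (1 ℕ.+ i) ℕ.+ t) (8*triangular+1 i)) (eq₂ i))
    where
    eq₁ : ∀ i t → 1 ℕ.+ 8 ℕ.* (1 ℕ.+ i ℕ.+ t) ≡ 8 ℕ.* (1 ℕ.+ i) ℕ.+ (1 ℕ.+ 8 ℕ.* t)
    eq₁ = solve-∀
    eq₂ : ∀ i → 8 ℕ.* (1 ℕ.+ i) ℕ.+ (1 ℕ.+ i ℕ.* 2) ℕ.* (1 ℕ.+ i ℕ.* 2) ≡ (3 ℕ.+ i ℕ.* 2) ℕ.* (3 ℕ.+ i ℕ.* 2)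
    eq₂ = solve-∀

  n≤triangular : ∀ n → n ≤ triangular n
  n≤triangular zero    = z≤n
  n≤triangular (suc n) = ℕ.m≤m+n (suc n) (triangular n)

  partialProduct-step : ∀ k ℓ N → partialProduct (suc ℓ) (suc N) ≈ partialProduct (suc ℓ) N [ k , suc N ]
  partialProduct-step k ℓ N = R.trans (R.*-congˡ {P} {(q^ 0) ⊖ (q^ (suc ℓ ℕ.* suc N))} {q^ 0} (R.trans
      (R.+-congˡ {q^ 0} {⊟ (q^ (suc ℓ ℕ.* suc N))} {⊟ 0S} (R.-‿cong (q^-truncate {suc ℓ ℕ.* suc N} (ℕ.m≤n*m (suc N) (suc ℓ)))))
      (≗⇒≈ (λ n → ℤ.+-identityʳ _)))) (R.*-identityʳ P)
    where
    module R = CommutativeRing (truncated k (suc N))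
    P : Series
    P = partialProduct (suc ℓ) N

  -- `f` reads each coefficient from a different partial product. The coefficient of qⁱ is constant
  -- from the i-th product on, so a single long product gives all of them.
  f≈partialProduct : ∀ k ℓ N → f (suc ℓ) ≈ partialProduct (suc ℓ) N [ k , suc N ]
  f≈partialProduct k ℓ N = agree λ i i<L → mod-reflexive (trans (sym (stable (N ℕ.∸ i) i))
    (cong (λ m → partialProduct (suc ℓ) m i) (ℕ.m∸n+n≡m (ℕ.s≤s⁻¹ i<L))))
    where
    stable : ∀ d i → partialProduct (suc ℓ) (d ℕ.+ i) i ≡ f (suc ℓ) i
    stable zero    i = refl
    stable (suc d) i = trans (mod-0⇒≡ (coeff (partialProduct-step 0 ℓ (d ℕ.+ i)) i (s≤s (ℕ.m≤n+m i d)))) (stable d i)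

  ≈-weaken : ∀ {a b k L L′} → L′ ≤ L → a ≈ b [ k , L ] → a ≈ b [ k , L′ ]
  ≈-weaken L′≤L e = agree λ n n<L′ → coeff e n (ℕ.<-≤-trans n<L′ L′≤L)

  -- The parity of c(n) as that of R(8n + 5).

  module CoefficientsOfC (n : ℕ) where

    private
      m L N : ℕ
      -- `gauss-ψ` starts at index 1, hence m = n + 1; m factors determine the products modulo
      -- q^(m+1), hence L.
      m = suc n
      L = suc m
      N = 8 ℕ.* n ℕ.+ 5

      module R = CommutativeRing (truncated 2 L)
      module T = Truncated 2 L
      open RingIdentities (truncated 2 L) using (two; _^_; ∏<; ∏<-cong; ∏<-*; Unit; unit-resp; unit-∏<; unit-1-; ^-congˡ; ^-distrib-*; module Gauss)
      open RingIdentities (truncated 2 L) using (one-minus-square; cube-times-sixth)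
      open Gauss T.q using (∏₋; ∏even; ∏odd; ψ; gauss-ψ; ∏₋-double)

      two≈0 : two R.≈ 0S
      two≈0 = R.trans (R.sym (R.*-identityʳ two)) (T.two^≈0 1 refl)

      partialProduct≈ : ∀ ℓ z → (∀ i → z ^ suc i R.≈ q^ (ℓ ℕ.* suc i)) → ∀ M →
        partialProduct ℓ M R.≈ ∏< (λ i → (q^ 0) ⊞ (⊟ (z ^ suc i))) M
      partialProduct≈ ℓ z e zero    = R.refl {q^ 0}
      partialProduct≈ ℓ z e (suc M) = R.*-cong {partialProduct ℓ M} {_} {(q^ 0) ⊖ (q^ (ℓ ℕ.* suc M))} {(q^ 0) ⊞ (⊟ (z ^ suc M))}
        (partialProduct≈ ℓ z e M) (R.+-congˡ {q^ 0} {⊟ (q^ (ℓ ℕ.* suc M))} {⊟ (z ^ suc M)} (R.-‿cong (R.sym (e M))))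

      f1≈ : ∀ M → m ≤ M → f 1 R.≈ ∏₋ M
      f1≈ M m≤M = R.trans (≈-weaken (s≤s m≤M) (f≈partialProduct 2 0 M)) (partialProduct≈ 1 T.q
        (λ i → R.trans (T.q-^ (suc i)) (R.reflexive (cong q^_ (sym (ℕ.*-identityˡ (suc i)))))) M)

      f2≈ : f 2 R.≈ ∏even m
      f2≈ = R.trans (f≈partialProduct 2 1 m) (partialProduct≈ 2 (T.q ⊛ T.q)
        (λ i → R.trans (T.qq-^ (suc i)) (R.reflexive (cong q^_ (ℕ.*-comm (suc i) 2)))) m)

      f2≈f1² : f 2 R.≈ f 1 ⊛ f 1
      f2≈f1² = R.trans f2≈ (R.sym (R.trans (R.*-cong {f 1} {∏₋ m} {f 1} {∏₋ m} (f1≈ m ℕ.≤-refl) (f1≈ m ℕ.≤-refl))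
        (R.trans (R.sym (∏<-* (λ i → (q^ 0) ⊞ (⊟ (T.q ^ suc i))) (λ i → (q^ 0) ⊞ (⊟ (T.q ^ suc i))) m))
          (∏<-cong (λ i → R.trans (one-minus-square two≈0 (T.q ^ suc i))
            (R.+-congˡ {q^ 0} {⊟ ((T.q ^ suc i) ⊛ (T.q ^ suc i))} {⊟ ((T.q ⊛ T.q) ^ suc i)} (R.-‿cong (R.sym (^-distrib-* T.q T.q (suc i)))))) m))))

      -- Gauss's identity rewrites one factor f₂ as the odd product times ψ; the odd product and the
      -- other f₂ together make up f₁.
      f2²≈f1ψ : f 2 ⊛ f 2 R.≈ f 1 ⊛ ψ m
      f2²≈f1ψ = R.trans (R.*-cong {f 2} {∏even m} {f 2} {∏odd m ⊛ ψ m} f2≈ (R.trans f2≈ (gauss-ψ n qQ≈0)))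
        (R.trans (R.sym (R.*-assoc (∏even m) (∏odd m) (ψ m))) (R.*-congʳ {ψ m} {∏even m ⊛ ∏odd m} {f 1}
          (R.trans (R.*-comm (∏even m) (∏odd m)) (R.sym (R.trans (f1≈ (m ℕ.* 2) (ℕ.m≤m*n m 2)) (∏₋-double m))))))
        where
        qQ≈0 : T.q ⊛ ((T.q ⊛ T.q) ^ suc n) R.≈ 0S
        qQ≈0 = R.trans (R.*-congˡ {T.q} (R.trans (T.qq-^ (suc n)) (R.refl {q^ (suc n ℕ.* 2)})))
          (R.trans (≗⇒≈ (q^-⊛ 1 (suc n ℕ.* 2))) (q^-truncate {1 ℕ.+ suc n ℕ.* 2} (s≤s (ℕ.m≤m*n (suc n) 2))))

      f1-unit : Unit (f 1)
      f1-unit = unit-resp (R.sym (f1≈ m ℕ.≤-refl)) (unit-∏< {λ i → (q^ 0) ⊞ (⊟ (T.q ^ suc i))} (λ i → unit-1- {T.q ^ suc i} L (nilpotent i)) m)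
        where
        nilpotent : ∀ i → (T.q ^ suc i) ^ L R.≈ 0S
        nilpotent i = R.trans (^-congˡ L (T.q-^ (suc i))) (R.trans (q^-^ 2 L (suc i) L) (q^-truncate {L ℕ.* suc i} (ℕ.m≤m*n L (suc i))))

      Ψ : Series
      Ψ = ∑S (λ t → q^ (triangular t)) (m ℕ.* 2)

      ψ≈ : ∀ M → ψ M R.≈ ∑S (λ t → q^ (triangular t)) (M ℕ.* 2)
      ψ≈ zero    = R.refl
      ψ≈ (suc M) = R.trans (R.+-cong {ψ M} {S} {(w ^ M) ⊞ (w ^ suc M)} {A ⊞ B} (ψ≈ M) (R.+-cong {w ^ M} {A} {w ^ suc M} {B}
          (power M (sym (triangular-even M)))
          (power (suc M) (cong (suc (M ℕ.* 2) ℕ.+_) (sym (triangular-even M))))))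
        (R.sym (R.+-assoc S A B))
        where
        w S A B : Series
        w = T.q ⊛ ((T.q ⊛ T.q) ^ M)
        S = ∑S (λ t → q^ (triangular t)) (M ℕ.* 2)
        A = q^ (triangular (M ℕ.* 2))
        B = q^ (triangular (suc (M ℕ.* 2)))
        power : ∀ i {e} → i ℕ.* suc (M ℕ.* 2) ≡ e → w ^ i R.≈ q^ e
        power i refl = R.trans (^-congˡ i (R.trans (R.*-congˡ {T.q} (T.qq-^ M)) (≗⇒≈ (q^-⊛ 1 (M ℕ.* 2))))) (q^-^ 2 L (suc (M ℕ.* 2)) i)

      Ψ₄ : Series
      Ψ₄ = ∑S (λ t → q^ (triangular t ℕ.* 2 ℕ.* 2)) (m ℕ.* 2)

      -- f₁³f₂⁶ is ψ⁵ modulo 2, and squaring twice turns ψ⁴ into ψ(q⁴).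
      c≈ : c R.≈ Ψ ⊛ Ψ₄
      c≈ = R.trans (cube-times-sixth {f 1} {f 2} {Ψ} f1-unit f2≈f1² (R.trans f2²≈f1ψ (R.*-congˡ {f 1} (ψ≈ m))))
        (R.*-congˡ {Ψ} {(Ψ ⊛ Ψ) ⊛ (Ψ ⊛ Ψ)} {Ψ₄} (R.trans (R.*-cong {Ψ ⊛ Ψ} {Ψ₂} {Ψ ⊛ Ψ} {Ψ₂} Ψ²≈ Ψ²≈) (T.∑S-square two≈0 (λ t → triangular t ℕ.* 2) (m ℕ.* 2))))
        where
        Ψ₂ : Series
        Ψ₂ = ∑S (λ t → q^ (triangular t ℕ.* 2)) (m ℕ.* 2)
        Ψ²≈ : Ψ ⊛ Ψ R.≈ Ψ₂
        Ψ²≈ = T.∑S-square two≈0 triangular (m ℕ.* 2)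

      N%8≡5 : N % 8 ≡ 5
      N%8≡5 = trans (cong (_% 8) (trans (ℕ.+-comm (8 ℕ.* n) 5) (cong (5 ℕ.+_) (ℕ.*-comm 8 n)))) ([m+kn]%n≡m%n 5 n 8)

      open FiveModEight N N%8≡5 using (non-four-multiple)

      halves : ∀ a → a ≡ a / 2 ℕ.* 2 ⊎ a ≡ suc (a / 2 ℕ.* 2)
      halves a with a % 2 | m%n<n a 2 | m≡m%n+[m/n]*n a 2
      ... | 0           | _               | e = inj₁ e
      ... | 1           | _               | e = inj₂ e
      ... | suc (suc _) | s≤s (s≤s ())    | _

      triangles : ℕ × ℕ → ℕ
      triangles (i , j) = triangular i ℕ.+ triangular j ℕ.* 2 ℕ.* 2

      odd-form : ∀ i j → suc (i ℕ.* 2) ℕ.* suc (i ℕ.* 2) ℕ.+ 4 ℕ.* (suc (j ℕ.* 2) ℕ.* suc (j ℕ.* 2)) ≡ 8 ℕ.* triangles (i , j) ℕ.+ 5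
      odd-form i j = trans (cong₂ (λ s t → s ℕ.+ 4 ℕ.* t) (sym (8*triangular+1 i)) (sym (8*triangular+1 j))) (eq (triangular i) (triangular j))
        where
        eq : ∀ s t → (1 ℕ.+ 8 ℕ.* s) ℕ.+ 4 ℕ.* (1 ℕ.+ 8 ℕ.* t) ≡ 8 ℕ.* (s ℕ.+ t ℕ.* 2 ℕ.* 2) ℕ.+ 5
        eq = solve-∀

      -- An even a would make N a multiple of 4, and an even b would make N ≡ a² (mod 8).
      both-odd : ∀ a b → a ℕ.* a ℕ.+ 4 ℕ.* (b ℕ.* b) ≡ N → a ≡ suc (a / 2 ℕ.* 2) × b ≡ suc (b / 2 ℕ.* 2)
      both-odd a b e with halves a | halves b
      ... | inj₂ p | inj₂ r = p , r
      ... | inj₁ p | _      = contradiction (trans (trans (eq (a / 2) b) (cong (λ a → a ℕ.* a ℕ.+ 4 ℕ.* (b ℕ.* b)) (sym p))) e) (non-four-multiple (a / 2 ℕ.* (a / 2) ℕ.+ b ℕ.* b))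
        where
        eq : ∀ h b → 4 ℕ.* (h ℕ.* h ℕ.+ b ℕ.* b) ≡ h ℕ.* 2 ℕ.* (h ℕ.* 2) ℕ.+ 4 ℕ.* (b ℕ.* b)
        eq = solve-∀
      ... | inj₂ p | inj₁ r = contradiction (trans (sym ([m+kn]%n≡m%n (a ℕ.* a) (2 ℕ.* (b / 2 ℕ.* (b / 2))) 8))
            (trans (cong (_% 8) (trans (trans (eq a (b / 2)) (cong (λ b → a ℕ.* a ℕ.+ 4 ℕ.* (b ℕ.* b)) (sym r))) e)) N%8≡5)) (square≢5 a)
        where
        eq : ∀ a h → a ℕ.* a ℕ.+ 2 ℕ.* (h ℕ.* h) ℕ.* 8 ≡ a ℕ.* a ℕ.+ 4 ℕ.* (h ℕ.* 2 ℕ.* (h ℕ.* 2))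
        eq = solve-∀

      pairs : Enumeration (λ a → n ≡ triangles a)
      pairs = enumerate (λ a → n ≟ triangles a) (cartesianProduct (downFrom (m ℕ.* 2)) (downFrom (m ℕ.* 2)))
        (Unique.cartesianProduct⁺ (Unique.downFrom⁺ (m ℕ.* 2)) (Unique.downFrom⁺ (m ℕ.* 2)))
        (λ {a} e → ∈-cartesianProduct⁺
          (∈-downFrom⁺ (below (proj₁ a) (subst (proj₁ a ≤_) (sym e) (ℕ.≤-trans (n≤triangular (proj₁ a)) (ℕ.m≤m+n _ _)))))
          (∈-downFrom⁺ (below (proj₂ a) (subst (proj₂ a ≤_) (sym e) (ℕ.≤-trans (n≤triangular (proj₂ a))
            (ℕ.≤-trans (ℕ.≤-trans (ℕ.m≤m*n _ 2) (ℕ.m≤m*n _ 2)) (ℕ.m≤n+m _ (triangular (proj₁ a)))))))))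
        where
        below : ∀ i → i ≤ n → i < m ℕ.* 2
        below i i≤n = ℕ.≤-trans (s≤s i≤n) (ℕ.m≤m*n m 2)

      triangle-sum : ∀ a b → a ℕ.* a ℕ.+ 4 ℕ.* (b ℕ.* b) ≡ N → n ≡ triangles (a / 2 , b / 2)
      triangle-sum a b e = ℕ.*-cancelˡ-≡ n (triangles (a / 2 , b / 2)) 8 (ℕ.+-cancelʳ-≡ 5 (8 ℕ.* n) (8 ℕ.* triangles (a / 2 , b / 2))
        (trans (sym e) (trans (cong₂ (λ a b → a ℕ.* a ℕ.+ 4 ℕ.* (b ℕ.* b)) (proj₁ (both-odd a b e)) (proj₂ (both-odd a b e))) (odd-form (a / 2) (b / 2)))))

      half-odd : ∀ i → suc (i ℕ.* 2) / 2 ≡ i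
      half-odd i = ℕ.*-cancelʳ-≡ (suc (i ℕ.* 2) / 2) i 2 (ℕ.suc-injective (sym (trans (m≡m%n+[m/n]*n (suc (i ℕ.* 2)) 2)
        (cong (ℕ._+ suc (i ℕ.* 2) / 2 ℕ.* 2) (odd+even 1 (i ℕ.* 2) refl (m*2-even i))))))

      -- Completing squares: n = T(i) + 4 T(j) for triangular numbers T means (2i + 1)² + 4 (2j +
      -- 1)² = 8n + 5, and every representation has this form.
      product-coeff : (Ψ ⊛ Ψ₄) n ≡ + reps N
      product-coeff = begin
        (Ψ ⊛ Ψ₄) n
          ≡⟨ ⊛-cong {Ψ} {_} {Ψ₄} {_} (∑S-monomials triangular (m ℕ.* 2)) (∑S-monomials (λ t → triangular t ℕ.* 2 ℕ.* 2) (m ℕ.* 2)) n ⟩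
        (monomials triangular (downFrom (m ℕ.* 2)) ⊛ monomials (λ t → triangular t ℕ.* 2 ℕ.* 2) (downFrom (m ℕ.* 2))) n
          ≡⟨ monomials-⊛ triangular (λ t → triangular t ℕ.* 2 ℕ.* 2) (downFrom (m ℕ.* 2)) (downFrom (m ℕ.* 2)) n ⟩
        monomials triangles (cartesianProduct (downFrom (m ℕ.* 2)) (downFrom (m ℕ.* 2))) n
          ≡⟨ monomials-coeff triangles (cartesianProduct (downFrom (m ℕ.* 2)) (downFrom (m ℕ.* 2))) n ⟩
        + card pairs
          ≡⟨ cong +_ (card-bijection pairs (representations N) (λ (i , j) → suc (i ℕ.* 2) , suc (j ℕ.* 2)) (λ (a , b) → a / 2 , b / 2)
               (λ {a} e → trans (odd-form (proj₁ a) (proj₂ a)) (cong (λ t → 8 ℕ.* t ℕ.+ 5) (sym e)))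
               (λ {b} e → triangle-sum (proj₁ b) (proj₂ b) e)
               (λ {a} _ → cong₂ _,_ (half-odd (proj₁ a)) (half-odd (proj₂ a)))
               (λ {b} e → cong₂ _,_ (sym (proj₁ (both-odd (proj₁ b) (proj₂ b) e))) (sym (proj₂ (both-odd (proj₁ b) (proj₂ b) e))))) ⟩
        + reps N ∎
        where open ≡-Reasoning

    c-parity : c n ≡ + reps N [ 2 ]
    c-parity = mod-trans (coeff c≈ n (ℕ.m≤n⇒m≤1+n (ℕ.n<1+n n))) (mod-reflexive product-coeff)

  +m≡+m%2 : ∀ m → + m ≡ + (m % 2) [ 2 ]
  +m≡+m%2 m = congruent (divides (+ (m / 2)) (begin
    + m - + (m % 2)                              ≡⟨ cong (λ t → + t - + (m % 2)) (m≡m%n+[m/n]*n m 2) ⟩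
    + (m % 2) + + (m / 2 ℕ.* 2) - + (m % 2)      ≡⟨ eq (+ (m % 2)) (+ (m / 2 ℕ.* 2)) ⟩
    + (m / 2 ℕ.* 2)                              ≡⟨ ℤ.pos-* (m / 2) 2 ⟩
    + (m / 2) * + 2                              ∎))
    where
    open ≡-Reasoning
    eq : ∀ r t → r + t - r ≡ t
    eq = ℤ-solve-∀

  ∣⇒%ℕ2≡0 : ∀ i → + 2 ∣ i → i %ℕ 2 ≡ 0
  ∣⇒%ℕ2≡0 i 2∣i = small (i %ℕ 2) (n%ℕd<d i 2) (∣⇒∣ᵤ {+ 2} {+ (i %ℕ 2)} (∣m+n∣n⇒∣m (subst (+ 2 ∣_) (a≡a%ℕn+[a/ℕn]*n i 2) 2∣i) (divides (i /ℕ 2) refl)))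
    where
    small : ∀ r → r < 2 → 2 ℕ∣.∣ r → r ≡ 0
    small zero          _              _   = refl
    small (suc zero)    _              2∣1 = contradiction (ℕ∣.∣⇒≤ 2∣1) λ { (s≤s ()) }
    small (suc (suc _)) (s≤s (s≤s ())) _

  legendre-multiple : ∀ a p → + p ∣ a → legendre a p ≡ 0ℤ
  legendre-multiple a p p∣a rewrite dec-true (+ p ℤ∣? a) p∣a = refl

  legendre-unit : ∀ a p → ¬ (+ p ∣ a) → legendre a p ≡ 1ℤ [ 2 ]
  legendre-unit a p p∤a rewrite dec-false (+ p ℤ∣? a) p∤a with does (any? {p} λ x → + p ℤ∣? (+ (toℕ x ℕ.* toℕ x) - a))
  ... | true  = mod-reflexive refl
  ... | false = congruent (divides -1ℤ refl)

  -- The parity of κ(p) and the progression of exponents.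

  module OddPrime {p : ℕ} (p-prime : Prime p) (p≥3 : p ≥ 3) where

    p-odd : p % 2 ≡ 1
    p-odd with p % 2 in eq | m%n<n p 2
    ... | 1           | _            = refl
    ... | suc (suc _) | s≤s (s≤s ())
    ... | 0           | _ with prime⇒irreducible p-prime (ℕ∣.m%n≡0⇒n∣m p 2 eq)
    ...   | inj₁ ()
    ...   | inj₂ refl = contradiction p≥3 λ { (s≤s (s≤s ())) }

    private
      u : ℕ
      u = (p ℕ.* p) / 8

    p^2≡ : p ℕ.^ 2 ≡ suc (u ℕ.* 8)
    p^2≡ = trans (cong (p ℕ.*_) (ℕ.*-identityʳ p)) (trans (m≡m%n+[m/n]*n (p ℕ.* p) 8) (cong (ℕ._+ u ℕ.* 8) (odd-square%8 p p-odd)))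

    index : 5 ℕ.* (p ℕ.^ 2 ∸ 1) / 8 ≡ 5 ℕ.* u
    index = trans (cong (λ t → 5 ℕ.* (t ∸ 1) / 8) p^2≡) (trans (cong (_/ 8) (sym (ℕ.*-assoc 5 u 8))) (m*n/n≡m (5 ℕ.* u) 8))

    8*index+5 : 8 ℕ.* (5 ℕ.* u) ℕ.+ 5 ≡ p ℕ.^ 2 ℕ.* 5
    8*index+5 = trans (eq u) (cong (ℕ._* 5) (sym p^2≡))
      where
      eq : ∀ u → 8 ℕ.* (5 ℕ.* u) ℕ.+ 5 ≡ (1 ℕ.+ u ℕ.* 8) ℕ.* 5
      eq = solve-∀

    argument : 5 ℕ.* (p ℕ.^ 2 ∸ 1) / 4 ≡ 10 ℕ.* u
    argument = trans (cong (λ t → 5 ℕ.* (t ∸ 1) / 4) p^2≡) (trans (cong (_/ 4) (eq u)) (m*n/n≡m (10 ℕ.* u) 4))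
      where
      eq : ∀ u → 5 ℕ.* (u ℕ.* 8) ≡ 10 ℕ.* u ℕ.* 4
      eq = solve-∀

    c≡reps : c (5 ℕ.* (p ℕ.^ 2 ∸ 1) / 8) ≡ + (reps (p ℕ.^ 2 ℕ.* 5) % 2) [ 2 ]
    c≡reps = mod-trans {y = + reps (p ℕ.^ 2 ℕ.* 5)} at-p (+m≡+m%2 (reps (p ℕ.^ 2 ℕ.* 5)))
      where
      at-index : ∀ i j → 8 ℕ.* i ℕ.+ 5 ≡ j → c i ≡ + reps j [ 2 ]
      at-index i j refl = CoefficientsOfC.c-parity i

      at-p : c (5 ℕ.* (p ℕ.^ 2 ∸ 1) / 8) ≡ + reps (p ℕ.^ 2 ℕ.* 5) [ 2 ]
      at-p = at-index (5 ℕ.* (p ℕ.^ 2 ∸ 1) / 8) (p ℕ.^ 2 ℕ.* 5) (trans (cong (λ i → 8 ℕ.* i ℕ.+ 5) index) 8*index+5)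

    -- From p² = 8u + 1 follows 5p² = 4 · 10u + 5, so a prime p dividing 10u would divide 5.
    p∤argument : p ≢ 5 → ¬ (+ p ∣ - + (10 ℕ.* u))
    p∤argument p≢5 p∣ = p≢5 (prime∣5⇒≡5 p-prime p∣5)
      where
      p∣10u : p ℕ∣.∣ 10 ℕ.* u
      p∣10u = subst (p ℕ∣.∣_) (ℤ.∣-i∣≡∣i∣ (+ (10 ℕ.* u))) (∣⇒∣ᵤ p∣)
      eq : ∀ u → (1 ℕ.+ u ℕ.* 8) ℕ.* 5 ≡ 10 ℕ.* u ℕ.* 4 ℕ.+ 5
      eq = solve-∀
      p∣5 : p ℕ∣.∣ 5
      p∣5 = ℕ∣.∣m+n∣m⇒∣n (subst (p ℕ∣.∣_) (trans (cong (ℕ._* 5) p^2≡) (eq u)) (ℕ∣.∣m⇒∣m*n 5 (ℕ∣.m∣m*n (p ℕ.^ 1)))) (ℕ∣.∣m⇒∣m*n 4 p∣10u)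

    p³≡1 : + (p ℕ.^ 3) ≡ 1ℤ [ 2 ]
    p³≡1 = mod-trans (+m≡+m%2 (p ℕ.^ 3)) (mod-reflexive (cong +_
      (odd*odd p (p ℕ.^ 2) p-odd (odd*odd p (p ℕ.^ 1) p-odd (trans (cong (_% 2) (ℕ.*-identityʳ p)) p-odd)))))

    private
      leg : ℤ
      leg = legendre (- + (5 ℕ.* (p ℕ.^ 2 ∸ 1) / 4)) p

    -- Now 5p² is the cube of p, an exponent covered by `reps-even`, and the argument of the
    -- Legendre symbol is a multiple of 5.
    κ-even-5 : p ≡ 5 → + 2 ∣ κ p
    κ-even-5 p≡5 = ∣m∣n⇒∣m+n (∣-resp-mod c≡reps (subst (λ r → + 2 ∣ + r) (sym reps-125) (divides 0ℤ refl)))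
      (∣n⇒∣m*n (+ (p ℕ.^ 3)) {leg} (subst (+ 2 ∣_) (sym (legendre-multiple _ p p∣argument)) (divides 0ℤ refl)))
      where
      cube≡ : p ℕ.^ (3 ℕ.+ 4 ℕ.* 0) ℕ.* 1 ≡ p ℕ.^ 2 ℕ.* 5
      cube≡ = trans (ℕ.*-identityʳ (p ℕ.^ 3)) (trans (ℕ.*-comm p (p ℕ.^ 2)) (cong (p ℕ.^ 2 ℕ.*_) p≡5))
      p∤1 : ¬ (p ℕ∣.∣ 1)
      p∤1 p∣1 = ¬prime[1] (subst Prime (ℕ∣.∣1⇒≡1 p∣1) p-prime)
      reps-125 : reps (p ℕ.^ 2 ℕ.* 5) % 2 ≡ 0
      reps-125 = subst (λ N → reps N % 2 ≡ 0) cube≡ (reps-even p-prime 0 1 p∤1 (trans (cong (_% 8) cube≡) (odd-square*5%8 p p-odd)))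
      p∣argument : + p ∣ - + (5 ℕ.* (p ℕ.^ 2 ∸ 1) / 4)
      p∣argument = subst (λ t → + p ∣ - + t) (sym argument)
        (∣m⇒∣-m (∣ᵤ⇒∣ (subst (ℕ∣._∣ 10 ℕ.* u) (sym p≡5) (ℕ∣.∣m⇒∣m*n u (ℕ∣.divides 2 refl)))))

    κ-even-≢5 : p ≢ 5 → + 2 ∣ κ p
    κ-even-≢5 p≢5 = ∣-resp-mod {x = κ p} {y = 1ℤ + 1ℤ * 1ℤ}
      (mod-+ (mod-trans c≡reps (mod-reflexive (cong +_ (reps-p²*5 p-prime p-odd p≢5))))
        (mod-* {x = + (p ℕ.^ 3)} {1ℤ} {leg} {1ℤ} p³≡1 (legendre-unit _ p (subst (λ t → ¬ (+ p ∣ - + t)) (sym argument) (p∤argument p≢5)))))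
      (divides 1ℤ refl)

    -- For p ≠ 5 both summands of κ are odd, and for p = 5 both are even.
    κ-even : κ p %ℕ 2 ≡ 0
    κ-even = ∣⇒%ℕ2≡0 (κ p) (by-cases (p ≟ 5))
      where
      by-cases : Dec (p ≡ 5) → + 2 ∣ κ p
      by-cases (yes p≡5) = κ-even-5 p≡5
      by-cases (no p≢5)  = κ-even-≢5 p≢5

    ν≡4 : ν p ≡ 4
    ν≡4 = cong (λ r → if r ℕ.≡ᵇ 0 then 4 else 6) κ-even

    p^even%8 : ∀ j → p ℕ.^ (2 ℕ.* j) % 8 ≡ 1
    p^even%8 j = trans (cong (_% 8) (trans (sym (ℕ.^-*-assoc p 2 j)) (cong (ℕ._^ j) (cong (p ℕ.*_) (ℕ.*-identityʳ p))))) (go j)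
      where
      go : ∀ j → (p ℕ.* p) ℕ.^ j % 8 ≡ 1
      go zero    = refl
      go (suc j) = trans (%-distribˡ-* (p ℕ.* p) ((p ℕ.* p) ℕ.^ j) 8) (cong₂ (λ r s → (r ℕ.* s) % 8) (odd-square%8 p p-odd) (go j))

    -- Modulo p the cofactor is 8n, and a prime p ≥ 3 does not divide 8.
    p∤cofactor : ∀ n → ¬ (p ℕ∣.∣ n) → ¬ (p ℕ∣.∣ 8 ℕ.* n ℕ.+ 5 ℕ.* p)
    p∤cofactor n p∤n p∣ with euclidsLemma 8 n p-prime (ℕ∣.∣m+n∣m⇒∣n (subst (p ℕ∣.∣_) (ℕ.+-comm (8 ℕ.* n) (5 ℕ.* p)) p∣) (ℕ∣.n∣m*n 5))
    ... | inj₂ p∣n = p∤n p∣n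
    ... | inj₁ p∣8 = contradiction (ℕ∣.∣⇒≤ (p∣2 (euclidsLemma 2 4 p-prime p∣8))) (ℕ.<⇒≱ p≥3)
      where
      p∣2 : p ℕ∣.∣ 2 ⊎ p ℕ∣.∣ 4 → p ℕ∣.∣ 2
      p∣2 (inj₁ d) = d
      p∣2 (inj₂ d) with euclidsLemma 2 2 p-prime d
      ... | inj₁ e = e
      ... | inj₂ e = e

    -- The exponent is a variable with a proof that it is 4, so the results can be instantiated at
    -- `ν p` as it stands in the theorem.
    module Progression {e : ℕ} (e≡4 : e ≡ 4) where

      exponent : ∀ k → e ℕ.* (k ℕ.+ 1) ≡ suc (3 ℕ.+ 4 ℕ.* k)
      exponent k = trans (cong (ℕ._* (k ℕ.+ 1)) e≡4) (eq k)
        where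
        eq : ∀ k → 4 ℕ.* (k ℕ.+ 1) ≡ 4 ℕ.+ 4 ℕ.* k
        eq = solve-∀

      progression : ℕ → ℕ → ℕ
      progression n k = 8 ℕ.* p ℕ.^ (e ℕ.* (k ℕ.+ 1) ∸ 1) ℕ.* n ℕ.+ 5 ℕ.* p ℕ.^ (e ℕ.* (k ℕ.+ 1))

      progression≡ : ∀ n k → progression n k ≡ p ℕ.^ (3 ℕ.+ 4 ℕ.* k) ℕ.* (8 ℕ.* n ℕ.+ 5 ℕ.* p)
      progression≡ n k = trans (cong (λ i → 8 ℕ.* p ℕ.^ (i ∸ 1) ℕ.* n ℕ.+ 5 ℕ.* p ℕ.^ i) (exponent k)) (eq (p ℕ.^ (3 ℕ.+ 4 ℕ.* k)) n p)
        where
        eq : ∀ x n p → 8 ℕ.* x ℕ.* n ℕ.+ 5 ℕ.* (p ℕ.* x) ≡ x ℕ.* (8 ℕ.* n ℕ.+ 5 ℕ.* p)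
        eq = solve-∀

      -- The second summand is 5 times a power of p², and odd squares are 1 modulo 8.
      progression%8 : ∀ n k → progression n k % 8 ≡ 5
      progression%8 n k = trans (cong (_% 8) (trans (cong (λ i → 8 ℕ.* p ℕ.^ (e ℕ.* (k ℕ.+ 1) ∸ 1) ℕ.* n ℕ.+ 5 ℕ.* p ℕ.^ i) (trans (exponent k) (eq₁ k)))
            (eq₂ (p ℕ.^ (e ℕ.* (k ℕ.+ 1) ∸ 1)) n (p ℕ.^ (2 ℕ.* (2 ℕ.+ 2 ℕ.* k))))))
        (trans ([m+kn]%n≡m%n (5 ℕ.* p ℕ.^ (2 ℕ.* (2 ℕ.+ 2 ℕ.* k))) (p ℕ.^ (e ℕ.* (k ℕ.+ 1) ∸ 1) ℕ.* n) 8)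
          (trans (%-distribˡ-* 5 (p ℕ.^ (2 ℕ.* (2 ℕ.+ 2 ℕ.* k))) 8) (cong (λ r → (5 ℕ.* r) % 8) (p^even%8 (2 ℕ.+ 2 ℕ.* k)))))
        where
        eq₁ : ∀ k → 4 ℕ.+ 4 ℕ.* k ≡ 2 ℕ.* (2 ℕ.+ 2 ℕ.* k)
        eq₁ = solve-∀
        eq₂ : ∀ x n z → 8 ℕ.* x ℕ.* n ℕ.+ 5 ℕ.* z ≡ 5 ℕ.* z ℕ.+ x ℕ.* n ℕ.* 8
        eq₂ = solve-∀

      reps-progression : ∀ n k → ¬ (p ℕ∣.∣ n) → reps (progression n k) % 2 ≡ 0
      reps-progression n k p∤n = trans (cong (λ N → reps N % 2) (progression≡ n k))
        (reps-even p-prime k (8 ℕ.* n ℕ.+ 5 ℕ.* p) (p∤cofactor n p∤n) (trans (cong (_% 8) (sym (progression≡ n k))) (progression%8 n k)))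

  overpartition-congruences : ∀ m α β N → m ≥ 1 → α ≥ 1 → N % 8 ≡ 5 → reps N % 2 ≡ 0 →
    (2 ℕ.^ (m ℕ.+ 3) ℕ∣.∣ ā (2 ℕ.^ m ℕ.* α) N) × (16 ℕ∣.∣ ā (2 ℕ.* β ℕ.+ 1) N)
  overpartition-congruences (suc j) α β N _ α≥1 N%8≡5 reps-even =
      subst₂ (λ d s → d ℕ∣.∣ ā s N) (cong (2 ℕ.^_) (trans (cong (4 ℕ.+_) (sym (ℕ.+-identityʳ j))) (exp j))) (sym s≡)
        (subst (λ N → 2 ℕ.^ (4 ℕ.+ j) ℕ∣.∣ ā (suc (suc (2 ℕ.* k))) N) (sym N≡) (overpartitions-even j α k (sym s≡)))
    , subst₂ (λ s N → 16 ℕ∣.∣ ā s N) (ℕ.+-comm 1 (2 ℕ.* β)) (sym N≡) (overpartitions-odd β)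
    where
    h k : ℕ
    h = N / 2
    -- Chosen so that s = 2^(j+1) α equals 2k + 2, which makes the exponent s - 1 of φ₂ visibly odd.
    k = ℕ.pred (2 ℕ.^ j ℕ.* α)
    N≡ : N ≡ suc (h ℕ.* 2)
    N≡ = trans (m≡m%n+[m/n]*n N 2) (cong (ℕ._+ h ℕ.* 2) (trans (sym (m∣n⇒o%n%m≡o%m 2 8 N (ℕ∣.divides 4 refl))) (cong (_% 2) N%8≡5)))
    open Coefficients h (trans (cong (_% 8) (sym N≡)) N%8≡5) (trans (cong (λ N → reps N % 2) (sym N≡)) reps-even)
      using (overpartitions-even; overpartitions-odd)
    exp : ∀ j → 4 ℕ.+ (j ℕ.+ 0) ≡ suc j ℕ.+ 3
    exp = solve-∀
    s≡ : 2 ℕ.^ suc j ℕ.* α ≡ suc (suc (2 ℕ.* k))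
    s≡ = trans (ℕ.*-assoc 2 (2 ℕ.^ j) α) (trans (cong (2 ℕ.*_) (sym (ℕ.suc-pred (2 ℕ.^ j ℕ.* α) {{nonzero}}))) (ℕ.*-suc 2 k))
      where
      nonzero : NonZero (2 ℕ.^ j ℕ.* α)
      nonzero = ℕ.m*n≢0 (2 ℕ.^ j) α {{ℕ.m^n≢0 2 j}} {{ℕ.>-nonZero α≥1}}

open import Data.Nat.Base using (ℕ; _+_; _*_; _∸_; _^_; _≥_)
open import Data.Nat.Divisibility using (_∣_)
open import Data.Nat.Primality using (Prime)
open import Data.Integer.Base using (_%ℕ_)
open import Data.Product.Base using (_×_)
open import Relation.Binary.PropositionalEquality using (_≡_)
open import Relation.Nullary.Negation using (¬_)
open import Data.Product.Base using (_,_)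
open import Relation.Binary.PropositionalEquality using (sym; trans)
open import Relation.Nullary.Negation using (contradiction)
open Congruences using (overpartition-congruences; module OddPrime)

theorem1p10 :
  ∀ (m α β p : ℕ) → m ≥ 1 → α ≥ 1 → β ≥ 1 → ¬ (2 ∣ α) → p ≥ 3 → Prime p →
    (∀ (n k : ℕ) → ¬ (p ∣ n) →
        (2 ^ (m + 3) ∣ ā (2 ^ m * α) (8 * p ^ (ν p * (k + 1) ∸ 1) * n + 5 * p ^ (ν p * (k + 1))))
      × (16 ∣ ā (2 * β + 1) (8 * p ^ (ν p * (k + 1) ∸ 1) * n + 5 * p ^ (ν p * (k + 1)))))
    ×
    (κ p %ℕ 2 ≡ 1 →
      ∀ (n k : ℕ) → ¬ (p ∣ 8 * n + 5) →
        (2 ^ (m + 3) ∣ ā (2 ^ m * α) (8 * p ^ (6 * k + 2) * n + 5 * p ^ (6 * k + 2)))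
      × (16 ∣ ā (2 * β + 1) (8 * p ^ (6 * k + 2) * n + 5 * p ^ (6 * k + 2))))
theorem1p10 m α β p m≥1 α≥1 _ _ p≥3 p-prime =
    first-part (ν p) ν≡4
  , (λ κ-odd → contradiction (trans (sym κ-even) κ-odd) λ ())
  where
  open OddPrime p-prime p≥3
  first-part : ∀ e → e ≡ 4 → ∀ n k → ¬ (p ∣ n) →
      (2 ^ (m + 3) ∣ ā (2 ^ m * α) (8 * p ^ (e * (k + 1) ∸ 1) * n + 5 * p ^ (e * (k + 1))))
    × (16 ∣ ā (2 * β + 1) (8 * p ^ (e * (k + 1) ∸ 1) * n + 5 * p ^ (e * (k + 1))))
  first-part e e≡4 n k p∤n =
    overpartition-congruences m α β (progression n k) m≥1 α≥1 (progression%8 n k) (reps-progression n k p∤n)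
    where open Progression e≡4
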